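{- For an integer $n\ge 1$, let $E(n)$ be the number of edges of the $(n,n,n)$ sort graph and let $T(n)=n\,E(n)$ be the cost (number of edges times payload size $d=n$) of the recursive breadth-first enumeration of octagonal tilings of the octagon with side lengths $a=b=c=d=n$. Then $$ T(n)=n^2\,\frac{(3n)!}{(n!)^3}\;\sim\;\frac{n\sqrt3}{2\pi}\,3^{3n}\qquad (n\to\infty), $$ where $\sim$ means that the ratio tends to $1$. Consequently, in terms of the number $N=6n^2$ of tiles of the octagonal tiling, there is a constant $\gamma>0$ such that the cost is $O\!\left(\sqrt N\,\exp(\gamma\sqrt N)\right)$.
   Context: For nonnegative integers $a,b,c$, the $(a,b,c)$ sort graph is the directed graph whose vertices are the sequences of length $a+b+c$ with exactly $a$ entries $0$, $b$ entries $1$ and $c$ entries $2$; there is an edge from $u$ to $v$ iff $v$ is obtained from $u$ by exchanging two adjacent entries $u_j<u_{j+1}$. The enumeration algorithm computes the number $\Omega(a,b,c,d)$ of tilings, by unit squares and unit $45^\circ$ rhombi, of a centro-symmetric octagon with consecutive integer side lengths $a,b,c,d$ (and $N=ac+bd+(a+c)(b+d)$ tiles). It does so by a single breadth-first pass through the $(a,b,c)$ sort graph, storing on each edge a list (the payload) of at most about $d$ counts. Its time complexity is measured as the product of the number of edges and the payload size $d$. -}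

module Defs where

open import Data.Fin.Base as Fin using (Fin)
open import Data.Fin.Patterns using (0F; 1F; 2F)
import Data.Fin.Properties as Fin
open import Data.Integer.Base as ℤ using (+_)
import Data.Integer.Properties as ℤ
open import Data.List.Base using (List; []; _∷_; allFin; applyUpTo; cartesianProduct; cartesianProductWith; filter; length)
open import Data.Nat.Base as ℕ using (ℕ; zero; suc; z≤n; s≤s; _!)
open import Data.Nat.ListAction using (sum)
import Data.Nat.Properties as ℕ
import Data.Nat.Solver as ℕ
open import Data.Product.Base using (∃-syntax; Σ-syntax; _×_; _,_; proj₁; proj₂)
open import Data.Rational.Base
open import Data.Rational.Properties
open import Data.Rational.Solver using (module +-*-Solver)
import Data.Rational.Unnormalised.Base as ℚᵘ
import Data.Rational.Unnormalised.Properties as ℚᵘ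
open import Data.Sum.Base using (_⊎_; inj₁; inj₂)
open import Data.Vec.Base as Vec using (Vec; []; _∷_)
import Data.Vec.Properties as Vec
open import Relation.Binary.PropositionalEquality
open import Relation.Nullary using (yes; no; ¬_; contradiction)
open import Relation.Nullary.Decidable as Dec using (Dec; _×-dec_; _⊎-dec_)
open import Algebra.Definitions.RawSemiring +-*-rawSemiring using (_^_)

-- Total reciprocal, with value 0 at 0: the first terms of a Cauchy sequence with
-- a nonzero limit may still vanish.
invℚ : ℚ → ℚ
invℚ p with p ≟ 0ℚ
... | yes _   = 0ℚ
... | no p≢0 = (1/ p) {{≢-nonZero p≢0}}

module RationalLemmas where
  open +-*-Solver using (solve; _:+_; _:*_; _:=_; :-_; _:-_; con)

  fracᵘ : ∀ a b → toℚᵘ (+ a / suc b) ℚᵘ.≃ ℚᵘ.mkℚᵘ (+ a) b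
  fracᵘ a b = toℚᵘ-fromℚᵘ (ℚᵘ.mkℚᵘ (+ a) b)

  frac-≤ : ∀ a b c d → a ℕ.* suc d ℕ.≤ c ℕ.* suc b → + a / suc b ≤ + c / suc d
  frac-≤ a b c d le = toℚᵘ-cancel-≤
    (ℚᵘ.≤-respˡ-≃ (ℚᵘ.≃-sym (fracᵘ a b)) (ℚᵘ.≤-respʳ-≃ (ℚᵘ.≃-sym (fracᵘ c d))
      (ℚᵘ.*≤* (subst₂ ℤ._≤_ (ℤ.pos-* a (suc d)) (ℤ.pos-* c (suc b)) (ℤ.+≤+ le)))))

  frac-+ : ∀ a b c d → + a / suc b + + c / suc d ≡ + (a ℕ.* suc d ℕ.+ c ℕ.* suc b) / (suc b ℕ.* suc d)
  frac-+ a b c d = toℚᵘ-injective (ℚᵘ.≃-trans (toℚᵘ-homo-+ (+ a / suc b) (+ c / suc d))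
    (ℚᵘ.≃-trans (ℚᵘ.+-cong (fracᵘ a b) (fracᵘ c d))
    (ℚᵘ.≃-trans (ℚᵘ.*≡* (cong (ℤ._* (+ suc b ℤ.* + suc d)) eq))
      (ℚᵘ.≃-sym (fracᵘ (a ℕ.* suc d ℕ.+ c ℕ.* suc b) (d ℕ.+ b ℕ.* suc d))))))
    where
    eq : + a ℤ.* + suc d ℤ.+ + c ℤ.* + suc b ≡ + (a ℕ.* suc d ℕ.+ c ℕ.* suc b)
    eq = trans (cong₂ ℤ._+_ (sym (ℤ.pos-* a (suc d))) (sym (ℤ.pos-* c (suc b))))
           (sym (ℤ.pos-+ (a ℕ.* suc d) (c ℕ.* suc b)))

  frac-≤-+ : ∀ a b c d e f → a ℕ.* (suc d ℕ.* suc f) ℕ.≤ (c ℕ.* suc f ℕ.+ e ℕ.* suc d) ℕ.* suc b →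
             + a / suc b ≤ + c / suc d + + e / suc f
  frac-≤-+ a b c d e f le = subst (+ a / suc b ≤_) (sym (frac-+ c d e f))
    (frac-≤ a b (c ℕ.* suc f ℕ.+ e ℕ.* suc d) (f ℕ.+ d ℕ.* suc f) le)

  frac-* : ∀ k d .{{_ : ℕ.NonZero d}} .{{_ : ℕ.NonZero (suc k ℕ.* d)}} →
           (+ 1 / (suc k ℕ.* d)) * (+ suc k / 1) ≡ + 1 / d
  frac-* k (suc d) = toℚᵘ-injective (ℚᵘ.≃-trans (toℚᵘ-homo-* (+ 1 / (suc k ℕ.* suc d)) (+ suc k / 1))
    (ℚᵘ.≃-trans (ℚᵘ.*-cong (fracᵘ 1 (d ℕ.+ k ℕ.* suc d)) (fracᵘ (suc k) 0))
    (ℚᵘ.≃-trans (ℚᵘ.*≡* eq) (ℚᵘ.≃-sym (fracᵘ 1 d)))))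
    where
    eq : (+ 1 ℤ.* + suc k) ℤ.* + suc d ≡ + 1 ℤ.* (+ (suc k ℕ.* suc d) ℤ.* + 1)
    eq = trans (cong (ℤ._* + suc d) (ℤ.*-identityˡ (+ suc k)))
      (trans (sym (ℤ.pos-* (suc k) (suc d)))
        (sym (trans (ℤ.*-identityˡ (+ (suc k ℕ.* suc d) ℤ.* + 1)) (ℤ.*-identityʳ (+ (suc k ℕ.* suc d))))))

  frac-pos : ∀ a b → 0 ℕ.< a → 0ℚ < + a / suc b
  frac-pos (suc a) b _ = positive⁻¹ (+ suc a / suc b) {{normalize-pos (suc a) (suc b)}}

  frac-nonNeg : ∀ a b → 0ℚ ≤ + a / suc b
  frac-nonNeg a b = nonNegative⁻¹ (+ a / suc b) {{normalize-nonNeg a (suc b)}}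

  archimedean : ∀ C ε → 0ℚ < ε → ∃[ N ] (∀ n → N ℕ.≤ n → + C / suc n ≤ ε)
  archimedean C (mkℚ (+ zero) d c) 0<ε = contradiction 0<ε λ { (*<* (ℤ.+<+ ())) }
  archimedean C (mkℚ (ℤ.-[1+ p ]) d c) 0<ε = contradiction 0<ε λ { (*<* ()) }
  archimedean C (mkℚ (+ suc p) d c) 0<ε = C ℕ.* suc d , λ n le →
    subst (+ C / suc n ≤_) (↥p/↧p≡p (mkℚ (+ suc p) d c))
      (frac-≤ C n (suc p) d (ℕ.≤-trans le (ℕ.≤-trans (ℕ.n≤1+n n) (ℕ.m≤n*m (suc n) (suc p)))))

  natBound : ∀ q → ∃[ n ] q ≤ + n / 1
  natBound (mkℚ (ℤ.-[1+ p ]) d c) = 0 , ≤-trans (<⇒≤ (negative⁻¹ (mkℚ (ℤ.-[1+ p ]) d c))) (frac-nonNeg 0 0)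
  natBound (mkℚ (+ p) d c) = p , subst (_≤ + p / 1) (↥p/↧p≡p (mkℚ (+ p) d c))
      (frac-≤ p d p 0 (ℕ.*-monoʳ-≤ p (s≤s z≤n)))

  ½+½ : ∀ ε → ½ * ε + ½ * ε ≡ ε
  ½+½ ε = trans (sym (*-distribʳ-+ ε ½ ½)) (*-identityˡ ε)

  0<½* : ∀ {ε} → 0ℚ < ε → 0ℚ < ½ * ε
  0<½* {ε} p = subst (_< ½ * ε) (*-zeroʳ ½) (*-monoʳ-<-pos ½ p)

  *-mono : ∀ {p q r s} → 0ℚ ≤ p → 0ℚ ≤ s → p ≤ q → r ≤ s → p * r ≤ q * s
  *-mono {p} {q} {r} {s} 0≤p 0≤s p≤q r≤s = ≤-trans
    (*-monoˡ-≤-nonNeg p {{nonNegative 0≤p}} r≤s) (*-monoʳ-≤-nonNeg s {{nonNegative 0≤s}} p≤q)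

  0≤* : ∀ {p q} → 0ℚ ≤ p → 0ℚ ≤ q → 0ℚ ≤ p * q
  0≤* {p} {q} a b = subst (_≤ p * q) (*-zeroˡ q) (*-mono ≤-refl b a ≤-refl)

  0≤+ : ∀ {p q} → 0ℚ ≤ p → 0ℚ ≤ q → 0ℚ ≤ p + q
  0≤+ {p} {q} a b = subst (_≤ p + q) (+-identityˡ 0ℚ) (+-mono-≤ a b)

  p≤p+q : ∀ {p q} → 0ℚ ≤ q → p ≤ p + q
  p≤p+q {p} {q} a = subst (_≤ p + q) (+-identityʳ p) (+-monoʳ-≤ p a)

  shrink : ∀ K → 0ℚ ≤ K → ∀ ε → 0ℚ < ε → ∃[ δ ] (0ℚ < δ × K * δ ≤ ε)
  shrink K 0≤K ε 0<ε = δ , 0<δ , ≤-trans (*-monoʳ-≤-nonNeg δ {{nonNegative (<⇒≤ 0<δ)}} (p≤p+q {K} (frac-nonNeg 1 0)))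
    (≤-reflexive (trans (sym (*-assoc K′ (1/ K′) ε)) (trans (cong (_* ε) (*-inverseʳ K′)) (*-identityˡ ε))))
    where
    K′ = K + 1ℚ
    instance
      K′-pos : Positive K′
      K′-pos = nonNeg+pos⇒pos K {{nonNegative 0≤K}} 1ℚ
      K′-nz : NonZero K′
      K′-nz = pos⇒nonZero K′
    δ = 1/ K′ * ε
    0<δ : 0ℚ < δ
    0<δ = positive⁻¹ δ {{pos*pos⇒pos (1/ K′) {{1/pos⇒pos K′}} ε {{positive 0<ε}}}}

  ∣-∣-sym : ∀ p q → ∣ p - q ∣ ≡ ∣ q - p ∣
  ∣-∣-sym p q = trans (sym (∣-p∣≡∣p∣ (p - q))) (cong ∣_∣ (solve 2 (λ p q → :- (p :- q) := q :- p) refl p q))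

  ∣-∣-tri : ∀ p q r → ∣ p - r ∣ ≤ ∣ p - q ∣ + ∣ q - r ∣
  ∣-∣-tri p q r = subst (λ z → ∣ z ∣ ≤ ∣ p - q ∣ + ∣ q - r ∣)
    (solve 3 (λ p q r → (p :- q) :+ (q :- r) := p :- r) refl p q r) (∣p+q∣≤∣p∣+∣q∣ (p - q) (q - r))

  ∣-∣-≤ : ∀ {p q r} → p ≤ q + r → q ≤ p + r → ∣ p - q ∣ ≤ r
  ∣-∣-≤ {p} {q} {r} a b with ∣p∣≡p∨∣p∣≡-p (p - q)
  ... | inj₁ e = subst₂ _≤_ (sym e) (solve 2 (λ q r → (q :+ r) :- q := r) refl q r) (+-monoˡ-≤ (- q) a)
  ... | inj₂ e = subst₂ _≤_ (trans (solve 2 (λ p q → q :- p := :- (p :- q)) refl p q) (sym e))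
                   (solve 2 (λ q r → (q :+ r) :- q := r) refl p r) (+-monoˡ-≤ (- p) b)

  p≤∣p∣ : ∀ p → p ≤ ∣ p ∣
  p≤∣p∣ p with ≤-total 0ℚ p
  ... | inj₁ a = ≤-reflexive (sym (0≤p⇒∣p∣≡p a))
  ... | inj₂ a = ≤-trans a (0≤∣p∣ p)

  ∣-∣-≤⁻¹ : ∀ {p q r} → ∣ p - q ∣ ≤ r → p ≤ q + r
  ∣-∣-≤⁻¹ {p} {q} {r} a = subst (_≤ q + r) (solve 2 (λ p q → q :+ (p :- q) := p) refl p q)
    (+-monoʳ-≤ q (≤-trans (p≤∣p∣ (p - q)) a))

  ∣*∣-≤ : ∀ {p q a b} → ∣ p ∣ ≤ a → ∣ q ∣ ≤ b → ∣ p * q ∣ ≤ a * b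
  ∣*∣-≤ {p} {q} {a} {b} x y = subst (_≤ a * b) (sym (∣p*q∣≡∣p∣*∣q∣ p q))
    (*-mono (0≤∣p∣ p) (≤-trans (0≤∣p∣ q) y) x y)

  invℚ-* : ∀ {p} → p ≢ 0ℚ → invℚ p * p ≡ 1ℚ
  invℚ-* {p} p≢0 with p ≟ 0ℚ
  ... | yes e   = contradiction e p≢0
  ... | no p≢0′ = *-inverseˡ p {{≢-nonZero p≢0′}}

open RationalLemmas

-- Real numbers are Cauchy sequences of rationals; `cauchy` carries the modulus of
-- convergence.

IsCauchy : (ℕ → ℚ) → Set
IsCauchy x = ∀ ε → 0ℚ < ε → ∃[ N ] (∀ m n → N ℕ.≤ m → N ℕ.≤ n → ∣ x m - x n ∣ ≤ ε)

record ℝ : Set where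
  constructor mkℝ
  field
    seq    : ℕ → ℚ
    cauchy : IsCauchy seq

open ℝ public

infix 4 _<ℝ_ _≤ℝ_ _#ℝ_

_<ℝ_ _≤ℝ_ _#ℝ_ : ℝ → ℝ → Set
x <ℝ y = ∃[ ε ] (0ℚ < ε × ∃[ N ] (∀ n → N ℕ.≤ n → seq x n + ε ≤ seq y n))
x ≤ℝ y = ∀ ε → 0ℚ < ε → ∃[ N ] (∀ n → N ℕ.≤ n → seq x n ≤ seq y n + ε)
x #ℝ y = x <ℝ y ⊎ y <ℝ x

module CauchyLemmas where
  open +-*-Solver using (solve; _:+_; _:*_; _:=_; :-_; _:-_; con)

  one-sided : ∀ x → (∀ ε → 0ℚ < ε → ∃[ N ] (∀ m n → N ℕ.≤ m → N ℕ.≤ n → x m ≤ x n + ε)) → IsCauchy x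
  one-sided x h ε 0<ε with h ε 0<ε
  ... | N , k = N , λ m n a b → ∣-∣-≤ (k m n a b) (k n m b a)

  scaled : ∀ x K → 0ℚ ≤ K →
           (∀ δ → 0ℚ < δ → ∃[ N ] (∀ m n → N ℕ.≤ m → N ℕ.≤ n → ∣ x m - x n ∣ ≤ K * δ)) → IsCauchy x
  scaled x K 0≤K h ε 0<ε with shrink K 0≤K ε 0<ε
  ... | δ , 0<δ , Kδ≤ε with h δ 0<δ
  ... | N , k = N , λ m n a b → ≤-trans (k m n a b) Kδ≤ε

  bound : ∀ x → IsCauchy x → ∃[ B ] (0ℚ ≤ B × ∃[ N ] (∀ n → N ℕ.≤ n → ∣ x n ∣ ≤ B))
  bound x cx with cx 1ℚ (positive⁻¹ 1ℚ)
  ... | N , h = 1ℚ + ∣ x N ∣ , 0≤+ (frac-nonNeg 1 0) (0≤∣p∣ (x N)) , N , λ n a →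
    subst (λ z → ∣ z ∣ ≤ 1ℚ + ∣ x N ∣) (solve 2 (λ p q → (p :- q) :+ q := p) refl (x n) (x N))
      (≤-trans (∣p+q∣≤∣p∣+∣q∣ (x n - x N) (x N)) (+-monoˡ-≤ ∣ x N ∣ (h n N a ℕ.≤-refl)))

  const-cauchy : ∀ q → IsCauchy (λ _ → q)
  const-cauchy q ε 0<ε = 0 , λ m n _ _ → ∣-∣-≤ le le
    where
    le : q ≤ q + ε
    le = p≤p+q {q} (<⇒≤ 0<ε)

  sub-cauchy : ∀ x y → IsCauchy x → IsCauchy y → IsCauchy (λ n → x n - y n)
  sub-cauchy x y cx cy ε 0<ε with cx (½ * ε) (0<½* 0<ε) | cy (½ * ε) (0<½* 0<ε)
  ... | N , h | M , k = N ℕ.⊔ M , λ m n a b → subst₂ _≤_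
      (cong ∣_∣ (solve 4 (λ p q r s → (p :- r) :+ (s :- q) := (p :- q) :- (r :- s)) refl (x m) (y m) (x n) (y n)))
      (½+½ ε)
      (≤-trans (∣p+q∣≤∣p∣+∣q∣ (x m - x n) (y n - y m))
        (+-mono-≤ (h m n (ℕ.m⊔n≤o⇒m≤o N M a) (ℕ.m⊔n≤o⇒m≤o N M b))
                  (k n m (ℕ.m⊔n≤o⇒n≤o N M b) (ℕ.m⊔n≤o⇒n≤o N M a))))

  abs-cauchy : ∀ x → IsCauchy x → IsCauchy (λ n → ∣ x n ∣)
  abs-cauchy x cx = one-sided (λ n → ∣ x n ∣) λ ε 0<ε → let (N , h) = cx ε 0<ε in N , λ m n a b →
    ≤-trans (subst (λ z → ∣ z ∣ ≤ ∣ x n ∣ + ∣ x m - x n ∣)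
        (solve 2 (λ p q → q :+ (p :- q) := p) refl (x m) (x n)) (∣p+q∣≤∣p∣+∣q∣ (x n) (x m - x n)))
      (+-monoʳ-≤ ∣ x n ∣ (h m n a b))

  product-difference : ∀ p q r s → p * (q - s) + (p - r) * s ≡ p * q - r * s
  product-difference = solve 4 (λ p q r s → p :* (q :- s) :+ (p :- r) :* s := p :* q :- r :* s) refl

  product-bound : ∀ p q r s B C δ → ∣ p ∣ ≤ B → ∣ s ∣ ≤ C → ∣ p - r ∣ ≤ δ → ∣ q - s ∣ ≤ δ →
                  ∣ p * q - r * s ∣ ≤ (B + C) * δ
  product-bound p q r s B C δ p≤ s≤ pr qs = begin
    ∣ p * q - r * s ∣                          ≡⟨ cong ∣_∣ (product-difference p q r s) ⟨
    ∣ p * (q - s) + (p - r) * s ∣             ≤⟨ ∣p+q∣≤∣p∣+∣q∣ (p * (q - s)) ((p - r) * s) ⟩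
    ∣ p * (q - s) ∣ + ∣ (p - r) * s ∣         ≤⟨ +-mono-≤ (∣*∣-≤ {p} {q - s} p≤ qs) (∣*∣-≤ {p - r} {s} pr s≤) ⟩
    B * δ + δ * C                              ≡⟨ cong (λ z → B * δ + z) (*-comm δ C) ⟩
    B * δ + C * δ                              ≡⟨ *-distribʳ-+ δ B C ⟨
    (B + C) * δ                                ∎
    where open ≤-Reasoning

  mul-cauchy : ∀ x y → IsCauchy x → IsCauchy y → IsCauchy (λ n → x n * y n)
  mul-cauchy x y cx cy = go (bound x cx) (bound y cy)
    where
    go : ∃[ B ] (0ℚ ≤ B × ∃[ N ] (∀ n → N ℕ.≤ n → ∣ x n ∣ ≤ B)) →
         ∃[ C ] (0ℚ ≤ C × ∃[ N ] (∀ n → N ℕ.≤ n → ∣ y n ∣ ≤ C)) → IsCauchy (λ n → x n * y n)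
    go (B , 0≤B , M , hB) (C , 0≤C , M′ , hC) = scaled (λ n → x n * y n) (B + C) (0≤+ 0≤B 0≤C) step
      where
      step : ∀ δ → 0ℚ < δ →
             ∃[ N ] (∀ m n → N ℕ.≤ m → N ℕ.≤ n → ∣ x m * y m - x n * y n ∣ ≤ (B + C) * δ)
      step δ 0<δ with cx δ 0<δ | cy δ 0<δ
      ... | N , h | N′ , h′ = M ℕ.+ M′ ℕ.+ (N ℕ.+ N′) , λ m n a b →
        product-bound (x m) (y m) (x n) (y n) B C δ
          (hB m (ℕ.m+n≤o⇒m≤o M (ℕ.m+n≤o⇒m≤o (M ℕ.+ M′) a)))
          (hC n (ℕ.m+n≤o⇒n≤o M (ℕ.m+n≤o⇒m≤o (M ℕ.+ M′) b)))
          (h m n (ℕ.m+n≤o⇒m≤o N (ℕ.m+n≤o⇒n≤o (M ℕ.+ M′) a)) (ℕ.m+n≤o⇒m≤o N (ℕ.m+n≤o⇒n≤o (M ℕ.+ M′) b)))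
          (h′ m n (ℕ.m+n≤o⇒n≤o N (ℕ.m+n≤o⇒n≤o (M ℕ.+ M′) a)) (ℕ.m+n≤o⇒n≤o N (ℕ.m+n≤o⇒n≤o (M ℕ.+ M′) b)))

  AwayFrom0 : (ℕ → ℚ) → Set
  AwayFrom0 x = ∃[ δ ] (0ℚ < δ × ∃[ N ] (∀ n → N ℕ.≤ n → δ ≤ ∣ x n ∣))

  invℚ-bound : ∀ {p δ} (0<δ : 0ℚ < δ) → δ ≤ ∣ p ∣ → p ≢ 0ℚ × ∣ invℚ p ∣ ≤ (1/ δ) {{>-nonZero 0<δ}}
  invℚ-bound {p} {δ} 0<δ δ≤ = p≢0 ,
    *-cancelʳ-≤-pos δ {{positive 0<δ}} (≤-trans (*-monoˡ-≤-nonNeg ∣ invℚ p ∣ {{nonNegative (0≤∣p∣ (invℚ p))}} δ≤)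
      (≤-reflexive (trans (sym (∣p*q∣≡∣p∣*∣q∣ (invℚ p) p)) (trans (cong ∣_∣ (invℚ-* p≢0))
        (sym (*-inverseˡ δ {{>-nonZero 0<δ}}))))))
    where
    p≢0 : p ≢ 0ℚ
    p≢0 refl = contradiction 0<δ (≤⇒≯ δ≤)
      where
      ≤⇒≯ : ∀ {p q} → p ≤ q → ¬ (q < p)
      ≤⇒≯ a b = <-irrefl refl (<-≤-trans b a)

  inverse-difference : ∀ p q i j → (i * j) * (q - p) ≡ i * (j * q) - j * (i * p)
  inverse-difference = solve 4 (λ p q i j → (i :* j) :* (q :- p) := i :* (j :* q) :- j :* (i :* p)) refl

  inverse-bound : ∀ p q D η → p ≢ 0ℚ → q ≢ 0ℚ → ∣ invℚ p ∣ ≤ D → ∣ invℚ q ∣ ≤ D → ∣ q - p ∣ ≤ η →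
                  ∣ invℚ p - invℚ q ∣ ≤ D * D * η
  inverse-bound p q D η p≢0 q≢0 pD qD qp = begin
    ∣ i - j ∣                         ≡⟨ cong ∣_∣ (cong₂ _-_ (*-identityʳ i) (*-identityʳ j)) ⟨
    ∣ i * 1ℚ - j * 1ℚ ∣               ≡⟨ cong ∣_∣ (cong₂ (λ u v → i * u - j * v) (invℚ-* q≢0) (invℚ-* p≢0)) ⟨
    ∣ i * (j * q) - j * (i * p) ∣     ≡⟨ cong ∣_∣ (inverse-difference p q i j) ⟨
    ∣ (i * j) * (q - p) ∣             ≤⟨ ∣*∣-≤ {i * j} {q - p} (∣*∣-≤ {i} {j} pD qD) qp ⟩
    D * D * η                         ∎
    where
    open ≤-Reasoning
    i j : ℚ
    i = invℚ p
    j = invℚ q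

  inv-cauchy : ∀ x → IsCauchy x → AwayFrom0 x → IsCauchy (λ n → invℚ (x n))
  inv-cauchy x cx (δ , 0<δ , M , hM) = scaled (λ n → invℚ (x n)) (D * D) (0≤* 0≤D 0≤D) step
    where
    D : ℚ
    D = (1/ δ) {{>-nonZero 0<δ}}
    0≤D : 0ℚ ≤ D
    0≤D = <⇒≤ (positive⁻¹ D {{1/pos⇒pos δ {{positive 0<δ}}}})
    step : ∀ η → 0ℚ < η →
           ∃[ N ] (∀ m n → N ℕ.≤ m → N ℕ.≤ n → ∣ invℚ (x m) - invℚ (x n) ∣ ≤ D * D * η)
    step η 0<η with cx η 0<η
    ... | N , h = M ℕ.⊔ N , λ m n a b →
      let (m≢0 , mD) = invℚ-bound 0<δ (hM m (ℕ.m⊔n≤o⇒m≤o M N a))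
          (n≢0 , nD) = invℚ-bound 0<δ (hM n (ℕ.m⊔n≤o⇒m≤o M N b))
      in inverse-bound (x m) (x n) D η m≢0 n≢0 mD nD (h n m (ℕ.m⊔n≤o⇒n≤o M N b) (ℕ.m⊔n≤o⇒n≤o M N a))

open CauchyLemmas

fromℕ : ℕ → ℝ
fromℕ n = mkℝ (λ _ → + n / 1) (const-cauchy (+ n / 1))

0ℝ 1ℝ : ℝ
0ℝ = fromℕ 0
1ℝ = fromℕ 1

infixl 6 _-ℝ_
infixl 7 _*ℝ_

_-ℝ_ _*ℝ_ : ℝ → ℝ → ℝ
x -ℝ y = mkℝ (λ n → seq x n - seq y n) (sub-cauchy (seq x) (seq y) (cauchy x) (cauchy y))
x *ℝ y = mkℝ (λ n → seq x n * seq y n) (mul-cauchy (seq x) (seq y) (cauchy x) (cauchy y))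

∣_∣ℝ : ℝ → ℝ
∣ x ∣ℝ = mkℝ (λ n → ∣ seq x n ∣) (abs-cauchy (seq x) (cauchy x))

#0⇒away : ∀ {x} → x #ℝ 0ℝ → AwayFrom0 (seq x)
#0⇒away {x} (inj₁ (δ , 0<δ , N , h)) = δ , 0<δ , N , λ n a →
  ≤-trans (≤-trans (≤-reflexive (solve 2 (λ p d → d := (p :+ d) :+ :- p) refl (seq x n) δ))
    (≤-trans (+-monoˡ-≤ (- seq x n) (h n a)) (≤-reflexive (+-identityˡ (- seq x n)))))
    (subst (- seq x n ≤_) (∣-p∣≡∣p∣ (seq x n)) (p≤∣p∣ (- seq x n)))
  where open +-*-Solver using (solve; _:+_; _:=_; :-_)
#0⇒away {x} (inj₂ (δ , 0<δ , N , h)) = δ , 0<δ , N , λ n a →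
  ≤-trans (subst (_≤ seq x n) (+-identityˡ δ) (h n a)) (p≤∣p∣ (seq x n))

inverse : (x : ℝ) → x #ℝ 0ℝ → ℝ
inverse x x#0 = mkℝ (λ n → invℚ (seq x n)) (inv-cauchy (seq x) (cauchy x) (#0⇒away {x} x#0))

divide : (x y : ℝ) → y #ℝ 0ℝ → ℝ
divide x y y#0 = x *ℝ inverse y y#0

-- Largest s with s * s ≤ n.
isqrt : ℕ → ℕ
isqrt zero    = 0
isqrt (suc n) with suc (isqrt n) ℕ.* suc (isqrt n) ℕ.≤? suc n
... | yes _ = suc (isqrt n)
... | no _  = isqrt n

module SqrtLemmas where
  open ℕ.+-*-Solver using (solve; _:+_; _:*_; _:=_; con)

  isqrt-spec : ∀ n → isqrt n ℕ.* isqrt n ℕ.≤ n × n ℕ.< suc (isqrt n) ℕ.* suc (isqrt n)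
  isqrt-spec zero = z≤n , s≤s z≤n
  isqrt-spec (suc n) with suc (isqrt n) ℕ.* suc (isqrt n) ℕ.≤? suc n
  ... | yes p = p , ℕ.≤-<-trans (proj₂ (isqrt-spec n))
                      (ℕ.*-mono-< (ℕ.n<1+n (suc (isqrt n))) (ℕ.n<1+n (suc (isqrt n))))
  ... | no ¬p = ℕ.m≤n⇒m≤1+n (proj₁ (isqrt-spec n)) , ℕ.≰⇒> ¬p

  square-cancel-< : ∀ a b → a ℕ.* a ℕ.< b ℕ.* b → a ℕ.< b
  square-cancel-< a b lt = ℕ.≰⇒> λ b≤a → ℕ.<⇒≱ lt (ℕ.*-mono-≤ b≤a b≤a)

  approx : ℕ → ℕ → ℕ
  approx N k = isqrt (N ℕ.* (suc k ℕ.* suc k))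

  swap-squares : ∀ a b → (a ℕ.* b) ℕ.* (a ℕ.* b) ≡ (a ℕ.* a) ℕ.* (b ℕ.* b)
  swap-squares = solve 2 (λ a b → (a :* b) :* (a :* b) := (a :* a) :* (b :* b)) refl

  swap-scale : ∀ N a b → (N ℕ.* a) ℕ.* b ≡ (N ℕ.* b) ℕ.* a
  swap-scale = solve 3 (λ N a b → (N :* a) :* b := (N :* b) :* a) refl

  approx-< : ∀ N m n → approx N m ℕ.* suc n ℕ.< suc (approx N n) ℕ.* suc m
  approx-< N m n = square-cancel-< _ _ (begin-strict
    (s ℕ.* K) ℕ.* (s ℕ.* K)                   ≡⟨ swap-squares s K ⟩
    (s ℕ.* s) ℕ.* (K ℕ.* K)                   ≤⟨ ℕ.*-monoˡ-≤ (K ℕ.* K) (proj₁ (isqrt-spec (N ℕ.* (M ℕ.* M)))) ⟩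
    (N ℕ.* (M ℕ.* M)) ℕ.* (K ℕ.* K)           ≡⟨ swap-scale N (M ℕ.* M) (K ℕ.* K) ⟩
    (N ℕ.* (K ℕ.* K)) ℕ.* (M ℕ.* M)           <⟨ ℕ.*-monoˡ-< (M ℕ.* M) (proj₂ (isqrt-spec (N ℕ.* (K ℕ.* K)))) ⟩
    (suc t ℕ.* suc t) ℕ.* (M ℕ.* M)           ≡⟨ swap-squares (suc t) M ⟨
    (suc t ℕ.* M) ℕ.* (suc t ℕ.* M)           ∎)
    where
    open ℕ.≤-Reasoning
    M K s t : ℕ
    M = suc m
    K = suc n
    s = approx N m
    t = approx N n

  approx-≤ : ∀ N m n → + approx N m / suc m ≤ + approx N n / suc n + + 1 / suc n
  approx-≤ N m n = frac-≤-+ s m t n 1 n (begin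
    s ℕ.* (K ℕ.* K)                       ≡⟨ ℕ.*-assoc s K K ⟨
    (s ℕ.* K) ℕ.* K                       ≤⟨ ℕ.*-monoˡ-≤ K (ℕ.<⇒≤ (approx-< N m n)) ⟩
    (suc t ℕ.* suc m) ℕ.* K               ≡⟨ eq t (suc m) K ⟩
    (t ℕ.* K ℕ.+ 1 ℕ.* K) ℕ.* suc m       ∎)
    where
    open ℕ.≤-Reasoning
    K s t : ℕ
    K = suc n
    s = approx N m
    t = approx N n
    eq : ∀ t m k → (suc t ℕ.* m) ℕ.* k ≡ (t ℕ.* k ℕ.+ 1 ℕ.* k) ℕ.* m
    eq = solve 3 (λ t m k → ((con 1 :+ t) :* m) :* k := (t :* k :+ con 1 :* k) :* m) refl

  sqrt-cauchy : ∀ N → IsCauchy (λ k → + isqrt (N ℕ.* (suc k ℕ.* suc k)) / suc k)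
  sqrt-cauchy N = one-sided (λ k → + approx N k / suc k) step
    where
    step : ∀ ε → 0ℚ < ε → ∃[ M ] (∀ m n → M ℕ.≤ m → M ℕ.≤ n → + approx N m / suc m ≤ + approx N n / suc n + ε)
    step ε 0<ε with archimedean 1 ε 0<ε
    ... | M , h = M , λ m n _ b → ≤-trans (approx-≤ N m n) (+-monoʳ-≤ (+ approx N n / suc n) (h n b))

-- Term k is √ N rounded down to a multiple of 1 / suc k.
√_ : ℕ → ℝ
√ N = mkℝ (λ k → + isqrt (N ℕ.* (suc k ℕ.* suc k)) / suc k) (SqrtLemmas.sqrt-cauchy N)

inDisc : ℕ → ℕ → ℕ → ℕ
inDisc n i j with i ℕ.* i ℕ.+ j ℕ.* j ℕ.<? n ℕ.* n
... | yes _ = 1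
... | no _  = 0

-- Number of cells of the grid of mesh 1 / n that meet the open quarter of the
-- unit disc in the first quadrant: a cell is counted by its lower left corner
-- (i / n , j / n).
quarterDisc : ℕ → ℕ
quarterDisc n = sum (applyUpTo (λ i → sum (applyUpTo (λ j → inDisc n i j) n)) n)

module PiLemmas where
  open ℕ.+-*-Solver using (solve; _:+_; _:*_; _:=_; con)

  S : ℕ → (ℕ → ℕ) → ℕ
  S n f = sum (applyUpTo f n)

  S-mono : ∀ n {f g} → (∀ i → i ℕ.< n → f i ℕ.≤ g i) → S n f ℕ.≤ S n g
  S-mono zero    h = z≤n
  S-mono (suc n) h = ℕ.+-mono-≤ (h 0 (s≤s z≤n)) (S-mono n λ i i<n → h (suc i) (s≤s i<n))

  S-cong : ∀ n {f g} → (∀ i → f i ≡ g i) → S n f ≡ S n g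
  S-cong zero    h = refl
  S-cong (suc n) h = cong₂ ℕ._+_ (h 0) (S-cong n λ i → h (suc i))

  S-append : ∀ m n f → S (m ℕ.+ n) f ≡ S m f ℕ.+ S n (λ i → f (m ℕ.+ i))
  S-append zero    n f = refl
  S-append (suc m) n f = trans (cong (f 0 ℕ.+_) (S-append m n (λ i → f (suc i))))
    (sym (ℕ.+-assoc (f 0) _ _))

  S-block : ∀ n m f → S (n ℕ.* m) f ≡ S n (λ q → S m (λ r → f (q ℕ.* m ℕ.+ r)))
  S-block zero    m f = refl
  S-block (suc n) m f = trans (S-append m (n ℕ.* m) f) (cong (S m f ℕ.+_)
    (trans (S-block n m (λ i → f (m ℕ.+ i)))
      (S-cong n λ q → S-cong m λ r → cong f (sym (ℕ.+-assoc m (q ℕ.* m) r)))))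

  S-const : ∀ n c → S n (λ _ → c) ≡ n ℕ.* c
  S-const zero    c = refl
  S-const (suc n) c = cong (c ℕ.+_) (S-const n c)

  S-scale : ∀ n c f → S n (λ i → c ℕ.* f i) ≡ c ℕ.* S n f
  S-scale zero    c f = sym (ℕ.*-zeroʳ c)
  S-scale (suc n) c f = trans (cong (c ℕ.* f 0 ℕ.+_) (S-scale n c (λ i → f (suc i))))
    (sym (ℕ.*-distribˡ-+ c (f 0) _))

  S-add : ∀ n f g → S n (λ i → f i ℕ.+ g i) ≡ S n f ℕ.+ S n g
  S-add zero    f g = refl
  S-add (suc n) f g = trans (cong (f 0 ℕ.+ g 0 ℕ.+_) (S-add n (λ i → f (suc i)) (λ i → g (suc i))))
    (swap (f 0) (g 0) (S n (λ i → f (suc i))) (S n (λ i → g (suc i))))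
    where
    swap : ∀ a b c d → a ℕ.+ b ℕ.+ (c ℕ.+ d) ≡ a ℕ.+ c ℕ.+ (b ℕ.+ d)
    swap = solve 4 (λ a b c d → a :+ b :+ (c :+ d) := a :+ c :+ (b :+ d)) refl

  S-shift : ∀ n f → S n f ℕ.≤ f 0 ℕ.+ S n (λ i → f (suc i))
  S-shift zero    f = z≤n
  S-shift (suc n) f = ℕ.+-monoʳ-≤ (f 0) (S-shift n (λ i → f (suc i)))

  inDisc-≤1 : ∀ n i j → inDisc n i j ℕ.≤ 1
  inDisc-≤1 n i j with i ℕ.* i ℕ.+ j ℕ.* j ℕ.<? n ℕ.* n
  ... | yes _ = ℕ.≤-refl
  ... | no _  = z≤n

  inDisc-mono : ∀ n i j n′ i′ j′ →
    (i ℕ.* i ℕ.+ j ℕ.* j ℕ.< n ℕ.* n → i′ ℕ.* i′ ℕ.+ j′ ℕ.* j′ ℕ.< n′ ℕ.* n′) →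
    inDisc n i j ℕ.≤ inDisc n′ i′ j′
  inDisc-mono n i j n′ i′ j′ h with i ℕ.* i ℕ.+ j ℕ.* j ℕ.<? n ℕ.* n
  ... | no _ = z≤n
  ... | yes p with i′ ℕ.* i′ ℕ.+ j′ ℕ.* j′ ℕ.<? n′ ℕ.* n′
  ...   | yes _ = ℕ.≤-refl
  ...   | no ¬p = contradiction (h p) ¬p

  scale-squares : ∀ q r m → (q ℕ.* m) ℕ.* (q ℕ.* m) ℕ.+ (r ℕ.* m) ℕ.* (r ℕ.* m) ≡ (q ℕ.* q ℕ.+ r ℕ.* r) ℕ.* (m ℕ.* m)
  scale-squares = solve 3 (λ q r m → (q :* m) :* (q :* m) :+ (r :* m) :* (r :* m) := (q :* q :+ r :* r) :* (m :* m)) refl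

  scale-square : ∀ q m → (q ℕ.* m) ℕ.* (q ℕ.* m) ≡ (q ℕ.* q) ℕ.* (m ℕ.* m)
  scale-square = SqrtLemmas.swap-squares

  coarsen : ∀ n m q q′ r r′ → inDisc (n ℕ.* m) (q ℕ.* m ℕ.+ r) (q′ ℕ.* m ℕ.+ r′) ℕ.≤ inDisc n q q′
  coarsen n m q q′ r r′ = inDisc-mono (n ℕ.* m) (q ℕ.* m ℕ.+ r) (q′ ℕ.* m ℕ.+ r′) n q q′ λ lt →
    ℕ.*-cancelʳ-< (m ℕ.* m) _ _ (subst₂ ℕ._<_ (scale-squares q q′ m) (scale-square n m)
      (ℕ.≤-<-trans (ℕ.+-mono-≤ (sq (ℕ.m≤m+n (q ℕ.* m) r)) (sq (ℕ.m≤m+n (q′ ℕ.* m) r′))) lt))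
    where
    sq : ∀ {a b} → a ℕ.≤ b → a ℕ.* a ℕ.≤ b ℕ.* b
    sq a≤b = ℕ.*-mono-≤ a≤b a≤b

  refine : ∀ n m q q′ r r′ → r ℕ.< m → r′ ℕ.< m →
           inDisc n (suc q) (suc q′) ℕ.≤ inDisc (n ℕ.* m) (q ℕ.* m ℕ.+ r) (q′ ℕ.* m ℕ.+ r′)
  refine n zero      q q′ r r′ ()
  refine n m@(suc _) q q′ r r′ r<m r′<m =
    inDisc-mono n (suc q) (suc q′) (n ℕ.* m) (q ℕ.* m ℕ.+ r) (q′ ℕ.* m ℕ.+ r′) λ lt →
      ℕ.≤-<-trans (ℕ.+-mono-≤ (sq (le q r<m)) (sq (le q′ r′<m)))
        (subst₂ ℕ._<_ (sym (scale-squares (suc q) (suc q′) m)) (sym (scale-square n m))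
          (ℕ.*-monoˡ-< (m ℕ.* m) lt))
    where
    sq : ∀ {a b} → a ℕ.≤ b → a ℕ.* a ℕ.≤ b ℕ.* b
    sq a≤b = ℕ.*-mono-≤ a≤b a≤b
    le : ∀ q {r} → r ℕ.< m → q ℕ.* m ℕ.+ r ℕ.≤ suc q ℕ.* m
    le q {r} r<m = subst (q ℕ.* m ℕ.+ r ℕ.≤_) (ℕ.+-comm (q ℕ.* m) m) (ℕ.+-monoʳ-≤ (q ℕ.* m) (ℕ.<⇒≤ r<m))

  blocks : ∀ n m → quarterDisc (n ℕ.* m) ≡
    S n (λ q → S m (λ r → S n (λ q′ → S m (λ r′ → inDisc (n ℕ.* m) (q ℕ.* m ℕ.+ r) (q′ ℕ.* m ℕ.+ r′)))))
  blocks n m = trans (S-block n m (λ i → S (n ℕ.* m) (inDisc (n ℕ.* m) i)))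
    (S-cong n λ q → S-cong m λ r → S-block n m (inDisc (n ℕ.* m) (q ℕ.* m ℕ.+ r)))

  constant-blocks : ∀ n m (f : ℕ → ℕ → ℕ) →
    S n (λ q → S m (λ _ → S n (λ q′ → S m (λ _ → f q q′)))) ≡ m ℕ.* (m ℕ.* S n (λ q → S n (f q)))
  constant-blocks n m f = trans (S-cong n λ q → trans (S-const m _) (cong (m ℕ.*_)
      (trans (S-cong n λ q′ → S-const m (f q q′)) (S-scale n m (f q)))))
    (trans (S-scale n m _) (cong (m ℕ.*_) (S-scale n m _)))

  upper : ∀ n m → quarterDisc (n ℕ.* m) ℕ.≤ m ℕ.* (m ℕ.* quarterDisc n)
  upper n m = subst₂ ℕ._≤_ (sym (blocks n m)) (constant-blocks n m (inDisc n))
    (S-mono n λ q _ → S-mono m λ r _ → S-mono n λ q′ _ → S-mono m λ r′ _ → coarsen n m q q′ r r′)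

  innerDisc : ℕ → ℕ
  innerDisc n = S n (λ q → S n (λ q′ → inDisc n (suc q) (suc q′)))

  lower : ∀ n m → m ℕ.* (m ℕ.* innerDisc n) ℕ.≤ quarterDisc (n ℕ.* m)
  lower n m = subst₂ ℕ._≤_ (constant-blocks n m (λ q q′ → inDisc n (suc q) (suc q′))) (sym (blocks n m))
    (S-mono n λ q _ → S-mono m λ r r<m → S-mono n λ q′ _ → S-mono m λ r′ r′<m → refine n m q q′ r r′ r<m r′<m)

  boundary : ∀ n → quarterDisc n ℕ.≤ n ℕ.+ (n ℕ.+ innerDisc n)
  boundary n = ℕ.≤-trans (S-shift n (λ i → S n (inDisc n i)))
    (ℕ.+-mono-≤ (row (inDisc n 0) (inDisc-≤1 n 0))
      (ℕ.≤-trans (S-mono n λ q _ → S-shift n (inDisc n (suc q)))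
        (ℕ.≤-trans (ℕ.≤-reflexive (S-add n (λ q → inDisc n (suc q) 0) (λ q → S n (λ q′ → inDisc n (suc q) (suc q′)))))
          (ℕ.+-monoˡ-≤ _ (row (λ q → inDisc n (suc q) 0) (λ q → inDisc-≤1 n (suc q) 0))))))
    where
    row : ∀ f → (∀ i → f i ℕ.≤ 1) → S n f ℕ.≤ n
    row f h = subst (S n f ℕ.≤_) (trans (S-const n 1) (ℕ.*-identityʳ n)) (S-mono n λ i _ → h i)

  spread : ∀ m n c → n ℕ.* (n ℕ.* (m ℕ.+ (m ℕ.+ c))) ≡ n ℕ.* (n ℕ.* (m ℕ.+ m)) ℕ.+ n ℕ.* (n ℕ.* c)
  spread = solve 3 (λ m n c → n :* (n :* (m :+ (m :+ c))) := n :* (n :* (m :+ m)) :+ n :* (n :* c)) refl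

  compare : ∀ m n → n ℕ.* (n ℕ.* quarterDisc m) ℕ.≤ n ℕ.* (n ℕ.* (m ℕ.+ m)) ℕ.+ m ℕ.* (m ℕ.* quarterDisc n)
  compare m n = begin
    n ℕ.* (n ℕ.* quarterDisc m)
      ≤⟨ ℕ.*-monoʳ-≤ n (ℕ.*-monoʳ-≤ n (boundary m)) ⟩
    n ℕ.* (n ℕ.* (m ℕ.+ (m ℕ.+ innerDisc m)))
      ≡⟨ spread m n (innerDisc m) ⟩
    n ℕ.* (n ℕ.* (m ℕ.+ m)) ℕ.+ n ℕ.* (n ℕ.* innerDisc m)
      ≤⟨ ℕ.+-monoʳ-≤ _ (lower m n) ⟩
    n ℕ.* (n ℕ.* (m ℕ.+ m)) ℕ.+ quarterDisc (m ℕ.* n)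
      ≡⟨ cong (λ k → n ℕ.* (n ℕ.* (m ℕ.+ m)) ℕ.+ quarterDisc k) (ℕ.*-comm m n) ⟩
    n ℕ.* (n ℕ.* (m ℕ.+ m)) ℕ.+ quarterDisc (n ℕ.* m)
      ≤⟨ ℕ.+-monoʳ-≤ _ (upper n m) ⟩
    n ℕ.* (n ℕ.* (m ℕ.+ m)) ℕ.+ m ℕ.* (m ℕ.* quarterDisc n) ∎
    where open ℕ.≤-Reasoning

  area : ℕ → ℚ
  area k = + (4 ℕ.* quarterDisc (suc k)) / (suc k ℕ.* suc k)

  pull : ∀ c k m → (4 ℕ.* c) ℕ.* ((k ℕ.* k) ℕ.* m) ≡ 4 ℕ.* m ℕ.* (k ℕ.* (k ℕ.* c))
  pull = solve 3 (λ c k m → (con 4 :* c) :* ((k :* k) :* m) := con 4 :* m :* (k :* (k :* c))) refl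

  collect : ∀ d k m → 4 ℕ.* m ℕ.* (k ℕ.* (k ℕ.* (m ℕ.+ m)) ℕ.+ m ℕ.* (m ℕ.* d)) ≡
                      (4 ℕ.* d ℕ.* m ℕ.+ 8 ℕ.* (k ℕ.* k)) ℕ.* (m ℕ.* m)
  collect = solve 3 (λ d k m → con 4 :* m :* (k :* (k :* (m :+ m)) :+ m :* (m :* d))
    := (con 4 :* d :* m :+ con 8 :* (k :* k)) :* (m :* m)) refl

  area-≤ : ∀ m n → area m ≤ area n + + 8 / suc m
  area-≤ m n = frac-≤-+ (4 ℕ.* c) (m ℕ.+ m ℕ.* M) (4 ℕ.* d) (n ℕ.+ n ℕ.* K) 8 m (begin
    (4 ℕ.* c) ℕ.* ((K ℕ.* K) ℕ.* M)
      ≡⟨ pull c K M ⟩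
    4 ℕ.* M ℕ.* (K ℕ.* (K ℕ.* c))
      ≤⟨ ℕ.*-monoʳ-≤ (4 ℕ.* M) (compare M K) ⟩
    4 ℕ.* M ℕ.* (K ℕ.* (K ℕ.* (M ℕ.+ M)) ℕ.+ M ℕ.* (M ℕ.* d))
      ≡⟨ collect d K M ⟩
    (4 ℕ.* d ℕ.* M ℕ.+ 8 ℕ.* (K ℕ.* K)) ℕ.* (M ℕ.* M) ∎)
    where
    open ℕ.≤-Reasoning
    M K c d : ℕ
    M = suc m
    K = suc n
    c = quarterDisc M
    d = quarterDisc K

  area-cauchy : IsCauchy area
  area-cauchy = one-sided area step
    where
    step : ∀ ε → 0ℚ < ε → ∃[ N ] (∀ m n → N ℕ.≤ m → N ℕ.≤ n → area m ≤ area n + ε)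
    step ε 0<ε = proj₁ N , λ m n a _ → ≤-trans (area-≤ m n) (+-monoʳ-≤ (area n) (proj₂ N m a))
      where
      N : ∃[ N ] (∀ n → N ℕ.≤ n → + 8 / suc n ≤ ε)
      N = archimedean 8 ε 0<ε

  double : ∀ m → 1 ℕ.* ((2 ℕ.* m) ℕ.* (2 ℕ.* m)) ≡ 4 ℕ.* (m ℕ.* (m ℕ.* 1)) ℕ.* 1
  double = solve 1 (λ m → con 1 :* ((con 2 :* m) :* (con 2 :* m)) := con 4 :* (m :* (m :* con 1)) :* con 1) refl

  area-odd : ∀ p → + 1 / 1 ≤ area (p ℕ.+ 1 ℕ.* suc p)
  area-odd p = frac-≤ 1 0 (4 ℕ.* quarterDisc (2 ℕ.* P)) (k ℕ.+ k ℕ.* suc k) (begin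
    1 ℕ.* ((2 ℕ.* P) ℕ.* (2 ℕ.* P))
      ≡⟨ double P ⟩
    4 ℕ.* (P ℕ.* (P ℕ.* 1)) ℕ.* 1
      ≤⟨ ℕ.*-monoˡ-≤ 1 (ℕ.*-monoʳ-≤ 4 (lower 2 P)) ⟩
    4 ℕ.* quarterDisc (2 ℕ.* P) ℕ.* 1 ∎)
    where
    open ℕ.≤-Reasoning
    P k : ℕ
    P = suc p
    k = p ℕ.+ 1 ℕ.* suc p

-- The area of the unit disc, as a limit of areas of grid approximations.
π : ℝ
π = mkℝ (λ k → + (4 ℕ.* quarterDisc (suc k)) / (suc k ℕ.* suc k)) PiLemmas.area-cauchy

0<π : 0ℝ <ℝ π
0<π = ½ , positive⁻¹ ½ , proj₁ modulus , λ n a →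
    subst (0ℚ + ½ ≤_) (cancel (seq π n))
      (+-monoˡ-≤ (- ½) (≤-trans (area-odd (proj₁ modulus))
        (∣-∣-≤⁻¹ {area (odd (proj₁ modulus))} {area n}
          (proj₂ modulus (odd (proj₁ modulus)) n (ℕ.m≤m+n (proj₁ modulus) _) a))))
  where
  open PiLemmas
  odd : ℕ → ℕ
  odd p = p ℕ.+ 1 ℕ.* suc p
  modulus : ∃[ N ] (∀ m n → N ℕ.≤ m → N ℕ.≤ n → ∣ area m - area n ∣ ≤ ½)
  modulus = area-cauchy ½ (positive⁻¹ ½)
  cancel : ∀ p → (p + ½) - ½ ≡ p
  cancel p = trans (+-assoc p ½ (- ½)) (+-identityʳ p)

*ℝ-positive : ∀ x y → 0ℝ <ℝ x → 0ℝ <ℝ y → 0ℝ <ℝ x *ℝ y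
*ℝ-positive x y (δ , 0<δ , M , h) (ε , 0<ε , N , k) =
  δ * ε , positive⁻¹ (δ * ε) {{pos*pos⇒pos δ {{positive 0<δ}} ε {{positive 0<ε}}}} , M ℕ.⊔ N , λ n a →
    let δ≤ = subst (_≤ seq x n) (+-identityˡ δ) (h n (ℕ.m⊔n≤o⇒m≤o M N a))
        ε≤ = subst (_≤ seq y n) (+-identityˡ ε) (k n (ℕ.m⊔n≤o⇒n≤o M N a))
    in subst (_≤ seq x n * seq y n) (sym (+-identityˡ (δ * ε)))
         (*-mono (<⇒≤ 0<δ) (≤-trans (<⇒≤ 0<ε) ε≤) δ≤ ε≤)

fromℕ-positive : ∀ n → 0ℝ <ℝ fromℕ (suc n)
fromℕ-positive n = + suc n / 1 , frac-pos (suc n) 0 (s≤s z≤n) , 0 , λ _ _ → ≤-reflexive (+-identityˡ (+ suc n / 1))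

2π#0 : fromℕ 2 *ℝ π #ℝ 0ℝ
2π#0 = inj₂ (*ℝ-positive (fromℕ 2) π (fromℕ-positive 1) 0<π)

expTerm : ℚ → ℕ → ℚ
expTerm x k = x ^ k * (+ 1 / k !) {{k ℕ.!≢0}}

expSum : ℚ → ℕ → ℚ
expSum x zero    = 0ℚ
expSum x (suc n) = expSum x n + expTerm x n

module ExpLemmas where
  open +-*-Solver using (solve; _:+_; _:*_; _:=_; :-_; _:-_; con)

  module Powers (c : ℚ) (0≤c : 0ℚ ≤ c) where

    0≤^ : ∀ k → 0ℚ ≤ c ^ k
    0≤^ zero    = frac-nonNeg 1 0
    0≤^ (suc k) = 0≤* 0≤c (0≤^ k)

    ∣^∣-≤ : ∀ x → ∣ x ∣ ≤ c → ∀ k → ∣ x ^ k ∣ ≤ c ^ k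
    ∣^∣-≤ x h zero    = ≤-refl
    ∣^∣-≤ x h (suc k) = ∣*∣-≤ {x} {x ^ k} h (∣^∣-≤ x h k)

    power-difference : ∀ B x y → ∣ x ∣ ≤ B → ∣ y ∣ ≤ c → 1ℚ ≤ B → B + B ≤ c →
                       ∀ k → ∣ x ^ k - y ^ k ∣ ≤ ∣ x - y ∣ * c ^ k
    power-difference B x y hx hy 1≤B BB zero    = 0≤* (0≤∣p∣ (x - y)) (0≤^ 0)
    power-difference B x y hx hy 1≤B BB (suc k) = begin
      ∣ x * x ^ k - y * y ^ k ∣
        ≡⟨ cong ∣_∣ (product-difference x (x ^ k) y (y ^ k)) ⟨
      ∣ x * (x ^ k - y ^ k) + (x - y) * y ^ k ∣
        ≤⟨ ∣p+q∣≤∣p∣+∣q∣ (x * (x ^ k - y ^ k)) ((x - y) * y ^ k) ⟩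
      ∣ x * (x ^ k - y ^ k) ∣ + ∣ (x - y) * y ^ k ∣
        ≤⟨ +-mono-≤ (∣*∣-≤ {x} {x ^ k - y ^ k} hx (power-difference B x y hx hy 1≤B BB k))
                    (∣*∣-≤ {x - y} {y ^ k} ≤-refl
                      (≤-trans (∣^∣-≤ y hy k) (subst (_≤ B * c ^ k) (*-identityˡ (c ^ k))
                        (*-monoʳ-≤-nonNeg (c ^ k) {{nonNegative (0≤^ k)}} 1≤B)))) ⟩
      B * (∣ x - y ∣ * c ^ k) + ∣ x - y ∣ * (B * c ^ k)
        ≡⟨ regroup B ∣ x - y ∣ (c ^ k) ⟩
      ∣ x - y ∣ * ((B + B) * c ^ k)
        ≤⟨ *-monoˡ-≤-nonNeg ∣ x - y ∣ {{nonNegative (0≤∣p∣ (x - y))}}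
             (*-monoʳ-≤-nonNeg (c ^ k) {{nonNegative (0≤^ k)}} BB) ⟩
      ∣ x - y ∣ * (c * c ^ k) ∎
      where
      open ≤-Reasoning
      regroup : ∀ b d p → b * (d * p) + d * (b * p) ≡ d * ((b + b) * p)
      regroup = solve 3 (λ b d p → b :* (d :* p) :+ d :* (b :* p) := d :* ((b :+ b) :* p)) refl

  1/! : ℕ → ℚ
  1/! k = (+ 1 / k !) {{k ℕ.!≢0}}

  0≤1/! : ∀ k → 0ℚ ≤ 1/! k
  0≤1/! k = nonNegative⁻¹ (1/! k) {{normalize-nonNeg 1 (k !) {{k ℕ.!≢0}}}}

  1/!-step : ∀ k → 1/! (suc k) * (+ suc k / 1) ≡ 1/! k
  1/!-step k = frac-* k (k !) {{k ℕ.!≢0}} {{suc k ℕ.!≢0}}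

  term-step : ∀ c k → expTerm c (suc k) * (+ suc k / 1) ≡ c * expTerm c k
  term-step c k = trans (shuffle c (c ^ k) (1/! (suc k)) (+ suc k / 1)) (cong (λ z → c * (c ^ k * z)) (1/!-step k))
    where
    shuffle : ∀ c p i n → c * p * i * n ≡ c * (p * (i * n))
    shuffle = solve 4 (λ c p i n → c :* p :* i :* n := c :* (p :* (i :* n))) refl

  add-sub : ∀ a b d → (a + d) - b ≡ (a - b) + d
  add-sub = solve 3 (λ a b d → (a :+ d) :- b := (a :- b) :+ d) refl

  -- For a fixed bound C ≥ 1 the terms Cᵏ/k! at least halve at each step from
  -- k = 2C on.
  module Bounded (C-1 : ℕ) where
    C : ℕ
    C = suc C-1
    c : ℚ
    c = + C / 1
    M : ℕ
    M = C ℕ.+ C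
    t : ℕ → ℚ
    t = expTerm c
    open Powers c (frac-nonNeg C 0)

    0≤t : ∀ k → 0ℚ ≤ t k
    0≤t k = 0≤* (0≤^ k) (0≤1/! k)

    instance
      c-pos : Positive c
      c-pos = positive (frac-pos C 0 (s≤s z≤n))

    c+c≤ : ∀ k → M ℕ.≤ k → c + c ≤ + suc k / 1
    c+c≤ k le = ≤-trans (≤-reflexive (frac-+ C 0 C 0)) (frac-≤ (C ℕ.* 1 ℕ.+ C ℕ.* 1) 0 (suc k) 0 (begin
      (C ℕ.* 1 ℕ.+ C ℕ.* 1) ℕ.* 1  ≡⟨ ℕ.*-identityʳ _ ⟩
      C ℕ.* 1 ℕ.+ C ℕ.* 1          ≡⟨ cong₂ ℕ._+_ (ℕ.*-identityʳ C) (ℕ.*-identityʳ C) ⟩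
      M                            ≤⟨ ℕ.m≤n⇒m≤1+n le ⟩
      suc k                        ≡⟨ ℕ.*-identityʳ (suc k) ⟨
      suc k ℕ.* 1                  ∎))
      where open ℕ.≤-Reasoning

    halving : ∀ k → M ℕ.≤ k → t (suc k) + t (suc k) ≤ t k
    halving k le = *-cancelˡ-≤-pos c (begin
      c * (t (suc k) + t (suc k))     ≡⟨ dbl c (t (suc k)) ⟩
      t (suc k) * (c + c)             ≤⟨ *-monoˡ-≤-nonNeg (t (suc k)) {{nonNegative (0≤t (suc k))}} (c+c≤ k le) ⟩
      t (suc k) * (+ suc k / 1)       ≡⟨ term-step c k ⟩
      c * t k                         ∎)
      where
      open ≤-Reasoning
      dbl : ∀ c t → c * (t + t) ≡ t * (c + c)
      dbl = solve 2 (λ c t → c :* (t :+ t) := t :* (c :+ c)) refl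

    sum-bound : ∀ m → M ℕ.≤ m → ∀ j → expSum c (j ℕ.+ m) + (t (j ℕ.+ m) + t (j ℕ.+ m)) ≤ expSum c m + (t m + t m)
    sum-bound m le zero    = ≤-refl
    sum-bound m le (suc j) = begin
      (s + u) + (v + v)   ≤⟨ +-monoʳ-≤ (s + u) (halving (j ℕ.+ m) (ℕ.≤-trans le (ℕ.m≤n+m m j))) ⟩
      (s + u) + u         ≡⟨ +-assoc s u u ⟩
      s + (u + u)         ≤⟨ sum-bound m le j ⟩
      expSum c m + (t m + t m) ∎
      where
      open ≤-Reasoning
      s u v : ℚ
      s = expSum c (j ℕ.+ m)
      u = t (j ℕ.+ m)
      v = t (suc j ℕ.+ m)

    0≤t+t : ∀ k → 0ℚ ≤ t k + t k
    0≤t+t k = 0≤+ (0≤t k) (0≤t k)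

    K₁ : ℚ
    K₁ = expSum c M + (t M + t M)

    sum-≤-K₁ : ∀ n → M ℕ.≤ n → expSum c n ≤ K₁
    sum-≤-K₁ n le = subst (λ k → expSum c k ≤ K₁) (ℕ.m∸n+n≡m le)
      (≤-trans (p≤p+q {expSum c (n ℕ.∸ M ℕ.+ M)} (0≤t+t (n ℕ.∸ M ℕ.+ M))) (sum-bound M ℕ.≤-refl (n ℕ.∸ M)))

    tail : ∀ x → ∣ x ∣ ≤ c → ∀ m j → ∣ expSum x (j ℕ.+ m) - expSum x m ∣ ≤ expSum c (j ℕ.+ m) - expSum c m
    tail x h m zero    = ≤-reflexive (trans (cong ∣_∣ (+-inverseʳ (expSum x m))) (sym (+-inverseʳ (expSum c m))))
    tail x h m (suc j) = subst₂ _≤_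
      (cong ∣_∣ (sym (add-sub (expSum x (j ℕ.+ m)) (expSum x m) (expTerm x (j ℕ.+ m)))))
      (sym (add-sub (expSum c (j ℕ.+ m)) (expSum c m) (t (j ℕ.+ m))))
      (≤-trans (∣p+q∣≤∣p∣+∣q∣ (expSum x (j ℕ.+ m) - expSum x m) (expTerm x (j ℕ.+ m)))
        (+-mono-≤ (tail x h m j)
          (∣*∣-≤ {x ^ (j ℕ.+ m)} {1/! (j ℕ.+ m)} (∣^∣-≤ x h (j ℕ.+ m)) (≤-reflexive (0≤p⇒∣p∣≡p (0≤1/! (j ℕ.+ m)))))))

    tail-≤ : ∀ x → ∣ x ∣ ≤ c → ∀ m n → M ℕ.≤ m → m ℕ.≤ n → ∣ expSum x n - expSum x m ∣ ≤ t m + t m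
    tail-≤ x h m n M≤m m≤n = subst (λ k → ∣ expSum x k - expSum x m ∣ ≤ t m + t m) (ℕ.m∸n+n≡m m≤n)
      (≤-trans (tail x h m (n ℕ.∸ m)) (subst (s - expSum c m ≤_) (cancel (expSum c m) (t m + t m))
        (+-monoˡ-≤ (- expSum c m)
          (≤-trans (p≤p+q {s} (0≤t+t (n ℕ.∸ m ℕ.+ m))) (sum-bound m M≤m (n ℕ.∸ m))))))
      where
      s : ℚ
      s = expSum c (n ℕ.∸ m ℕ.+ m)
      cancel : ∀ a b → (a + b) - a ≡ b
      cancel = solve 2 (λ a b → (a :+ b) :- a := b) refl

    t-antitone : ∀ j → t (j ℕ.+ M) ≤ t M
    t-antitone zero    = ≤-refl
    t-antitone (suc j) = ≤-trans (p≤p+q {t (suc j ℕ.+ M)} (0≤t (suc j ℕ.+ M)))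
      (≤-trans (halving (j ℕ.+ M) (ℕ.m≤n+m M j)) (t-antitone j))

    K₂ : ℚ
    K₂ = c * t M + c * t M

    0≤K₂ : 0ℚ ≤ K₂
    0≤K₂ = 0≤+ (0≤* (frac-nonNeg C 0) (0≤t M)) (0≤* (frac-nonNeg C 0) (0≤t M))

    t-small : ∀ k → M ℕ.≤ k → ∀ δ → + 1 / suc k ≤ δ → t (suc k) ≤ c * t M * δ
    t-small k le δ h = begin
      t (suc k)                                        ≡⟨ *-identityʳ (t (suc k)) ⟨
      t (suc k) * 1ℚ                                   ≡⟨ cong (t (suc k) *_) (trans (*-comm (+ suc k / 1) (+ 1 / suc k)) inv) ⟨
      t (suc k) * ((+ suc k / 1) * (+ 1 / suc k))      ≡⟨ *-assoc (t (suc k)) (+ suc k / 1) (+ 1 / suc k) ⟨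
      t (suc k) * (+ suc k / 1) * (+ 1 / suc k)        ≡⟨ cong (_* (+ 1 / suc k)) (term-step c k) ⟩
      c * t k * (+ 1 / suc k)                          ≤⟨ *-mono (0≤* (frac-nonNeg C 0) (0≤t k)) (≤-trans (frac-nonNeg 1 k) h)
                                                            (*-monoˡ-≤-nonNeg c {{pos⇒nonNeg c}} t≤) h ⟩
      c * t M * δ                                      ∎
      where
      open ≤-Reasoning
      t≤ : t k ≤ t M
      t≤ = subst (λ i → t i ≤ t M) (ℕ.m∸n+n≡m le) (t-antitone (k ℕ.∸ M))
      inv : (+ 1 / suc k) * (+ suc k / 1) ≡ 1ℚ
      inv = trans (cong (_* (+ suc k / 1)) (/-cong {+ 1} {suc k} {+ 1} {suc k ℕ.* 1} refl (sym (ℕ.*-identityʳ (suc k)))))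
        (frac-* k 1)

    near : ∀ x → ∣ x ∣ ≤ c → ∀ δ → ∃[ N ] (∀ k → N ℕ.≤ k → + 1 / suc k ≤ δ) →
           ∃[ N ] (M ℕ.≤ N × (∀ m n → N ℕ.≤ m → N ℕ.≤ n → ∣ expSum x m - expSum x n ∣ ≤ K₂ * δ))
    near x h δ (N , hN) = suc (M ℕ.⊔ N) , ℕ.m≤n⇒m≤1+n (ℕ.m≤m⊔n M N) , λ m n a b → pick m n a b (ℕ.≤-total m n)
      where
      one : ∀ m n → suc (M ℕ.⊔ N) ℕ.≤ m → m ℕ.≤ n → ∣ expSum x n - expSum x m ∣ ≤ K₂ * δ
      one (suc m) n (s≤s a) m≤n = ≤-trans (tail-≤ x h (suc m) n (ℕ.m≤n⇒m≤1+n M≤m) m≤n)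
        (subst (t (suc m) + t (suc m) ≤_) (sym (*-distribʳ-+ δ (c * t M) (c * t M))) (+-mono-≤ small small))
        where
        M≤m : M ℕ.≤ m
        M≤m = ℕ.m⊔n≤o⇒m≤o M N a
        small : t (suc m) ≤ c * t M * δ
        small = t-small m M≤m δ (hN m (ℕ.m⊔n≤o⇒n≤o M N a))
      pick : ∀ m n → suc (M ℕ.⊔ N) ℕ.≤ m → suc (M ℕ.⊔ N) ℕ.≤ n → m ℕ.≤ n ⊎ n ℕ.≤ m →
             ∣ expSum x m - expSum x n ∣ ≤ K₂ * δ
      pick m n a b (inj₁ m≤n) = subst (_≤ K₂ * δ) (∣-∣-sym (expSum x n) (expSum x m)) (one m n a m≤n)
      pick m n a b (inj₂ n≤m) = one n m b n≤m

    lipschitz : ∀ B x y → ∣ x ∣ ≤ B → ∣ y ∣ ≤ c → 1ℚ ≤ B → B + B ≤ c →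
                ∀ n → ∣ expSum x n - expSum y n ∣ ≤ ∣ x - y ∣ * expSum c n
    lipschitz B x y hx hy 1≤B BB zero    = ≤-reflexive (sym (*-zeroʳ ∣ x - y ∣))
    lipschitz B x y hx hy 1≤B BB (suc n) = begin
      ∣ (a + p * i) - (b + q * i) ∣              ≡⟨ cong ∣_∣ (split a b p q i) ⟩
      ∣ (a - b) + (p - q) * i ∣                  ≤⟨ ∣p+q∣≤∣p∣+∣q∣ (a - b) ((p - q) * i) ⟩
      ∣ a - b ∣ + ∣ (p - q) * i ∣                ≤⟨ +-mono-≤ (lipschitz B x y hx hy 1≤B BB n)
                                                     (∣*∣-≤ {p - q} {i} (power-difference B x y hx hy 1≤B BB n)
                                                       (≤-reflexive (0≤p⇒∣p∣≡p (0≤1/! n)))) ⟩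
      d * expSum c n + d * c ^ n * i             ≡⟨ join d (expSum c n) (c ^ n) i ⟩
      d * (expSum c n + c ^ n * i)               ∎
      where
      open ≤-Reasoning
      a b p q i d : ℚ
      a = expSum x n
      b = expSum y n
      p = x ^ n
      q = y ^ n
      i = 1/! n
      d = ∣ x - y ∣
      split : ∀ a b p q i → (a + p * i) - (b + q * i) ≡ (a - b) + (p - q) * i
      split = solve 5 (λ a b p q i → (a :+ p :* i) :- (b :+ q :* i) := (a :- b) :+ (p :- q) :* i) refl
      join : ∀ d s w i → d * s + d * w * i ≡ d * (s + w * i)
      join = solve 4 (λ d s w i → d :* s :+ d :* w :* i := d :* (s :+ w :* i)) refl

  exp-cauchy : ∀ x → IsCauchy x → IsCauchy (λ n → expSum (x n) n)
  exp-cauchy x cx = go (bound x cx)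
    where
    go : ∃[ B ] (0ℚ ≤ B × ∃[ N ] (∀ n → N ℕ.≤ n → ∣ x n ∣ ≤ B)) → IsCauchy (λ n → expSum (x n) n)
    go (b , _ , L , hL) = scaled (λ n → expSum (x n) n) (K₂ + K₁) (0≤+ 0≤K₂ 0≤K₁) step
      where
      b′ : ℕ
      b′ = proj₁ (natBound b)
      B : ℚ
      B = + suc b′ / 1
      b≤B : b ≤ B
      b≤B = ≤-trans (proj₂ (natBound b)) (frac-≤ b′ 0 (suc b′) 0 (ℕ.*-monoˡ-≤ 1 (ℕ.n≤1+n b′)))
      open Bounded (b′ ℕ.+ suc b′)
      B+B≤c : B + B ≤ c
      B+B≤c = ≤-trans (≤-reflexive (frac-+ (suc b′) 0 (suc b′) 0)) (frac-≤ (suc b′ ℕ.* 1 ℕ.+ suc b′ ℕ.* 1) 0 C 0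
        (ℕ.≤-reflexive (cong (ℕ._* 1) (cong₂ ℕ._+_ (ℕ.*-identityʳ (suc b′)) (ℕ.*-identityʳ (suc b′))))))
      1≤B : 1ℚ ≤ B
      1≤B = frac-≤ 1 0 (suc b′) 0 (s≤s z≤n)
      B≤c : B ≤ c
      B≤c = ≤-trans (p≤p+q {B} (frac-nonNeg (suc b′) 0)) B+B≤c
      x≤B : ∀ n → L ℕ.≤ n → ∣ x n ∣ ≤ B
      x≤B n le = ≤-trans (hL n le) b≤B
      0≤expSum : ∀ n → 0ℚ ≤ expSum c n
      0≤expSum zero    = ≤-refl
      0≤expSum (suc n) = 0≤+ (0≤expSum n) (0≤t n)
      0≤K₁ : 0ℚ ≤ K₁
      0≤K₁ = 0≤+ (0≤expSum M) (0≤t+t M)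
      step : ∀ δ → 0ℚ < δ →
             ∃[ N ] (∀ m n → N ℕ.≤ m → N ℕ.≤ n → ∣ expSum (x m) m - expSum (x n) n ∣ ≤ (K₂ + K₁) * δ)
      step δ 0<δ = P ℕ.+ (L ℕ.+ N) , λ m n a b → begin
          ∣ expSum (x m) m - expSum (x n) n ∣
            ≤⟨ ∣-∣-tri (expSum (x m) m) (expSum (x m) n) (expSum (x n) n) ⟩
          ∣ expSum (x m) m - expSum (x m) n ∣ + ∣ expSum (x m) n - expSum (x n) n ∣
            ≤⟨ +-mono-≤ (proj₂ (proj₂ (near (x m) (≤-trans (x≤B m (≥L a)) B≤c) δ archi)) m n (≥P a) (≥P b))
                 (≤-trans (lipschitz B (x m) (x n) (x≤B m (≥L a)) (≤-trans (x≤B n (≥L b)) B≤c) 1≤B B+B≤c n)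
                   (*-mono (0≤∣p∣ (x m - x n)) 0≤K₁ (proj₂ (cx δ 0<δ) m n (≥N a) (≥N b))
                     (sum-≤-K₁ n (ℕ.≤-trans (ℕ.m≤n⇒m≤1+n (ℕ.m≤m⊔n M (proj₁ archi))) (≥P b))))) ⟩
          K₂ * δ + δ * K₁
            ≡⟨ collect K₂ K₁ δ ⟩
          (K₂ + K₁) * δ ∎
        where
        open ≤-Reasoning
        archi : ∃[ N ] (∀ k → N ℕ.≤ k → + 1 / suc k ≤ δ)
        archi = archimedean 1 δ 0<δ
        P N : ℕ
        P = suc (M ℕ.⊔ proj₁ archi)
        N = proj₁ (cx δ 0<δ)
        ≥P : ∀ {m} → P ℕ.+ (L ℕ.+ N) ℕ.≤ m → P ℕ.≤ m
        ≥P a = ℕ.m+n≤o⇒m≤o P a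
        ≥L : ∀ {m} → P ℕ.+ (L ℕ.+ N) ℕ.≤ m → L ℕ.≤ m
        ≥L a = ℕ.m+n≤o⇒m≤o L (ℕ.m+n≤o⇒n≤o P a)
        ≥N : ∀ {m} → P ℕ.+ (L ℕ.+ N) ℕ.≤ m → N ℕ.≤ m
        ≥N a = ℕ.m+n≤o⇒n≤o L (ℕ.m+n≤o⇒n≤o P a)
        collect : ∀ a b d → a * d + d * b ≡ (a + b) * d
        collect = solve 3 (λ a b d → a :* d :+ d :* b := (a :+ b) :* d) refl

-- The diagonal of the power series: term n is ∑_{k<n} (seq x n)ᵏ / k!.
exp : ℝ → ℝ
exp x = mkℝ (λ n → expSum (seq x n) n) (ExpLemmas.exp-cauchy (seq x) (cauchy x))

-- f n / g n → 1; g n need only be nonzero for large n.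

infix 4 _∼_ _=O_

_∼_ : (ℕ → ℝ) → (ℕ → ℝ) → Set
f ∼ g = Σ[ M ∈ ℕ ] Σ[ g#0 ∈ (∀ n → M ℕ.≤ n → g n #ℝ 0ℝ) ]
  (∀ ε → 0ℝ <ℝ ε → ∃[ N ] (∀ n (M≤n : M ℕ.≤ n) → N ℕ.≤ n →
     ∣ divide (f n) (g n) (g#0 n M≤n) -ℝ 1ℝ ∣ℝ <ℝ ε))

_=O_ : (ℕ → ℝ) → (ℕ → ℝ) → Set
f =O g = ∃[ C ] (0ℝ <ℝ C × ∃[ N ] (∀ n → N ℕ.≤ n → ∣ f n ∣ℝ ≤ℝ C *ℝ ∣ g n ∣ℝ))

Word : ℕ → Set
Word n = Vec (Fin 3) n

occurrences : ∀ {n} → Fin 3 → Word n → ℕ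
occurrences x = Vec.count (x Fin.≟_)

IsVertex : ∀ a b c → Word (a ℕ.+ b ℕ.+ c) → Set
IsVertex a b c u = occurrences 0F u ≡ a × occurrences 1F u ≡ b × occurrences 2F u ≡ c

infix 4 _⟶_

-- u ⟶ v: v arises from u by exchanging two adjacent entries x < y, x on the left.
data _⟶_ : ∀ {n} → Word n → Word n → Set where
  here  : ∀ {n x y} {w : Word n} → x Fin.< y → x ∷ y ∷ w ⟶ y ∷ x ∷ w
  there : ∀ {n x} {u v : Word n} → u ⟶ v → x ∷ u ⟶ x ∷ v

_⟶?_ : ∀ {n} (u v : Word n) → Dec (u ⟶ v)
[] ⟶? [] = no λ ()
(x ∷ []) ⟶? (z ∷ []) = no λ { (there ()) }
(x ∷ u@(y ∷ w)) ⟶? (x′ ∷ v@(y′ ∷ w′)) =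
  Dec.map′ to from
    ((x Fin.<? y ×-dec y Fin.≟ x′ ×-dec x Fin.≟ y′ ×-dec Vec.≡-dec Fin._≟_ w w′) ⊎-dec
     (x Fin.≟ x′ ×-dec u ⟶? v))
  where
  to : (x Fin.< y × y ≡ x′ × x ≡ y′ × w ≡ w′) ⊎ (x ≡ x′ × u ⟶ v) → x ∷ u ⟶ x′ ∷ v
  to (inj₁ (x<y , refl , refl , refl)) = here x<y
  to (inj₂ (refl , e))                 = there e
  from : x ∷ u ⟶ x′ ∷ v → (x Fin.< y × y ≡ x′ × x ≡ y′ × w ≡ w′) ⊎ (x ≡ x′ × u ⟶ v)
  from (here x<y) = inj₁ (x<y , refl , refl , refl)
  from (there e)  = inj₂ (refl , e)

-- `words`, hence `vertices` and `edges`, list every element exactly once, so that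
-- lengths are cardinalities.
words : ∀ n → List (Word n)
words zero    = [] ∷ []
words (suc n) = cartesianProductWith _∷_ (allFin 3) (words n)

isVertex? : ∀ a b c u → Dec (IsVertex a b c u)
isVertex? a b c u = occurrences 0F u ℕ.≟ a ×-dec occurrences 1F u ℕ.≟ b ×-dec occurrences 2F u ℕ.≟ c

vertices : ∀ a b c → List (Word (a ℕ.+ b ℕ.+ c))
vertices a b c = filter (isVertex? a b c) (words (a ℕ.+ b ℕ.+ c))

edges : ∀ a b c → List (Word (a ℕ.+ b ℕ.+ c) × Word (a ℕ.+ b ℕ.+ c))
edges a b c = filter (λ (u , v) → u ⟶? v) (cartesianProduct (vertices a b c) (vertices a b c))

-- Edges of the (n,n,n) sort graph.
E : ℕ → ℕ
E n = length (edges n n n)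

-- Number of edges times payload size d = n.
T : ℕ → ℕ
T n = n ℕ.* E n

tiles : ℕ → ℕ → ℕ → ℕ → ℕ
tiles a b c d = a ℕ.* c ℕ.+ b ℕ.* d ℕ.+ (a ℕ.+ c) ℕ.* (b ℕ.+ d)

n!^k≢0 : ∀ n k → ℕ.NonZero ((n !) ℕ.^ k)
n!^k≢0 n k = ℕ.m^n≢0 (n !) k {{n ℕ.!≢0}}

{-# OPTIONS --safe #-}
module Submission where

-- Counting the edges at their tails, E n is the number of ascents in all vertices; splitting
-- off the first letter gives E n = n (3n)! / (n!)³.
--
-- For the asymptotics put cₙ = n C(2n,n)² / 16ⁿ and dₙ = n (3n)! / ((n!)³ 27ⁿ), two sequences
-- that increase to limits β and δ. Writing (6n)! / (n!)⁶ in two ways gives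
-- C(6n,3n) ((3n)!/(n!)³)² = ((6n)!/((2n)!)³) C(2n,n)³, hence 4 β δ⁴ = 3 δ² β³, so 4 δ² = 3 β².
-- That β = 1/π, for π the area of the disc, is Wästlund's proof of the Wallis product: with
-- aᵢ = C(2i,i)/4ⁱ the rectangles aᵢ × aⱼ tile the quadrant, those with i + j = k have total
-- area 1, and the quarter disc of radius a₀ + … + aₘ₋₁ = 2m aₘ lies between the unions of the
-- rectangles with i + j < m - 1 and with i + j ≤ m.
-- Hence δ = √3 / (2π).

-- Stirling's formula and integrals are avoided throughout. Wästlund's argument fits the definition
-- of π by lattice counts: after scaling by 4ᵐ the sides aᵢ are integers, the staircases are unions
-- of grid cells, and the disc of integer radius 2m C(2m,m) is compared with them by counting cells.
-- For the trinomial constant no such picture is used. The identity for (6n)! relates the sequences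
-- at n, 2n and 3n. Since a subsequence keeps the limit, it becomes an equation between β and δ, in
-- which 3 comes from the index 3n and 4 from the square of the index 2n. It has δ⁴ against δ², so
-- that δ² survives the cancellation, for which δ must be kept away from 0. Central binomial
-- coefficients enter squared, and the final comparison is between (2πδ)² and 3. So no root of a
-- rational sequence has to be taken: √3 enters through its square and the bound √3 ≥ 1.

open import Defs

-- Counting the edges of the sort graph.

module Counting where

  open import Data.Bool.Base using (true; false; if_then_else_; _∧_)
  open import Data.Bool.Properties using (∧-zeroʳ)
  open import Data.Fin.Base as Fin using (Fin)
  open import Data.Fin.Patterns using (0F; 1F; 2F)
  import Data.Fin.Properties as Fin
  open import Data.List.Base using (List; []; _∷_; _++_; map; filter; length; cartesianProduct; cartesianProductWith)
  open import Data.List.Properties using (map-++; map-cong; map-∘)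
  open import Data.Nat.Base using (ℕ; zero; suc; _+_; _*_; _!; NonZero)
  open import Data.Nat.ListAction using (sum)
  open import Data.Nat.ListAction.Properties using (sum-++)
  open import Data.Nat.Properties using (_≟_; +-identityʳ; +-suc; *-identityʳ; *-identityˡ; *-zeroʳ; suc-injective; *-distribˡ-+; *-cancelˡ-≡; +-cancelʳ-≡; m*n≢0; _!≢0)
  open import Data.Nat.Tactic.RingSolver using (solve-∀)
  open import Data.Product.Base using (_×_; _,_)
  open import Data.Sum.Base using (inj₁; inj₂)
  open import Data.Vec.Base as Vec using ([]; _∷_)
  import Data.Vec.Properties as Vec
  open import Function.Base using (_∘_)
  open import Level using (Level)
  open import Relation.Binary.PropositionalEquality
  open import Relation.Nullary using (Dec; yes; no; does; ¬_; contradiction)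
  open import Relation.Nullary.Decidable using (_×-dec_; _⊎-dec_)
  open import Relation.Unary using (Pred; Decidable)

  private variable
    ℓ : Level
    A B C : Set
    P Q : Set ℓ

  ∑ : List A → (A → ℕ) → ℕ
  ∑ xs f = sum (map f xs)

  ∑-cong : ∀ (xs : List A) {f g : A → ℕ} → (∀ x → f x ≡ g x) → ∑ xs f ≡ ∑ xs g
  ∑-cong xs h = cong sum (map-cong h xs)

  ∑-0 : ∀ (xs : List A) → ∑ xs (λ _ → 0) ≡ 0
  ∑-0 []       = refl
  ∑-0 (_ ∷ xs) = ∑-0 xs

  ∑-+ : ∀ (xs : List A) (f g : A → ℕ) → ∑ xs (λ x → f x + g x) ≡ ∑ xs f + ∑ xs g
  ∑-+ []       f g = refl
  ∑-+ (x ∷ xs) f g = trans (cong (f x + g x +_) (∑-+ xs f g)) (swap (f x) (g x) (∑ xs f) (∑ xs g))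
    where
    swap : ∀ a b c d → a + b + (c + d) ≡ a + c + (b + d)
    swap = solve-∀

  ∑-* : ∀ (xs : List A) k (f : A → ℕ) → ∑ xs (λ x → k * f x) ≡ k * ∑ xs f
  ∑-* []       k f = sym (*-zeroʳ k)
  ∑-* (x ∷ xs) k f = trans (cong (k * f x +_) (∑-* xs k f)) (sym (*-distribˡ-+ k (f x) (∑ xs f)))

  ∑-++ : ∀ (xs ys : List A) (f : A → ℕ) → ∑ (xs ++ ys) f ≡ ∑ xs f + ∑ ys f
  ∑-++ xs ys f = trans (cong sum (map-++ f xs ys)) (sum-++ (map f xs) (map f ys))

  ∑-map : ∀ (xs : List A) (g : A → B) (f : B → ℕ) → ∑ (map g xs) f ≡ ∑ xs (f ∘ g)
  ∑-map xs g f = cong sum (sym (map-∘ xs))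

  ∑-product : ∀ (_⊗_ : A → B → C) xs ys (f : C → ℕ) →
              ∑ (cartesianProductWith _⊗_ xs ys) f ≡ ∑ xs (λ x → ∑ ys (λ y → f (x ⊗ y)))
  ∑-product _⊗_ []       ys f = refl
  ∑-product _⊗_ (x ∷ xs) ys f = trans (∑-++ (map (x ⊗_) ys) _ f)
    (cong₂ _+_ (∑-map ys (x ⊗_) f) (∑-product _⊗_ xs ys f))

  ind : Dec P → ℕ
  ind d = if does d then 1 else 0

  length-filter : ∀ {R : Pred A ℓ} (R? : Decidable R) xs → length (filter R? xs) ≡ ∑ xs (ind ∘ R?)
  length-filter R? []       = refl
  length-filter R? (x ∷ xs) with does (R? x)
  ... | true  = cong suc (length-filter R? xs)
  ... | false = length-filter R? xs

  ∑-filter : ∀ {R : Pred A ℓ} (R? : Decidable R) xs f →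
             ∑ (filter R? xs) f ≡ ∑ xs (λ x → if does (R? x) then f x else 0)
  ∑-filter R? []       f = refl
  ∑-filter R? (x ∷ xs) f with does (R? x)
  ... | true  = cong (f x +_) (∑-filter R? xs f)
  ... | false = ∑-filter R? xs f

  ind-⇔ : (p : Dec P) (q : Dec Q) → (P → Q) → (Q → P) → ind p ≡ ind q
  ind-⇔ (yes p) (yes q) f g = refl
  ind-⇔ (yes p) (no ¬q) f g = contradiction (f p) ¬q
  ind-⇔ (no ¬p) (yes q) f g = contradiction (g q) ¬p
  ind-⇔ (no ¬p) (no ¬q) f g = refl

  ind-× : (p : Dec P) (q : Dec Q) → ind (p ×-dec q) ≡ ind p * ind q
  ind-× (yes _) q = sym (*-identityˡ (ind q))
  ind-× (no _)  q = refl

  ind-⊎ : (p : Dec P) (q : Dec Q) → (P → ¬ Q) → ind (p ⊎-dec q) ≡ ind p + ind q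
  ind-⊎ (yes p) (yes q) h = contradiction q (h p)
  ind-⊎ (yes p) (no _)  h = refl
  ind-⊎ (no _)  q       h = refl

  ∑-words : ∀ m (f : Word (suc m) → ℕ) →
    ∑ (words (suc m)) f ≡ ∑ (words m) (f ∘ (0F ∷_)) + ∑ (words m) (f ∘ (1F ∷_)) + ∑ (words m) (f ∘ (2F ∷_))
  ∑-words m f = trans (∑-product _∷_ (0F ∷ 1F ∷ 2F ∷ []) (words m) f)
    (assoc (∑ (words m) (f ∘ (0F ∷_))) (∑ (words m) (f ∘ (1F ∷_))) (∑ (words m) (f ∘ (2F ∷_))))
    where
    assoc : ∀ x y z → x + (y + (z + 0)) ≡ x + y + z
    assoc = solve-∀

  ∑-select : ∀ m (x : Fin 3) (f : Word m → ℕ) →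
             ∑ (words (suc m)) (λ v → ind (x Fin.≟ Vec.head v) * f (Vec.tail v)) ≡ ∑ (words m) f
  ∑-select m x f = trans (∑-words m _) (trans
      (cong₂ _+_ (cong₂ _+_ (∑-* (words m) (ind (x Fin.≟ 0F)) f) (∑-* (words m) (ind (x Fin.≟ 1F)) f))
                 (∑-* (words m) (ind (x Fin.≟ 2F)) f))
      (pick x (∑ (words m) f)))
    where
    pick : ∀ x s → ind (x Fin.≟ 0F) * s + ind (x Fin.≟ 1F) * s + ind (x Fin.≟ 2F) * s ≡ s
    pick 0F = solve-∀
    pick 1F = solve-∀
    pick 2F = solve-∀

  _≟ʷ_ : ∀ {m} (u v : Word m) → Dec (u ≡ v)
  _≟ʷ_ = Vec.≡-dec Fin._≟_

  -- The list `words m` contains each word exactly once, so that a sum over all `v` picks out the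
  -- single target of a given exchange with weight 1.
  ∑-≡ : ∀ {m} (u : Word m) → ∑ (words m) (λ v → ind (u ≟ʷ v)) ≡ 1
  ∑-≡ []              = refl
  ∑-≡ {suc m} (x ∷ u) = trans (∑-cong (words (suc m)) split) (trans (∑-select m x (λ v → ind (u ≟ʷ v))) (∑-≡ u))
    where
    split : ∀ v → ind ((x ∷ u) ≟ʷ v) ≡ ind (x Fin.≟ Vec.head v) * ind (u ≟ʷ Vec.tail v)
    split (y ∷ v) = trans (ind-⇔ ((x ∷ u) ≟ʷ (y ∷ v)) (x Fin.≟ y ×-dec u ≟ʷ v)
      (λ { refl → refl , refl }) (λ { (refl , refl) → refl })) (ind-× (x Fin.≟ y) (u ≟ʷ v))

  ascents : ∀ {m} → Word m → ℕ
  ascents []          = 0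
  ascents (x ∷ [])    = 0
  ascents (x ∷ y ∷ w) = ind (x Fin.<? y) + ascents (y ∷ w)

  -- An edge exchanges either the first two letters or two later ones. The first kind exists exactly
  -- at an ascent and has a single target; the second keeps the first letter, so that `∑-select`
  -- reduces it to the rest of the word.
  outdegree : ∀ {m} (u : Word m) → ∑ (words m) (λ v → ind (u ⟶? v)) ≡ ascents u
  outdegree []       = refl
  outdegree (x ∷ []) = refl
  outdegree {suc (suc m)} (x ∷ y ∷ w) = begin
    ∑ ws (λ v → ind ((x ∷ y ∷ w) ⟶? v))
      ≡⟨ ∑-cong ws split ⟩
    ∑ ws (λ v → ind (x Fin.<? y) * ind ((y ∷ x ∷ w) ≟ʷ v) + ind (x Fin.≟ Vec.head v) * ind ((y ∷ w) ⟶? Vec.tail v))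
      ≡⟨ ∑-+ ws _ _ ⟩
    ∑ ws (λ v → ind (x Fin.<? y) * ind ((y ∷ x ∷ w) ≟ʷ v)) + ∑ ws (λ v → ind (x Fin.≟ Vec.head v) * ind ((y ∷ w) ⟶? Vec.tail v))
      ≡⟨ cong₂ _+_ (trans (∑-* ws (ind (x Fin.<? y)) _) (trans (cong (ind (x Fin.<? y) *_) (∑-≡ (y ∷ x ∷ w))) (*-identityʳ _)))
                   (trans (∑-select (suc m) x _) (outdegree (y ∷ w))) ⟩
    ind (x Fin.<? y) + ascents (y ∷ w) ∎
    where
    open ≡-Reasoning
    ws : List (Word (suc (suc m)))
    ws = words (suc (suc m))
    split : ∀ v → ind ((x ∷ y ∷ w) ⟶? v) ≡
            ind (x Fin.<? y) * ind ((y ∷ x ∷ w) ≟ʷ v) + ind (x Fin.≟ Vec.head v) * ind ((y ∷ w) ⟶? Vec.tail v)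
    split v@(x′ ∷ v′) = trans
      (ind-⇔ ((x ∷ y ∷ w) ⟶? v) ((x Fin.<? y ×-dec (y ∷ x ∷ w) ≟ʷ v) ⊎-dec (x Fin.≟ x′ ×-dec (y ∷ w) ⟶? v′))
        (λ { (here x<y) → inj₁ (x<y , refl) ; (there e) → inj₂ (refl , e) })
        (λ { (inj₁ (x<y , refl)) → here x<y ; (inj₂ (refl , e)) → there e }))
      (trans (ind-⊎ (x Fin.<? y ×-dec (y ∷ x ∷ w) ≟ʷ v) (x Fin.≟ x′ ×-dec (y ∷ w) ⟶? v′)
          -- An exchange at the front replaces the first letter by a larger one, so that no target
          -- is counted twice.
          (λ { (x<y , refl) (x≡y , _) → Fin.<⇒≢ x<y x≡y }))
        (cong₂ _+_ (ind-× (x Fin.<? y) ((y ∷ x ∷ w) ≟ʷ v)) (ind-× (x Fin.≟ x′) ((y ∷ w) ⟶? v′))))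

  ⟶-occurrences : ∀ {m} {u v : Word m} → u ⟶ v → ∀ x → occurrences x u ≡ occurrences x v
  ⟶-occurrences (here {x = y} {y = z} {w = w} _) x with does (x Fin.≟ y) | does (x Fin.≟ z)
  ... | true  | true  = refl
  ... | true  | false = refl
  ... | false | true  = refl
  ... | false | false = refl
  ⟶-occurrences (there {x = y} e) x with does (x Fin.≟ y)
  ... | true  = cong suc (⟶-occurrences e x)
  ... | false = ⟶-occurrences e x

  -- `IsVertex` with the length freed from `a + b + c`, so that induction on the length needs no
  -- transport between vector types.
  Content : ∀ {m} → ℕ → ℕ → ℕ → Word m → Set
  Content a b c u = occurrences 0F u ≡ a × occurrences 1F u ≡ b × occurrences 2F u ≡ c

  content? : ∀ {m} a b c (u : Word m) → Dec (Content a b c u)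
  content? a b c u = occurrences 0F u ≟ a ×-dec occurrences 1F u ≟ b ×-dec occurrences 2F u ≟ c

  weight : ∀ m → ℕ → ℕ → ℕ → (Word m → ℕ) → ℕ
  weight m a b c f = ∑ (words m) (λ u → if does (content? a b c u) then f u else 0)

  -- An edge keeps the number of each letter, so that its head is a vertex whenever its tail is. The
  -- restriction on heads can therefore be dropped, and the inner sum is the full `outdegree`.
  E≡weight : ∀ n → E n ≡ weight (n + n + n) n n n ascents
  E≡weight n = begin
    E n
      ≡⟨ length-filter (λ (u , v) → u ⟶? v) (cartesianProduct vs vs) ⟩
    ∑ (cartesianProduct vs vs) (λ (u , v) → ind (u ⟶? v))
      ≡⟨ ∑-product _,_ vs vs _ ⟩
    ∑ vs (λ u → ∑ vs (λ v → ind (u ⟶? v)))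
      ≡⟨ ∑-filter (isVertex? n n n) ws _ ⟩
    ∑ ws (λ u → if does (isVertex? n n n u) then ∑ vs (λ v → ind (u ⟶? v)) else 0)
      ≡⟨ ∑-cong ws inner ⟩
    weight (n + n + n) n n n ascents ∎
    where
    open ≡-Reasoning
    vs ws : List (Word (n + n + n))
    vs = vertices n n n
    ws = words (n + n + n)
    ⟶-content : ∀ {u v} → u ⟶ v → IsVertex n n n u → IsVertex n n n v
    ⟶-content e (p , q , r) =
      trans (sym (⟶-occurrences e 0F)) p , trans (sym (⟶-occurrences e 1F)) q , trans (sym (⟶-occurrences e 2F)) r
    guarded : (p : Dec P) (q : Dec Q) → (Q → P) → (if does p then ind q else 0) ≡ ind q
    guarded (yes _) q       h = refl
    guarded (no ¬p) (yes q) h = contradiction (h q) ¬p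
    guarded (no _)  (no _)  h = refl
    if-cong : ∀ {x y} (p : Dec P) → (P → x ≡ y) → (if does p then x else 0) ≡ (if does p then y else 0)
    if-cong (yes p) h = h p
    if-cong (no _)  h = refl
    inner : ∀ u → (if does (isVertex? n n n u) then ∑ vs (λ v → ind (u ⟶? v)) else 0) ≡
                  (if does (content? n n n u) then ascents u else 0)
    inner u = if-cong (isVertex? n n n u) λ p → trans (∑-filter (isVertex? n n n) ws _)
      (trans (∑-cong ws λ v → guarded (isVertex? n n n v) (u ⟶? v) (λ e → ⟶-content e p)) (outdegree u))

  -- A word that begins with a letter needs at least one copy of it: the value 0 at 0 stands for the
  -- empty set of such words.
  lower : (ℕ → ℕ) → ℕ → ℕ
  lower g zero    = 0
  lower g (suc k) = g k

  weight-suc : ∀ m a b c f → weight (suc m) a b c f ≡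
    lower (λ a → weight m a b c (f ∘ (0F ∷_))) a +
    lower (λ b → weight m a b c (f ∘ (1F ∷_))) b +
    lower (λ c → weight m a b c (f ∘ (2F ∷_))) c
  weight-suc m a b c f = trans (∑-words m _) (cong₂ _+_ (cong₂ _+_ (first a) (second b)) (third c))
    where
    first : ∀ a → ∑ (words m) (λ u → if does (content? a b c (0F ∷ u)) then f (0F ∷ u) else 0) ≡
                  lower (λ a → weight m a b c (f ∘ (0F ∷_))) a
    first zero    = ∑-0 (words m)
    first (suc a) = refl
    second : ∀ b → ∑ (words m) (λ u → if does (content? a b c (1F ∷ u)) then f (1F ∷ u) else 0) ≡
                   lower (λ b → weight m a b c (f ∘ (1F ∷_))) b
    second zero    = trans (∑-cong (words m) λ u → cong (λ t → if t then f (1F ∷ u) else 0)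
                       (∧-zeroʳ (does (occurrences 0F u ≟ a)))) (∑-0 (words m))
    second (suc b) = refl
    third : ∀ c → ∑ (words m) (λ u → if does (content? a b c (2F ∷ u)) then f (2F ∷ u) else 0) ≡
                  lower (λ c → weight m a b c (f ∘ (2F ∷_))) c
    third zero    = trans (∑-cong (words m) λ u → cong (λ t → if t then f (2F ∷ u) else 0)
                      (trans (cong (does (occurrences 0F u ≟ a) ∧_) (∧-zeroʳ (does (occurrences 1F u ≟ b))))
                        (∧-zeroʳ (does (occurrences 0F u ≟ a))))) (∑-0 (words m))
    third (suc c) = refl

  weight-cong : ∀ m a b c {f g} → (∀ u → f u ≡ g u) → weight m a b c f ≡ weight m a b c g
  weight-cong m a b c h = ∑-cong (words m) λ u → cong (λ k → if does (content? a b c u) then k else 0) (h u)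

  weight-+ : ∀ m a b c f g → weight m a b c (λ u → f u + g u) ≡ weight m a b c f + weight m a b c g
  weight-+ m a b c f g = trans (∑-cong (words m) λ u → split (does (content? a b c u)) (f u) (g u)) (∑-+ (words m) _ _)
    where
    split : ∀ t x y → (if t then x + y else 0) ≡ (if t then x else 0) + (if t then y else 0)
    split true  x y = refl
    split false x y = refl

  count : ℕ → ℕ → ℕ → ℕ → ℕ
  count m a b c = weight m a b c (λ _ → 1)

  -- Removing the first letter gives the recurrence of the multinomial coefficients; the factorials
  -- are kept as factors so that everything stays in ℕ.
  count-! : ∀ m a b c → a + b + c ≡ m → a ! * b ! * c ! * count m a b c ≡ m !

  lowerᵃ lowerᵇ lowerᶜ : ℕ → ℕ → ℕ → ℕ → ℕ
  lowerᵃ m a b c = lower (λ a → count m a b c) a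
  lowerᵇ m a b c = lower (λ b → count m a b c) b
  lowerᶜ m a b c = lower (λ c → count m a b c) c

  lowerᵃ-! : ∀ m a b c → a + b + c ≡ suc m → a ! * b ! * c ! * lowerᵃ m a b c ≡ a * m !
  lowerᵃ-! m zero    b c e = *-zeroʳ (1 * b ! * c !)
  lowerᵃ-! m (suc a) b c e = trans (shuffle (suc a) (a !) (b !) (c !) _)
    (cong (suc a *_) (count-! m a b c (suc-injective e)))
    where
    shuffle : ∀ k x y z w → (k * x) * y * z * w ≡ k * (x * y * z * w)
    shuffle = solve-∀

  lowerᵇ-! : ∀ m a b c → a + b + c ≡ suc m → a ! * b ! * c ! * lowerᵇ m a b c ≡ b * m !
  lowerᵇ-! m a zero    c e = *-zeroʳ (a ! * 1 * c !)
  lowerᵇ-! m a (suc b) c e = trans (shuffle (suc b) (a !) (b !) (c !) _)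
    (cong (suc b *_) (count-! m a b c (suc-injective (trans (cong (_+ c) (sym (+-suc a b))) e))))
    where
    shuffle : ∀ k x y z w → x * (k * y) * z * w ≡ k * (x * y * z * w)
    shuffle = solve-∀

  lowerᶜ-! : ∀ m a b c → a + b + c ≡ suc m → a ! * b ! * c ! * lowerᶜ m a b c ≡ c * m !
  lowerᶜ-! m a b zero    e = *-zeroʳ (a ! * b ! * 1)
  lowerᶜ-! m a b (suc c) e = trans (shuffle (suc c) (a !) (b !) (c !) _)
    (cong (suc c *_) (count-! m a b c (suc-injective (trans (sym (+-suc (a + b) c)) e))))
    where
    shuffle : ∀ k x y z w → x * y * (k * z) * w ≡ k * (x * y * z * w)
    shuffle = solve-∀

  count-! zero    zero    zero    zero    e = refl
  count-! (suc m) a b c e = begin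
    x * count (suc m) a b c
      ≡⟨ cong (x *_) (weight-suc m a b c (λ _ → 1)) ⟩
    x * (lowerᵃ m a b c + lowerᵇ m a b c + lowerᶜ m a b c)
      ≡⟨ distrib x _ _ _ ⟩
    x * lowerᵃ m a b c + x * lowerᵇ m a b c + x * lowerᶜ m a b c
      ≡⟨ cong₂ _+_ (cong₂ _+_ (lowerᵃ-! m a b c e) (lowerᵇ-! m a b c e)) (lowerᶜ-! m a b c e) ⟩
    a * m ! + b * m ! + c * m !
      ≡⟨ collect a b c (m !) ⟩
    (a + b + c) * m !
      ≡⟨ cong (_* m !) e ⟩
    suc m * m ! ∎
    where
    open ≡-Reasoning
    x : ℕ
    x = a ! * b ! * c !
    distrib : ∀ x p q r → x * (p + q + r) ≡ x * p + x * q + x * r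
    distrib = solve-∀
    collect : ∀ a b c x → a * x + b * x + c * x ≡ (a + b + c) * x
    collect = solve-∀

  -- Total number of ascents over the words of a given content.

  e₂ : ℕ → ℕ → ℕ → ℕ
  e₂ a b c = a * b + a * c + b * c

  ascents-∷ : ∀ {m} x (u : Word (suc m)) → ascents (x ∷ u) ≡ ind (x Fin.<? Vec.head u) + ascents u
  ascents-∷ x (y ∷ w) = refl

  weight-0 : ∀ m a b c → weight m a b c (λ _ → 0) ≡ 0
  weight-0 m a b c = trans (∑-cong (words m) λ u → lemma (does (content? a b c u))) (∑-0 (words m))
    where
    lemma : ∀ t → (if t then 0 else 0) ≡ 0
    lemma true  = refl
    lemma false = refl

  lower-0 : ∀ {g} → (∀ i → g i ≡ 0) → ∀ k → lower g k ≡ 0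
  lower-0 h zero    = refl
  lower-0 h (suc k) = h k

  -- A new first 0 makes an ascent exactly when the next letter is 1 or 2, and `lowerᵇ` and `lowerᶜ`
  -- count the words that begin so. A first 1 gains only `lowerᶜ`, a first 2 nothing.
  ascents-0∷ : ∀ m a b c → weight (suc m) a b c (ascents ∘ (0F ∷_)) ≡
               lowerᵇ m a b c + lowerᶜ m a b c + weight (suc m) a b c ascents
  ascents-0∷ m a b c = trans (weight-cong (suc m) a b c (ascents-∷ 0F)) (trans (weight-+ (suc m) a b c _ ascents)
    (cong (_+ weight (suc m) a b c ascents) (trans (weight-suc m a b c _)
      (cong (λ z → z + lowerᵇ m a b c + lowerᶜ m a b c) (lower-0 (λ i → weight-0 m i b c) a)))))

  ascents-1∷ : ∀ m a b c → weight (suc m) a b c (ascents ∘ (1F ∷_)) ≡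
               lowerᶜ m a b c + weight (suc m) a b c ascents
  ascents-1∷ m a b c = trans (weight-cong (suc m) a b c (ascents-∷ 1F)) (trans (weight-+ (suc m) a b c _ ascents)
    (cong (_+ weight (suc m) a b c ascents) (trans (weight-suc m a b c _)
      (cong₂ (λ y z → y + z + lowerᶜ m a b c) (lower-0 (λ i → weight-0 m i b c) a) (lower-0 (λ i → weight-0 m a i c) b)))))

  ascents-2∷ : ∀ m a b c → weight (suc m) a b c (ascents ∘ (2F ∷_)) ≡ weight (suc m) a b c ascents
  ascents-2∷ m a b c = trans (weight-cong (suc m) a b c (ascents-∷ 2F)) (trans (weight-+ (suc m) a b c _ ascents)
    (cong (_+ weight (suc m) a b c ascents) (trans (weight-suc m a b c _)
      (cong₂ _+_ (cong₂ _+_ (lower-0 (λ i → weight-0 m i b c) a) (lower-0 (λ i → weight-0 m a i c) b))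
        (lower-0 (λ i → weight-0 m a b i) c)))))

  -- The closed form comes from fixing a position: each of the `m` adjacent pairs of places carries
  -- 0, 1 in ab (m - 1)! / (a! b! c!) words, and likewise for 0, 2 and 1, 2. The induction removes
  -- the first letter instead.
  ascents-! : ∀ m a b c → a + b + c ≡ suc m → a ! * b ! * c ! * weight (suc m) a b c ascents ≡ e₂ a b c * m !

  module _ (m : ℕ) where

    lowerᵃ-ascents : ∀ a b c → a + b + c ≡ suc (suc m) →
      a ! * b ! * c ! * lower (λ a → weight (suc m) a b c (ascents ∘ (0F ∷_))) a ≡ a * e₂ a b c * m !
    lowerᵃ-ascents zero    b c e = *-zeroʳ (1 * b ! * c !)
    lowerᵃ-ascents (suc a) b c e = begin
      suc a ! * b ! * c ! * weight (suc m) a b c (ascents ∘ (0F ∷_))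
        ≡⟨ cong (suc a ! * b ! * c ! *_) (ascents-0∷ m a b c) ⟩
      suc a * a ! * b ! * c ! * (lowerᵇ m a b c + lowerᶜ m a b c + weight (suc m) a b c ascents)
        ≡⟨ shuffle (suc a) (a !) (b !) (c !) _ _ _ ⟩
      suc a * (a ! * b ! * c ! * lowerᵇ m a b c + a ! * b ! * c ! * lowerᶜ m a b c + a ! * b ! * c ! * weight (suc m) a b c ascents)
        ≡⟨ cong (suc a *_) (cong₂ _+_ (cong₂ _+_ (lowerᵇ-! m a b c e′) (lowerᶜ-! m a b c e′)) (ascents-! m a b c e′)) ⟩
      suc a * (b * m ! + c * m ! + e₂ a b c * m !)
        ≡⟨ collect a b c (m !) ⟩
      suc a * e₂ (suc a) b c * m ! ∎
      where
      open ≡-Reasoning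
      e′ : a + b + c ≡ suc m
      e′ = suc-injective e
      shuffle : ∀ k x y z p q r → k * x * y * z * (p + q + r) ≡ k * (x * y * z * p + x * y * z * q + x * y * z * r)
      shuffle = solve-∀
      collect : ∀ a b c x → suc a * (b * x + c * x + (a * b + a * c + b * c) * x) ≡ suc a * (suc a * b + suc a * c + b * c) * x
      collect = solve-∀

    -- Taking away a 0 lowers `e₂` by b + c, which the new ascents after a first 0 return in full. A
    -- first 1 returns only c of the lost a + c, and a first 2 none of the lost a + b; the extra
    -- summand on the left makes up the deficit without subtraction.
    lowerᵇ-ascents : ∀ a b c → a + b + c ≡ suc (suc m) →
      a ! * b ! * c ! * lower (λ b → weight (suc m) a b c (ascents ∘ (1F ∷_))) b + a * b * m ! ≡ b * e₂ a b c * m !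
    lowerᵇ-ascents a zero    c e = cong₂ (λ y z → y + z * m !) (*-zeroʳ (a ! * 1 * c !)) (*-zeroʳ a)
    lowerᵇ-ascents a (suc b) c e = begin
      a ! * suc b ! * c ! * weight (suc m) a b c (ascents ∘ (1F ∷_)) + a * suc b * m !
        ≡⟨ cong (λ w → a ! * suc b ! * c ! * w + a * suc b * m !) (ascents-1∷ m a b c) ⟩
      a ! * (suc b * b !) * c ! * (lowerᶜ m a b c + weight (suc m) a b c ascents) + a * suc b * m !
        ≡⟨ shuffle (suc b) (a !) (b !) (c !) _ _ _ ⟩
      suc b * (a ! * b ! * c ! * lowerᶜ m a b c + a ! * b ! * c ! * weight (suc m) a b c ascents) + a * suc b * m !
        ≡⟨ cong (λ w → suc b * w + a * suc b * m !) (cong₂ _+_ (lowerᶜ-! m a b c e′) (ascents-! m a b c e′)) ⟩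
      suc b * (c * m ! + e₂ a b c * m !) + a * suc b * m !
        ≡⟨ collect a b c (m !) ⟩
      suc b * e₂ a (suc b) c * m ! ∎
      where
      open ≡-Reasoning
      e′ : a + b + c ≡ suc m
      e′ = suc-injective (trans (cong (_+ c) (sym (+-suc a b))) e)
      shuffle : ∀ k x y z p q r → x * (k * y) * z * (p + q) + r ≡ k * (x * y * z * p + x * y * z * q) + r
      shuffle = solve-∀
      collect : ∀ a b c x → suc b * (c * x + (a * b + a * c + b * c) * x) + a * suc b * x ≡
                            suc b * (a * suc b + a * c + suc b * c) * x
      collect = solve-∀

    lowerᶜ-ascents : ∀ a b c → a + b + c ≡ suc (suc m) →
      a ! * b ! * c ! * lower (λ c → weight (suc m) a b c (ascents ∘ (2F ∷_))) c + (a + b) * c * m ! ≡ c * e₂ a b c * m !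
    lowerᶜ-ascents a b zero    e = cong₂ (λ y z → y + z * m !) (*-zeroʳ (a ! * b ! * 1)) (*-zeroʳ (a + b))
    lowerᶜ-ascents a b (suc c) e = begin
      a ! * b ! * suc c ! * weight (suc m) a b c (ascents ∘ (2F ∷_)) + (a + b) * suc c * m !
        ≡⟨ cong (λ w → a ! * b ! * suc c ! * w + (a + b) * suc c * m !) (ascents-2∷ m a b c) ⟩
      a ! * b ! * (suc c * c !) * weight (suc m) a b c ascents + (a + b) * suc c * m !
        ≡⟨ shuffle (suc c) (a !) (b !) (c !) _ _ ⟩
      suc c * (a ! * b ! * c ! * weight (suc m) a b c ascents) + (a + b) * suc c * m !
        ≡⟨ cong (λ w → suc c * w + (a + b) * suc c * m !) (ascents-! m a b c e′) ⟩
      suc c * (e₂ a b c * m !) + (a + b) * suc c * m !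
        ≡⟨ collect a b c (m !) ⟩
      suc c * e₂ a b (suc c) * m ! ∎
      where
      open ≡-Reasoning
      e′ : a + b + c ≡ suc m
      e′ = suc-injective (trans (sym (+-suc (a + b) c)) e)
      shuffle : ∀ k x y z p r → x * y * (k * z) * p + r ≡ k * (x * y * z * p) + r
      shuffle = solve-∀
      collect : ∀ a b c x → suc c * ((a * b + a * c + b * c) * x) + (a + b) * suc c * x ≡
                            suc c * (a * b + a * suc c + b * suc c) * x
      collect = solve-∀

  ascents-! zero    1 0 0 e = refl
  ascents-! zero    0 1 0 e = refl
  ascents-! zero    0 0 1 e = refl
  -- The deficits ab and (a + b) c add up to one `e₂ a b c`, which is what reduces the factor m + 2
  -- to the m + 1 that completes the factorial.
  ascents-! (suc m) a b c e = +-cancelʳ-≡ (e₂ a b c * m !) _ _ (begin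
    x * weight (suc (suc m)) a b c ascents + e₂ a b c * m !
      ≡⟨ cong (λ w → x * w + e₂ a b c * m !) (weight-suc (suc m) a b c ascents) ⟩
    x * (X + Y + Z) + e₂ a b c * m !
      ≡⟨ distrib x X Y Z a b c (m !) ⟩
    x * X + (x * Y + a * b * m !) + (x * Z + (a + b) * c * m !)
      ≡⟨ cong₂ _+_ (cong₂ _+_ (lowerᵃ-ascents m a b c e) (lowerᵇ-ascents m a b c e)) (lowerᶜ-ascents m a b c e) ⟩
    a * e₂ a b c * m ! + b * e₂ a b c * m ! + c * e₂ a b c * m !
      ≡⟨ collect a b c (e₂ a b c) (m !) ⟩
    (a + b + c) * (e₂ a b c * m !)
      ≡⟨ cong (_* (e₂ a b c * m !)) e ⟩
    suc (suc m) * (e₂ a b c * m !)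
      ≡⟨ split m (e₂ a b c) (m !) ⟩
    e₂ a b c * (suc m * m !) + e₂ a b c * m ! ∎)
    where
    open ≡-Reasoning
    x X Y Z : ℕ
    x = a ! * b ! * c !
    X = lower (λ a → weight (suc m) a b c (ascents ∘ (0F ∷_))) a
    Y = lower (λ b → weight (suc m) a b c (ascents ∘ (1F ∷_))) b
    Z = lower (λ c → weight (suc m) a b c (ascents ∘ (2F ∷_))) c
    distrib : ∀ x X Y Z a b c f → x * (X + Y + Z) + (a * b + a * c + b * c) * f ≡ x * X + (x * Y + a * b * f) + (x * Z + (a + b) * c * f)
    distrib = solve-∀
    collect : ∀ a b c e f → a * e * f + b * e * f + c * e * f ≡ (a + b + c) * (e * f)
    collect = solve-∀
    split : ∀ m e f → suc (suc m) * (e * f) ≡ e * (suc m * f) + e * f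
    split = solve-∀

  -- Defined as numbers of words, hence natural numbers by construction; the words behind
  -- `centralBinomial` avoid the letter 2.
  trinomial centralBinomial : ℕ → ℕ
  trinomial n = count (n + n + n) n n n
  centralBinomial n = count (n + n + 0) n n 0

  E-! : ∀ n → n ! * n ! * n ! * E n ≡ n * (n + n + n) !
  E-! zero      = refl
  E-! n@(suc k) = begin
    n ! * n ! * n ! * E n
      ≡⟨ cong (n ! * n ! * n ! *_) (E≡weight n) ⟩
    n ! * n ! * n ! * weight (n + n + n) n n n ascents
      ≡⟨ ascents-! (k + n + n) n n n refl ⟩
    (n * n + n * n + n * n) * (k + n + n) !
      -- 3n² = n · 3n, and the factor 3n completes (3n - 1)! to (3n)!.
      ≡⟨ collect n ((k + n + n) !) ⟩
    n * ((n + n + n) * (k + n + n) !) ∎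
    where
    open ≡-Reasoning
    collect : ∀ n f → (n * n + n * n + n * n) * f ≡ n * ((n + n + n) * f)
    collect = solve-∀

  trinomial-! : ∀ n → n ! * n ! * n ! * trinomial n ≡ (n + n + n) !
  trinomial-! n = count-! (n + n + n) n n n refl

  centralBinomial-! : ∀ n → n ! * n ! * centralBinomial n ≡ (n + n) !
  centralBinomial-! n = trans (cong (_* centralBinomial n) (sym (*-identityʳ (n ! * n !))))
    (trans (count-! (n + n + 0) n n 0 refl) (cong _! (+-identityʳ (n + n))))

  n!²≢0 : ∀ n → NonZero (n ! * n !)
  n!²≢0 n = m*n≢0 (n !) (n !) {{n !≢0}} {{n !≢0}}

  n!³≢0 : ∀ n → NonZero (n ! * n ! * n !)
  n!³≢0 n = m*n≢0 (n ! * n !) (n !) {{n!²≢0 n}} {{n !≢0}}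

  E≡trinomial : ∀ n → E n ≡ n * trinomial n
  E≡trinomial n = *-cancelˡ-≡ (E n) (n * trinomial n) (n ! * n ! * n !) {{n!³≢0 n}}
    (trans (E-! n) (trans (cong (n *_) (sym (trinomial-! n))) (swap n (n ! * n ! * n !) (trinomial n))))
    where
    swap : ∀ n x t → n * (x * t) ≡ x * (n * t)
    swap = solve-∀

-- Rectangles and lattice points in the quarter disc.

module Grid where

  open PiLemmas using (S; S-mono; S-append; S-const; S-scale; S-add; inDisc-≤1)
  open import Data.Nat.Base
  open import Data.Nat.Properties
  open import Data.Nat.Tactic.RingSolver using (solve-∀)
  open import Data.Sum.Base using (inj₁; inj₂)
  open import Function.Base using (_∘_)
  open import Relation.Binary.PropositionalEquality
  open import Relation.Nullary using (yes; no; contradiction)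

  S-cong-< : ∀ n {f g} → (∀ i → i < n → f i ≡ g i) → S n f ≡ S n g
  S-cong-< n h = ≤-antisym (S-mono n λ i i<n → ≤-reflexive (h i i<n)) (S-mono n λ i i<n → ≤-reflexive (sym (h i i<n)))

  S-last : ∀ n f → S (suc n) f ≡ S n f + f n
  S-last n f = trans (cong (λ k → S k f) (+-comm 1 n)) (trans (S-append n 1 f)
    (cong (S n f +_) (trans (+-identityʳ (f (n + 0))) (cong f (+-identityʳ n)))))

  S-reverse : ∀ n f → S (suc n) f ≡ S (suc n) (λ i → f (n ∸ i))
  S-reverse zero    f = refl
  S-reverse (suc n) f = begin
    f 0 + S (suc n) (f ∘ suc)
      ≡⟨ cong (f 0 +_) (S-reverse n (f ∘ suc)) ⟩
    f 0 + S (suc n) (λ i → f (suc (n ∸ i)))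
      ≡⟨ +-comm (f 0) _ ⟩
    S (suc n) (λ i → f (suc (n ∸ i))) + f 0
      ≡⟨ cong₂ _+_ (S-cong-< (suc n) λ i i≤n → cong f (+-∸-assoc 1 (s≤s⁻¹ i≤n))) (cong f (n∸n≡0 (suc n))) ⟨
    S (suc n) (λ i → f (suc n ∸ i)) + f (suc n ∸ suc n)
      ≡⟨ S-last (suc n) (λ i → f (suc n ∸ i)) ⟨
    S (suc (suc n)) (λ i → f (suc n ∸ i)) ∎
    where open ≡-Reasoning

  S-≤-support : ∀ n l f → (∀ i → f i ≤ 1) → (∀ i → l ≤ i → f i ≡ 0) → S n f ≤ l
  S-≤-support n l f h z with ≤-total n l
  ... | inj₁ n≤l = ≤-trans (≤-count n) n≤l
    where
    ≤-count : ∀ n → S n f ≤ n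
    ≤-count n = subst (S n f ≤_) (trans (S-const n 1) (*-identityʳ n)) (S-mono n λ i _ → h i)
  ... | inj₂ l≤n = begin
    S n f                                        ≡⟨ cong (λ k → S k f) (m+[n∸m]≡n l≤n) ⟨
    S (l + (n ∸ l)) f                            ≡⟨ S-append l (n ∸ l) f ⟩
    S l f + S (n ∸ l) (λ i → f (l + i))          ≤⟨ +-mono-≤ (S-mono l λ i _ → h i) (S-mono (n ∸ l) λ i _ → ≤-reflexive (z (l + i) (m≤m+n l i))) ⟩
    S l (λ _ → 1) + S (n ∸ l) (λ _ → 0)          ≡⟨ cong₂ _+_ (S-const l 1) (S-const (n ∸ l) 0) ⟩
    l * 1 + (n ∸ l) * 0                          ≡⟨ cong₂ _+_ (*-identityʳ l) (*-zeroʳ (n ∸ l)) ⟩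
    l + 0                                        ≡⟨ +-identityʳ l ⟩
    l                                            ∎
    where open ≤-Reasoning

  S-prefix : ∀ {l n} f → l ≤ n → S l f ≤ S n f
  S-prefix {l} {n} f l≤n = subst (λ k → S l f ≤ S k f) (m+[n∸m]≡n l≤n)
    (subst (S l f ≤_) (sym (S-append l (n ∸ l) f)) (m≤m+n (S l f) _))

  S-≥-prefix : ∀ n l f → l ≤ n → (∀ i → i < l → 1 ≤ f i) → l ≤ S n f
  S-≥-prefix n l f l≤n h = ≤-trans (≤-reflexive (trans (sym (*-identityʳ l)) (sym (S-const l 1))))
    (≤-trans (S-mono l h) (S-prefix f l≤n))

  -- The range is cut into consecutive blocks of lengths `A 0`, `A 1`, ...: for the disc these are
  -- vertical strips, one for each column of rectangles.
  S-partial : ∀ (A : ℕ → ℕ) n f → S (S n A) f ≡ S n (λ i → S (A i) (λ r → f (S i A + r)))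
  S-partial A zero    f = refl
  S-partial A (suc n) f = begin
    S (S (suc n) A) f
      ≡⟨ cong (λ k → S k f) (S-last n A) ⟩
    S (S n A + A n) f
      ≡⟨ S-append (S n A) (A n) f ⟩
    S (S n A) f + S (A n) (λ r → f (S n A + r))
      ≡⟨ cong (_+ S (A n) (λ r → f (S n A + r))) (S-partial A n f) ⟩
    S n (λ i → S (A i) (λ r → f (S i A + r))) + S (A n) (λ r → f (S n A + r))
      ≡⟨ S-last n (λ i → S (A i) (λ r → f (S i A + r))) ⟨
    S (suc n) (λ i → S (A i) (λ r → f (S i A + r))) ∎
    where open ≡-Reasoning

  mono-from-step : ∀ (f : ℕ → ℕ) M → (∀ i → i < M → f i ≤ f (suc i)) → ∀ {i j} → i ≤ j → j ≤ M → f i ≤ f j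
  mono-from-step f M h {j = zero}  z≤n j≤M = ≤-refl
  mono-from-step f M h {i} {suc j} i≤j j<M with m≤n⇒m<n∨m≡n i≤j
  ... | inj₂ refl = ≤-refl
  ... | inj₁ i<j  = ≤-trans (mono-from-step f M h (s≤s⁻¹ i<j) (<⇒≤ j<M)) (h j j<M)

  antitone-from-step : ∀ (f : ℕ → ℕ) M → (∀ i → i < M → f (suc i) ≤ f i) → ∀ {i j} → i ≤ j → j ≤ M → f j ≤ f i
  antitone-from-step f M h {j = zero}  z≤n j≤M = ≤-refl
  antitone-from-step f M h {i} {suc j} i≤j j<M with m≤n⇒m<n∨m≡n i≤j
  ... | inj₂ refl = ≤-refl
  ... | inj₁ i<j  = ≤-trans (h j j<M) (antitone-from-step f M h (s≤s⁻¹ i<j) (<⇒≤ j<M))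

  inDisc-no : ∀ n x y → n * n ≤ x * x + y * y → inDisc n x y ≡ 0
  inDisc-no n x y le with x * x + y * y <? n * n
  ... | yes lt = contradiction le (<⇒≱ lt)
  ... | no _   = refl

  inDisc-yes : ∀ n x y → x * x + y * y < n * n → 1 ≤ inDisc n x y
  inDisc-yes n x y lt with x * x + y * y <? n * n
  ... | yes _  = ≤-refl
  ... | no ¬lt = contradiction lt ¬lt

  -- A is, up to scale, the sequence of coefficients of (1 - x)^(-1/2), whose square is 1 / (1 - x).
  module Staircase (M : ℕ) .{{_ : NonZero M}} (A : ℕ → ℕ)
    (step : ∀ i → i < M → 2 * suc i * A (suc i) ≡ suc (2 * i) * A i) where

    σ : ℕ → ℕ
    σ i = S i A

    σ-suc : ∀ i → σ (suc i) ≡ σ i + A i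
    σ-suc i = S-last i A

    -- The recurrence telescopes. This makes the radius `σ M` explicit and turns the square of `σ i`
    -- into 4i · i (A i)², to which the monotonicity lemmas apply.
    σ-closed : ∀ i → i ≤ M → σ i ≡ 2 * i * A i
    σ-closed zero    _   = refl
    σ-closed (suc i) i<M = begin
      σ (suc i)               ≡⟨ σ-suc i ⟩
      σ i + A i               ≡⟨ cong (_+ A i) (σ-closed i (<⇒≤ i<M)) ⟩
      2 * i * A i + A i       ≡⟨ +-comm (2 * i * A i) (A i) ⟩
      suc (2 * i) * A i       ≡⟨ step i i<M ⟨
      2 * suc i * A (suc i)   ∎
      where open ≡-Reasoning

    convolution : ℕ → ℕ
    convolution n = S (suc n) (λ i → A i * A (n ∸ i))

    -- Evaluated in two ways: the reversal of i and n - i gives n times the convolution, the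
    -- recurrence for `A` gives a step in n. This is the equation 2 (1 - x) f′ f = f² for f = (1 -
    -- x)^(-1/2), read coefficientwise.
    moment : ℕ → ℕ
    moment n = S (suc n) (λ i → 2 * i * (A i * A (n ∸ i)))

    moment-symmetric : ∀ n → moment n ≡ n * convolution n
    moment-symmetric n = begin
      S (suc n) (λ i → 2 * i * g i)
        ≡⟨ S-cong-< (suc n) (λ i _ → double i (g i)) ⟩
      S (suc n) (λ i → i * g i + i * g i)
        ≡⟨ S-add (suc n) (λ i → i * g i) (λ i → i * g i) ⟩
      S (suc n) (λ i → i * g i) + S (suc n) (λ i → i * g i)
        ≡⟨ cong (S (suc n) (λ i → i * g i) +_) (S-reverse n (λ i → i * g i)) ⟩
      S (suc n) (λ i → i * g i) + S (suc n) (λ i → (n ∸ i) * g (n ∸ i))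
        ≡⟨ S-add (suc n) (λ i → i * g i) (λ i → (n ∸ i) * g (n ∸ i)) ⟨
      S (suc n) (λ i → i * g i + (n ∸ i) * g (n ∸ i))
        ≡⟨ S-cong-< (suc n) (λ i i≤n → fold i (s≤s⁻¹ i≤n)) ⟩
      S (suc n) (λ i → n * g i)
        ≡⟨ S-scale (suc n) n g ⟩
      n * convolution n ∎
      where
      open ≡-Reasoning
      g : ℕ → ℕ
      g i = A i * A (n ∸ i)
      double : ∀ i x → 2 * i * x ≡ i * x + i * x
      double = solve-∀
      fold : ∀ i → i ≤ n → i * g i + (n ∸ i) * g (n ∸ i) ≡ n * g i
      fold i i≤n = begin
        i * g i + (n ∸ i) * g (n ∸ i)
          ≡⟨ cong (λ k → i * g i + (n ∸ i) * (A (n ∸ i) * A k)) (m∸[m∸n]≡n i≤n) ⟩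
        i * g i + (n ∸ i) * (A (n ∸ i) * A i)
          ≡⟨ cong (λ x → i * g i + (n ∸ i) * x) (*-comm (A (n ∸ i)) (A i)) ⟩
        i * g i + (n ∸ i) * g i
          ≡⟨ *-distribʳ-+ (g i) i (n ∸ i) ⟨
        (i + (n ∸ i)) * g i
          ≡⟨ cong (_* g i) (m+[n∸m]≡n i≤n) ⟩
        n * g i ∎

    moment-suc : ∀ n → n < M → moment (suc n) ≡ moment n + convolution n
    moment-suc n n<M = trans
      (S-cong-< (suc n) λ i i≤n → begin
        2 * suc i * (A (suc i) * A (n ∸ i))        ≡⟨ *-assoc (2 * suc i) (A (suc i)) (A (n ∸ i)) ⟨
        2 * suc i * A (suc i) * A (n ∸ i)          ≡⟨ cong (_* A (n ∸ i)) (step i (<-≤-trans i≤n n<M)) ⟩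
        suc (2 * i) * A i * A (n ∸ i)              ≡⟨ unfold i (A i) (A (n ∸ i)) ⟩
        2 * i * (A i * A (n ∸ i)) + A i * A (n ∸ i) ∎)
      (S-add (suc n) (λ i → 2 * i * (A i * A (n ∸ i))) (λ i → A i * A (n ∸ i)))
      where
      open ≡-Reasoning
      unfold : ∀ i x y → suc (2 * i) * x * y ≡ 2 * i * (x * y) + x * y
      unfold = solve-∀

    convolution-constant : ∀ n → n ≤ M → convolution n ≡ A 0 * A 0
    convolution-constant zero    _   = +-identityʳ (A 0 * A 0)
    convolution-constant (suc n) n<M = trans (*-cancelˡ-≡ _ _ (suc n) (begin
      suc n * convolution (suc n)      ≡⟨ moment-symmetric (suc n) ⟨
      moment (suc n)                   ≡⟨ moment-suc n n<M ⟩
      moment n + convolution n         ≡⟨ cong (_+ convolution n) (moment-symmetric n) ⟩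
      n * convolution n + convolution n ≡⟨ +-comm (n * convolution n) (convolution n) ⟩
      suc n * convolution n            ∎)) (convolution-constant n (<⇒≤ n<M))
      where open ≡-Reasoning

    -- Area of the union of the rectangles A i × A j with i + j < n.
    triangle : ℕ → ℕ
    triangle n = S n (λ i → A i * σ (n ∸ i))

    triangle-suc : ∀ n → triangle (suc n) ≡ triangle n + convolution n
    triangle-suc n = begin
      S (suc n) (λ i → A i * σ (suc n ∸ i))
        ≡⟨ S-cong-< (suc n) (λ i i≤n → trans
             (cong (A i *_) (trans (cong σ (+-∸-assoc 1 (s≤s⁻¹ i≤n))) (σ-suc (n ∸ i))))
             (*-distribˡ-+ (A i) (σ (n ∸ i)) (A (n ∸ i)))) ⟩
      S (suc n) (λ i → A i * σ (n ∸ i) + A i * A (n ∸ i))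
        ≡⟨ S-add (suc n) (λ i → A i * σ (n ∸ i)) (λ i → A i * A (n ∸ i)) ⟩
      S (suc n) (λ i → A i * σ (n ∸ i)) + convolution n
        ≡⟨ cong (_+ convolution n) (S-last n (λ i → A i * σ (n ∸ i))) ⟩
      triangle n + A n * σ (n ∸ n) + convolution n
        ≡⟨ cong (λ k → triangle n + A n * σ k + convolution n) (n∸n≡0 n) ⟩
      triangle n + A n * 0 + convolution n
        ≡⟨ cong (λ k → triangle n + k + convolution n) (*-zeroʳ (A n)) ⟩
      triangle n + 0 + convolution n
        ≡⟨ cong (_+ convolution n) (+-identityʳ (triangle n)) ⟩
      triangle n + convolution n ∎
      where open ≡-Reasoning

    triangle-area : ∀ n → n ≤ suc M → triangle n ≡ n * (A 0 * A 0)
    triangle-area zero    _    = refl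
    triangle-area (suc n) n≤M = trans (triangle-suc n) (trans
      (cong₂ _+_ (triangle-area n (<⇒≤ n≤M)) (convolution-constant n (s≤s⁻¹ n≤M)))
      (+-comm (n * (A 0 * A 0)) (A 0 * A 0)))

    square : ∀ i x → (2 * i * x) * (2 * i * x) ≡ 4 * i * (i * (x * x))
    square = solve-∀

    -- From (2i + 1)² = 4i (i + 1) + 1; for `shrinking` the identity is (2i + 1)(2i + 3) = 4 (i +
    -- 1)² - 1. These bound (A i)² from above and from below in terms of (A M)², which decides on
    -- which side of the circle a corner lies.
    growing : ∀ {i j} → i ≤ j → j ≤ M → i * (A i * A i) ≤ j * (A j * A j)
    growing = mono-from-step (λ i → i * (A i * A i)) M λ i i<M → *-cancelˡ-≤ (4 * suc i) (begin
      4 * suc i * (i * (A i * A i))                            ≤⟨ m≤m+n _ (A i * A i) ⟩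
      4 * suc i * (i * (A i * A i)) + A i * A i                ≡⟨ left i (A i) ⟩
      (suc (2 * i) * A i) * (suc (2 * i) * A i)                ≡⟨ cong₂ _*_ (step i i<M) (step i i<M) ⟨
      (2 * suc i * A (suc i)) * (2 * suc i * A (suc i))        ≡⟨ square (suc i) (A (suc i)) ⟩
      4 * suc i * (suc i * (A (suc i) * A (suc i)))            ∎)
      where
      open ≤-Reasoning
      left : ∀ i x → 4 * suc i * (i * (x * x)) + x * x ≡ (suc (2 * i) * x) * (suc (2 * i) * x)
      left = solve-∀

    shrinking : ∀ {i j} → i ≤ j → j ≤ M → suc (2 * j) * (A j * A j) ≤ suc (2 * i) * (A i * A i)
    shrinking = antitone-from-step (λ i → suc (2 * i) * (A i * A i)) M λ i i<M → *-cancelˡ-≤ (4 * suc i * suc i) (begin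
      4 * suc i * suc i * (suc (2 * suc i) * (A (suc i) * A (suc i)))
        ≡⟨ left i (A (suc i)) ⟩
      suc (2 * suc i) * ((2 * suc i * A (suc i)) * (2 * suc i * A (suc i)))
        ≡⟨ cong₂ (λ x y → suc (2 * suc i) * (x * y)) (step i i<M) (step i i<M) ⟩
      suc (2 * suc i) * ((suc (2 * i) * A i) * (suc (2 * i) * A i))
        ≤⟨ m≤m+n _ (suc (2 * i) * (A i * A i)) ⟩
      suc (2 * suc i) * ((suc (2 * i) * A i) * (suc (2 * i) * A i)) + suc (2 * i) * (A i * A i)
        ≡⟨ right i (A i) ⟩
      4 * suc i * suc i * (suc (2 * i) * (A i * A i)) ∎)
      where
      open ≤-Reasoning
      left : ∀ i x → 4 * suc i * suc i * (suc (2 * suc i) * (x * x)) ≡ suc (2 * suc i) * ((2 * suc i * x) * (2 * suc i * x))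
      left = solve-∀
      right : ∀ i x → suc (2 * suc i) * ((suc (2 * i) * x) * (suc (2 * i) * x)) + suc (2 * i) * (x * x) ≡
                      4 * suc i * suc i * (suc (2 * i) * (x * x))
      right = solve-∀

    -- By `growing`, the square of `σ i` is at most the fraction i / M of the squared radius, and
    -- the two fractions add up to 1.
    corner-inside : ∀ i l → i + l ≡ M → σ i * σ i + σ l * σ l ≤ σ M * σ M
    corner-inside i l e = *-cancelˡ-≤ M (begin
      M * (σ i * σ i + σ l * σ l)        ≡⟨ *-distribˡ-+ M (σ i * σ i) (σ l * σ l) ⟩
      M * (σ i * σ i) + M * (σ l * σ l)  ≤⟨ +-mono-≤ (scaled i (m+n≤o⇒m≤o i (≤-reflexive e))) (scaled l (m+n≤o⇒n≤o i (≤-reflexive e))) ⟩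
      i * (σ M * σ M) + l * (σ M * σ M)  ≡⟨ *-distribʳ-+ (σ M * σ M) i l ⟨
      (i + l) * (σ M * σ M)              ≡⟨ cong (_* (σ M * σ M)) e ⟩
      M * (σ M * σ M)                    ∎)
      where
      open ≤-Reasoning
      scaled : ∀ i → i ≤ M → M * (σ i * σ i) ≤ i * (σ M * σ M)
      scaled i i≤M = begin
        M * (σ i * σ i)                        ≡⟨ cong (λ s → M * (s * s)) (σ-closed i i≤M) ⟩
        M * ((2 * i * A i) * (2 * i * A i))    ≡⟨ left M i (A i) ⟩
        4 * M * i * (i * (A i * A i))          ≤⟨ *-monoʳ-≤ (4 * M * i) (growing i≤M ≤-refl) ⟩
        4 * M * i * (M * (A M * A M))          ≡⟨ right M i (A M) ⟩
        i * ((2 * M * A M) * (2 * M * A M))    ≡⟨ cong (λ s → i * (s * s)) (σ-closed M ≤-refl) ⟨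
        i * (σ M * σ M)                        ∎
        where
        left : ∀ m i x → m * ((2 * i * x) * (2 * i * x)) ≡ 4 * m * i * (i * (x * x))
        left = solve-∀
        right : ∀ m i x → 4 * m * i * (m * (x * x)) ≡ i * ((2 * m * x) * (2 * m * x))
        right = solve-∀

    -- By `shrinking`, the square of `σ (suc i)` is at least (2i + 1)(2M + 1) (A M)². As (2i + 1) +
    -- (2l + 1) = 2M, the sum is at least 2M (2M + 1) (A M)², while the squared radius is 4M² (A
    -- M)².
    corner-outside : ∀ i l → suc i + suc l ≡ suc M → σ M * σ M ≤ σ (suc i) * σ (suc i) + σ (suc l) * σ (suc l)
    corner-outside i l e = begin
      σ M * σ M
        ≡⟨ cong (λ s → s * s) (σ-closed M ≤-refl) ⟩
      (2 * M * A M) * (2 * M * A M)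
        ≤⟨ m≤m+n _ (2 * M * (A M * A M)) ⟩
      (2 * M * A M) * (2 * M * A M) + 2 * M * (A M * A M)
        ≡⟨ top M (A M) ⟩
      2 * M * (suc (2 * M) * (A M * A M))
        ≡⟨ cong (λ m → 2 * m * (suc (2 * M) * (A M * A M))) M≡ ⟩
      2 * suc (i + l) * (suc (2 * M) * (A M * A M))
        ≡⟨ split i l (suc (2 * M) * (A M * A M)) ⟩
      suc (2 * i) * (suc (2 * M) * (A M * A M)) + suc (2 * l) * (suc (2 * M) * (A M * A M))
        ≤⟨ +-mono-≤ (bound i (subst (suc i ≤_) (sym M≡) (s≤s (m≤m+n i l)))) (bound l (subst (suc l ≤_) (sym M≡) (s≤s (m≤n+m l i)))) ⟩
      σ (suc i) * σ (suc i) + σ (suc l) * σ (suc l) ∎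
      where
      open ≤-Reasoning
      M≡ : M ≡ suc (i + l)
      M≡ = suc-injective (trans (sym e) (cong suc (+-suc i l)))
      top : ∀ m x → (2 * m * x) * (2 * m * x) + 2 * m * (x * x) ≡ 2 * m * (suc (2 * m) * (x * x))
      top = solve-∀
      split : ∀ i l x → 2 * suc (i + l) * x ≡ suc (2 * i) * x + suc (2 * l) * x
      split = solve-∀
      bound : ∀ i → suc i ≤ M → suc (2 * i) * (suc (2 * M) * (A M * A M)) ≤ σ (suc i) * σ (suc i)
      bound i i<M = begin
        suc (2 * i) * (suc (2 * M) * (A M * A M))                                     ≤⟨ *-monoʳ-≤ (suc (2 * i)) (shrinking i<M ≤-refl) ⟩
        suc (2 * i) * (suc (2 * suc i) * (A (suc i) * A (suc i)))                     ≤⟨ m≤m+n _ (A (suc i) * A (suc i)) ⟩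
        suc (2 * i) * (suc (2 * suc i) * (A (suc i) * A (suc i))) + A (suc i) * A (suc i) ≡⟨ difference i (A (suc i)) ⟩
        (2 * suc i * A (suc i)) * (2 * suc i * A (suc i))                             ≡⟨ cong (λ s → s * s) (σ-closed (suc i) i<M) ⟨
        σ (suc i) * σ (suc i)                                                         ∎
        where
        difference : ∀ i x → suc (2 * i) * (suc (2 * suc i) * (x * x)) + x * x ≡ (2 * suc i * x) * (2 * suc i * x)
        difference = solve-∀

    σ-mono : ∀ {i j} → i ≤ j → σ i ≤ σ j
    σ-mono = S-prefix A

    row : ℕ → ℕ
    row x = S (σ M) (inDisc (σ M) x)

    -- Points of strip i at height σ (M + 1 - i) or more dominate, in both coordinates, the corner
    -- (σ i, σ (M + 1 - i)), which is not inside the open disc.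
    row-≤ : ∀ i r → i < M → row (σ i + r) ≤ σ (suc M ∸ i)
    -- `corner-outside` concerns corners off the axis; in the strip at the axis the height alone
    -- already reaches the radius.
    row-≤ zero    r i<M = S-≤-support (σ M) (σ (suc M)) (inDisc (σ M) r) (inDisc-≤1 (σ M) r)
      λ y le → inDisc-no (σ M) r y (≤-trans (*-mono-≤ le′ le′) (≤-trans (*-mono-≤ le le) (m≤n+m (y * y) (r * r))))
      where
      le′ : σ M ≤ σ (suc M)
      le′ = σ-mono (n≤1+n M)
    row-≤ (suc i) r i<M = S-≤-support (σ M) (σ (M ∸ i)) (inDisc (σ M) (σ (suc i) + r)) (inDisc-≤1 (σ M) (σ (suc i) + r))
      λ y le → inDisc-no (σ M) (σ (suc i) + r) y (≤-trans
        (subst (λ k → σ M * σ M ≤ σ (suc i) * σ (suc i) + σ k * σ k) (sym M∸i) (corner-outside i (M ∸ suc i) e))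
        (+-mono-≤ (*-mono-≤ (m≤m+n (σ (suc i)) r) (m≤m+n (σ (suc i)) r)) (*-mono-≤ le le)))
      where
      M∸i : M ∸ i ≡ suc (M ∸ suc i)
      M∸i = +-∸-assoc 1 (<⇒≤ i<M)
      e : suc i + suc (M ∸ suc i) ≡ suc M
      e = trans (+-suc (suc i) (M ∸ suc i)) (cong suc (m+[n∸m]≡n (<⇒≤ i<M)))

    -- A cell is counted by its lower left corner. For r < A i that point lies strictly below and to
    -- the left of (σ (i + 1), σ (M - i - 1)), so that it is inside the open disc even if the latter
    -- lies on the circle.
    row-≥ : ∀ i r → suc i ≤ M → r < A i → σ (M ∸ suc i) ≤ row (σ i + r)
    row-≥ i r i<M r<A = S-≥-prefix (σ M) (σ (M ∸ suc i)) (inDisc (σ M) (σ i + r)) (σ-mono (m∸n≤m M (suc i)))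
      λ y y< → inDisc-yes (σ M) (σ i + r) y (<-≤-trans
        (+-mono-< (*-mono-< x< x<) (*-mono-< y< y<))
        (corner-inside (suc i) (M ∸ suc i) (m+[n∸m]≡n i<M)))
      where
      x< : σ i + r < σ (suc i)
      x< = subst (σ i + r <_) (sym (σ-suc i)) (+-monoʳ-< (σ i) r<A)

    rows : quarterDisc (σ M) ≡ S M (λ i → S (A i) (λ r → row (σ i + r)))
    rows = S-partial A M row

    quarterDisc-≤ : quarterDisc (σ M) ≤ suc M * (A 0 * A 0)
    quarterDisc-≤ = begin
      quarterDisc (σ M)                             ≡⟨ rows ⟩
      S M (λ i → S (A i) (λ r → row (σ i + r)))     ≤⟨ S-mono M (λ i i<M → S-mono (A i) λ r _ → row-≤ i r i<M) ⟩
      S M (λ i → S (A i) (λ _ → σ (suc M ∸ i)))     ≡⟨ S-cong-< M (λ i _ → S-const (A i) (σ (suc M ∸ i))) ⟩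
      -- The disc has only the strips i < M; the summand for i = M can only increase the sum and
      -- completes the triangle.
      S M (λ i → A i * σ (suc M ∸ i))               ≤⟨ S-prefix (λ i → A i * σ (suc M ∸ i)) (n≤1+n M) ⟩
      triangle (suc M)                              ≡⟨ triangle-area (suc M) ≤-refl ⟩
      suc M * (A 0 * A 0)                           ∎
      where open ≤-Reasoning

    -- The rectangle i, j has its upper right corner at (σ (i + 1), σ (j + 1)); it fits into the
    -- disc when (i + 1) + (j + 1) ≤ M, that is, i + j < M - 1.
    quarterDisc-≥ : pred M * (A 0 * A 0) ≤ quarterDisc (σ M)
    quarterDisc-≥ = begin
      pred M * (A 0 * A 0)                          ≡⟨ triangle-area (pred M) (≤-trans pred≤ (n≤1+n M)) ⟨
      triangle (pred M)                             ≤⟨ S-prefix (λ i → A i * σ (pred M ∸ i)) pred≤ ⟩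
      S M (λ i → A i * σ (pred M ∸ i))              ≡⟨ S-cong-< M (λ i _ → S-const (A i) (σ (pred M ∸ i))) ⟨
      S M (λ i → S (A i) (λ _ → σ (pred M ∸ i)))    ≤⟨ S-mono M (λ i i<M → S-mono (A i) λ r r<A →
                                                          subst (λ k → σ k ≤ row (σ i + r)) (sym (pred-∸ M i)) (row-≥ i r i<M r<A)) ⟩
      S M (λ i → S (A i) (λ r → row (σ i + r)))     ≡⟨ rows ⟨
      quarterDisc (σ M)                             ∎
      where
      open ≤-Reasoning
      pred≤ : pred M ≤ M
      pred≤ = pred[n]≤n
      pred-∸ : ∀ m i → pred m ∸ i ≡ m ∸ suc i
      pred-∸ zero    i = 0∸n≡0 i
      pred-∸ (suc m) i = refl

-- Recurrences and growth of central binomial and trinomial coefficients.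

module Multinomials where

  open Counting
  open Grid
  open import Data.Nat.Base
  open import Data.Nat.Properties
  open import Data.Nat.Tactic.RingSolver using (solve-∀)
  open import Relation.Binary.PropositionalEquality

  [m*n]^k≡m^k*n^k : ∀ m n k → (m * n) ^ k ≡ m ^ k * n ^ k
  [m*n]^k≡m^k*n^k m n zero    = refl
  [m*n]^k≡m^k*n^k m n (suc k) = trans (cong (m * n *_) ([m*n]^k≡m^k*n^k m n k)) (swap m n (m ^ k) (n ^ k))
    where
    swap : ∀ m n x y → m * n * (x * y) ≡ m * x * (n * y)
    swap = solve-∀

  centralBinomial-suc : ∀ n → suc n * centralBinomial (suc n) ≡ 2 * suc (2 * n) * centralBinomial n
  centralBinomial-suc n = *-cancelˡ-≡ _ _ (n ! * n ! * suc n)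
    {{m*n≢0 (n ! * n !) (suc n) {{n!²≢0 n}}}} (begin
    n ! * n ! * suc n * (suc n * centralBinomial (suc n))
      ≡⟨ left (suc n) (n !) _ ⟩
    suc n ! * suc n ! * centralBinomial (suc n)
      ≡⟨ centralBinomial-! (suc n) ⟩
    (suc n + suc n) !
      ≡⟨ cong (λ k → suc k !) (+-suc n n) ⟩
    suc (suc (n + n)) * (suc (n + n) * (n + n) !)
      ≡⟨ cong (λ k → suc (suc (n + n)) * (suc (n + n) * k)) (centralBinomial-! n) ⟨
    suc (suc (n + n)) * (suc (n + n) * (n ! * n ! * centralBinomial n))
      ≡⟨ right n (n !) _ ⟩
    n ! * n ! * suc n * (2 * suc (2 * n) * centralBinomial n) ∎)
    where
    open ≡-Reasoning
    left : ∀ k x u → x * x * k * (k * u) ≡ (k * x) * (k * x) * u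
    left = solve-∀
    right : ∀ n x u → suc (suc (n + n)) * (suc (n + n) * (x * x * u)) ≡ x * x * suc n * (2 * suc (2 * n) * u)
    right = solve-∀

  trinomial-suc : ∀ n → suc n * suc n * trinomial (suc n) ≡ 3 * suc (3 * n) * suc (suc (3 * n)) * trinomial n
  trinomial-suc n = *-cancelˡ-≡ _ _ (n ! * n ! * n ! * suc n)
    {{m*n≢0 (n ! * n ! * n !) (suc n) {{n!³≢0 n}}}} (begin
    n ! * n ! * n ! * suc n * (suc n * suc n * trinomial (suc n))
      ≡⟨ left (suc n) (n !) _ ⟩
    suc n ! * suc n ! * suc n ! * trinomial (suc n)
      ≡⟨ trinomial-! (suc n) ⟩
    (suc n + suc n + suc n) !
      ≡⟨ cong _! (shift n) ⟩
    suc (suc (suc (n + n + n))) * (suc (suc (n + n + n)) * (suc (n + n + n) * (n + n + n) !))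
      ≡⟨ cong (λ k → suc (suc (suc (n + n + n))) * (suc (suc (n + n + n)) * (suc (n + n + n) * k))) (trinomial-! n) ⟨
    suc (suc (suc (n + n + n))) * (suc (suc (n + n + n)) * (suc (n + n + n) * (n ! * n ! * n ! * trinomial n)))
      ≡⟨ right n (n !) _ ⟩
    n ! * n ! * n ! * suc n * (3 * suc (3 * n) * suc (suc (3 * n)) * trinomial n) ∎)
    where
    open ≡-Reasoning
    shift : ∀ n → suc n + suc n + suc n ≡ suc (suc (suc (n + n + n)))
    shift = solve-∀
    left : ∀ k x u → x * x * x * k * (k * k * u) ≡ (k * x) * (k * x) * (k * x) * u
    left = solve-∀
    right : ∀ n x u → suc (suc (suc (n + n + n))) * (suc (suc (n + n + n)) * (suc (n + n + n) * (x * x * x * u))) ≡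
                      x * x * x * suc n * (3 * suc (3 * n) * suc (suc (3 * n)) * u)
    right = solve-∀

  -- Both sides are (6n)! / (n!)⁶.
  duplication : ∀ n → centralBinomial (n + n + n) * (trinomial n * trinomial n) ≡
                      trinomial (n + n) * (centralBinomial n * centralBinomial n * centralBinomial n)
  duplication n = *-cancelˡ-≡ _ _ (x * x * x * (x * x * x))
    {{m*n≢0 (x * x * x) (x * x * x) {{n!³≢0 n}} {{n!³≢0 n}}}} (begin
    x * x * x * (x * x * x) * (centralBinomial (n + n + n) * (trinomial n * trinomial n))
      ≡⟨ left x (trinomial n) _ ⟩
    (x * x * x * trinomial n) * (x * x * x * trinomial n) * centralBinomial (n + n + n)
      ≡⟨ cong (λ k → k * k * centralBinomial (n + n + n)) (trinomial-! n) ⟩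
    (n + n + n) ! * (n + n + n) ! * centralBinomial (n + n + n)
      ≡⟨ centralBinomial-! (n + n + n) ⟩
    (n + n + n + (n + n + n)) !
      ≡⟨ cong _! (six n) ⟩
    (n + n + (n + n) + (n + n)) !
      ≡⟨ trinomial-! (n + n) ⟨
    (n + n) ! * (n + n) ! * (n + n) ! * trinomial (n + n)
      ≡⟨ cong (λ k → k * k * k * trinomial (n + n)) (centralBinomial-! n) ⟨
    (x * x * centralBinomial n) * (x * x * centralBinomial n) * (x * x * centralBinomial n) * trinomial (n + n)
      ≡⟨ right x (centralBinomial n) _ ⟩
    x * x * x * (x * x * x) * (trinomial (n + n) * (centralBinomial n * centralBinomial n * centralBinomial n)) ∎)
    where
    open ≡-Reasoning
    x : ℕ
    x = n !
    six : ∀ n → n + n + n + (n + n + n) ≡ n + n + (n + n) + (n + n)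
    six = solve-∀
    left : ∀ x v w → x * x * x * (x * x * x) * (w * (v * v)) ≡ (x * x * x * v) * (x * x * x * v) * w
    left = solve-∀
    right : ∀ x u w → (x * x * u) * (x * x * u) * (x * x * u) * w ≡ x * x * x * (x * x * x) * (w * (u * u * u))
    right = solve-∀

  centralBinomial>0 : ∀ n → 0 < centralBinomial n
  centralBinomial>0 n = n≢0⇒n>0 λ e → ≢-nonZero⁻¹ ((n + n) !) {{(n + n) !≢0}}
    (trans (sym (centralBinomial-! n)) (trans (cong (n ! * n ! *_) e) (*-zeroʳ (n ! * n !))))

  -- The term added in this and the next three bounds is the exact difference of two polynomials in
  -- n, here (4n + 2)² = 16n (n + 1) + 4. The bounds are the hypotheses of the enclosures of β and
  -- δ.
  binomial-growth : ∀ n → n * (16 * (centralBinomial n * centralBinomial n)) ≤ suc n * (centralBinomial (suc n) * centralBinomial (suc n))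
  binomial-growth n = *-cancelˡ-≤ (suc n) (begin
    suc n * (n * (16 * (u * u)))
      ≤⟨ m≤m+n _ (4 * (u * u)) ⟩
    suc n * (n * (16 * (u * u))) + 4 * (u * u)
      ≡⟨ left n u ⟩
    (2 * suc (2 * n) * u) * (2 * suc (2 * n) * u)
      ≡⟨ cong (λ k → k * k) (centralBinomial-suc n) ⟨
    (suc n * centralBinomial (suc n)) * (suc n * centralBinomial (suc n))
      ≡⟨ right (suc n) (centralBinomial (suc n)) ⟩
    suc n * (suc n * (centralBinomial (suc n) * centralBinomial (suc n))) ∎)
    where
    open ≤-Reasoning
    u : ℕ
    u = centralBinomial n
    left : ∀ n u → suc n * (n * (16 * (u * u))) + 4 * (u * u) ≡ (2 * suc (2 * n) * u) * (2 * suc (2 * n) * u)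
    left = solve-∀
    right : ∀ k u → (k * u) * (k * u) ≡ k * (k * (u * u))
    right = solve-∀

  binomial-decay : ∀ n → suc (suc n) * (centralBinomial (suc n) * centralBinomial (suc n)) ≤ suc n * (16 * (centralBinomial n * centralBinomial n))
  binomial-decay n = *-cancelˡ-≤ (suc n * suc n) (begin
    suc n * suc n * (suc (suc n) * (centralBinomial (suc n) * centralBinomial (suc n)))
      ≡⟨ left n (centralBinomial (suc n)) ⟩
    suc (suc n) * ((suc n * centralBinomial (suc n)) * (suc n * centralBinomial (suc n)))
      ≡⟨ cong (λ k → suc (suc n) * (k * k)) (centralBinomial-suc n) ⟩
    suc (suc n) * ((2 * suc (2 * n) * u) * (2 * suc (2 * n) * u))
      ≤⟨ m≤m+n _ ((12 * n + 8) * (u * u)) ⟩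
    suc (suc n) * ((2 * suc (2 * n) * u) * (2 * suc (2 * n) * u)) + (12 * n + 8) * (u * u)
      ≡⟨ right n u ⟩
    suc n * suc n * (suc n * (16 * (u * u))) ∎)
    where
    open ≤-Reasoning
    u : ℕ
    u = centralBinomial n
    left : ∀ n u → suc n * suc n * (suc (suc n) * (u * u)) ≡ suc (suc n) * ((suc n * u) * (suc n * u))
    left = solve-∀
    right : ∀ n u → suc (suc n) * ((2 * suc (2 * n) * u) * (2 * suc (2 * n) * u)) + (12 * n + 8) * (u * u) ≡
                    suc n * suc n * (suc n * (16 * (u * u)))
    right = solve-∀

  trinomial-growth : ∀ n → n * (27 * trinomial n) ≤ suc n * trinomial (suc n)
  trinomial-growth n = *-cancelˡ-≤ (suc n) (begin
    suc n * (n * (27 * trinomial n))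
      ≤⟨ m≤m+n _ (6 * trinomial n) ⟩
    suc n * (n * (27 * trinomial n)) + 6 * trinomial n
      ≡⟨ left n (trinomial n) ⟩
    3 * suc (3 * n) * suc (suc (3 * n)) * trinomial n
      ≡⟨ trinomial-suc n ⟨
    suc n * suc n * trinomial (suc n)
      ≡⟨ *-assoc (suc n) (suc n) (trinomial (suc n)) ⟩
    suc n * (suc n * trinomial (suc n)) ∎)
    where
    open ≤-Reasoning
    left : ∀ n v → suc n * (n * (27 * v)) + 6 * v ≡ 3 * suc (3 * n) * suc (suc (3 * n)) * v
    left = solve-∀

  trinomial-decay : ∀ n → suc (suc n) * trinomial (suc n) ≤ suc n * (27 * trinomial n)
  trinomial-decay n = *-cancelˡ-≤ (suc n * suc n) (begin
    suc n * suc n * (suc (suc n) * trinomial (suc n))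
      ≡⟨ left n (trinomial (suc n)) ⟩
    suc (suc n) * (suc n * suc n * trinomial (suc n))
      ≡⟨ cong (suc (suc n) *_) (trinomial-suc n) ⟩
    suc (suc n) * (3 * suc (3 * n) * suc (suc (3 * n)) * trinomial n)
      ≤⟨ m≤m+n _ ((21 * n + 15) * trinomial n) ⟩
    suc (suc n) * (3 * suc (3 * n) * suc (suc (3 * n)) * trinomial n) + (21 * n + 15) * trinomial n
      ≡⟨ right n (trinomial n) ⟩
    suc n * suc n * (suc n * (27 * trinomial n)) ∎)
    where
    open ≤-Reasoning
    left : ∀ n v → suc n * suc n * (suc (suc n) * v) ≡ suc (suc n) * (suc n * suc n * v)
    left = solve-∀
    right : ∀ n v → suc (suc n) * (3 * suc (3 * n) * suc (suc (3 * n)) * v) + (21 * n + 15) * v ≡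
                    suc n * suc n * (suc n * (27 * v))
    right = solve-∀

  module Wallis (M : ℕ) .{{_ : NonZero M}} where

    -- For i ≤ M this is C(2i,i) / 4ⁱ times 4ᴹ, an integer, so that the rectangles consist of grid
    -- cells. Beyond M the truncated subtraction breaks the recurrence, whence the bound in `step`.
    A : ℕ → ℕ
    A i = 4 ^ (M ∸ i) * centralBinomial i

    step : ∀ i → i < M → 2 * suc i * A (suc i) ≡ suc (2 * i) * A i
    step i i<M = begin
      2 * suc i * (4 ^ (M ∸ suc i) * centralBinomial (suc i))
        ≡⟨ left (suc i) (4 ^ (M ∸ suc i)) (centralBinomial (suc i)) ⟩
      2 * 4 ^ (M ∸ suc i) * (suc i * centralBinomial (suc i))
        ≡⟨ cong (2 * 4 ^ (M ∸ suc i) *_) (centralBinomial-suc i) ⟩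
      2 * 4 ^ (M ∸ suc i) * (2 * suc (2 * i) * centralBinomial i)
        ≡⟨ right (suc (2 * i)) (4 ^ (M ∸ suc i)) (centralBinomial i) ⟩
      suc (2 * i) * (4 ^ suc (M ∸ suc i) * centralBinomial i)
        ≡⟨ cong (λ k → suc (2 * i) * (4 ^ k * centralBinomial i)) (+-∸-assoc 1 i<M) ⟨
      suc (2 * i) * (4 ^ (M ∸ i) * centralBinomial i) ∎
      where
      open ≡-Reasoning
      left : ∀ k x u → 2 * k * (x * u) ≡ 2 * x * (k * u)
      left = solve-∀
      right : ∀ k x u → 2 * x * (2 * k * u) ≡ k * (4 * x * u)
      right = solve-∀

    open Staircase M A step

    radius : σ M ≡ 2 * M * centralBinomial M
    radius = trans (σ-closed M ≤-refl) (cong (2 * M *_)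
      (trans (cong (λ k → 4 ^ k * centralBinomial M) (n∸n≡0 M)) (*-identityˡ (centralBinomial M))))

    -- This is the unit of area: the unit square has side `A 0`, measured in grid cells.
    A₀² : A 0 * A 0 ≡ 16 ^ M
    A₀² = trans (cong₂ _*_ (*-identityʳ (4 ^ M)) (*-identityʳ (4 ^ M))) (sym ([m*n]^k≡m^k*n^k 4 4 M))

    quarterDisc-upper : quarterDisc (2 * M * centralBinomial M) ≤ suc M * 16 ^ M
    quarterDisc-upper = subst₂ (λ r a → quarterDisc r ≤ suc M * a) radius A₀² quarterDisc-≤

    quarterDisc-lower : pred M * 16 ^ M ≤ quarterDisc (2 * M * centralBinomial M)
    quarterDisc-lower = subst₂ (λ r a → pred M * a ≤ quarterDisc r) radius A₀² quarterDisc-≥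

-- Natural numbers in ℚ and convergence by enclosure.

module Limits where

  open Counting
  open Multinomials
  open import Data.Integer.Base as ℤ using (+_)
  import Data.Integer.Properties as ℤ
  open import Data.Nat.Base as ℕ using (ℕ; zero; suc; z≤n; s≤s; _!)
  import Data.Nat.Properties as ℕ
  open import Data.Nat.Tactic.RingSolver using (solve-∀)
  open import Data.Product.Base using (∃-syntax; _×_; _,_; proj₁; proj₂)
  open import Data.Rational.Base
  open import Data.Rational.Properties
  open import Data.Rational.Solver using (module +-*-Solver)
  import Data.Rational.Unnormalised.Base as ℚᵘ
  import Data.Rational.Unnormalised.Properties as ℚᵘ
  open import Data.Sum.Base using (inj₂)
  open import Relation.Binary.PropositionalEquality
  open RationalLemmas
  open CauchyLemmas
  open +-*-Solver using (solve; _:+_; _:*_; _:=_; :-_; _:-_; con)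
  open SqrtLemmas using (isqrt-spec; square-cancel-<)
  open ExpLemmas using (1/!; 0≤1/!; module Powers)
  open import Algebra.Definitions.RawSemiring +-*-rawSemiring using (_^_)

  ι : ℕ → ℚ
  ι n = + n / 1

  ι-* : ∀ m n → ι m * ι n ≡ ι (m ℕ.* n)
  ι-* m n = toℚᵘ-injective (ℚᵘ.≃-trans (toℚᵘ-homo-* (ι m) (ι n))
    (ℚᵘ.≃-trans (ℚᵘ.*-cong (fracᵘ m 0) (fracᵘ n 0))
    (ℚᵘ.≃-trans (ℚᵘ.*≡* (cong (ℤ._* + 1) (sym (ℤ.pos-* m n)))) (ℚᵘ.≃-sym (fracᵘ (m ℕ.* n) 0)))))

  ι-+ : ∀ m n → ι m + ι n ≡ ι (m ℕ.+ n)
  ι-+ m n = trans (frac-+ m 0 n 0) (cong₂ (λ x y → ι (x ℕ.+ y)) (ℕ.*-identityʳ m) (ℕ.*-identityʳ n))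

  ι-≤ : ∀ {m n} → m ℕ.≤ n → ι m ≤ ι n
  ι-≤ {m} {n} le = frac-≤ m 0 n 0 (ℕ.*-monoˡ-≤ 1 le)

  0≤ι : ∀ n → 0ℚ ≤ ι n
  0≤ι n = frac-nonNeg n 0

  ι-positive : ∀ n .{{_ : ℕ.NonZero n}} → Positive (ι n)
  ι-positive (suc n) = positive (frac-pos (suc n) 0 (s≤s z≤n))

  frac-ι : ∀ m n .{{_ : ℕ.NonZero n}} → (+ m / n) * ι n ≡ ι m
  frac-ι m (suc n) = toℚᵘ-injective (ℚᵘ.≃-trans (toℚᵘ-homo-* (+ m / suc n) (ι (suc n)))
    (ℚᵘ.≃-trans (ℚᵘ.*-cong (fracᵘ m n) (fracᵘ (suc n) 0))
    (ℚᵘ.≃-trans (ℚᵘ.*≡* (ℤ.*-assoc (+ m) (+ suc n) (+ 1))) (ℚᵘ.≃-sym (fracᵘ m 0)))))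

  *-cancelʳ : ∀ {p q} r .{{_ : Positive r}} → p * r ≡ q * r → p ≡ q
  *-cancelʳ r e = ≤-antisym (*-cancelʳ-≤-pos r (≤-reflexive e)) (*-cancelʳ-≤-pos r (≤-reflexive (sym e)))

  -- Clearing a common denominator `k` moves an inequality from ℚ to ℕ, where the combinatorial
  -- bounds live.
  ≤-via-ι : ∀ {p q} k m n .{{_ : ℕ.NonZero k}} → p * ι k ≡ ι m → q * ι k ≡ ι n → m ℕ.≤ n → p ≤ q
  ≤-via-ι k m n e f le = *-cancelʳ-≤-pos (ι k) {{ι-positive k}} (subst₂ _≤_ (sym e) (sym f) (ι-≤ le))

  -- If a n / qⁿ ~ C / n with n a n / qⁿ increasing and (n + 1) a n / qⁿ decreasing, the two
  -- sequences enclose C.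
  module Enclosure (q : ℕ) .{{_ : ℕ.NonZero q}} (a : ℕ → ℕ) (a₀ : a 0 ≡ 1)
    (growth : ∀ n → n ℕ.* (q ℕ.* a n) ℕ.≤ suc n ℕ.* a (suc n))
    (decay : ∀ n → suc (suc n) ℕ.* a (suc n) ℕ.≤ suc n ℕ.* (q ℕ.* a n)) where

    q^n≢0 : ∀ n → ℕ.NonZero (q ℕ.^ n)
    q^n≢0 n = ℕ.m^n≢0 q n

    ratio : ℕ → ℚ
    ratio n = (+ a n / (q ℕ.^ n)) {{q^n≢0 n}}

    ratio-ι : ∀ n → ratio n * ι (q ℕ.^ n) ≡ ι (a n)
    ratio-ι n = frac-ι (a n) (q ℕ.^ n) {{q^n≢0 n}}

    lo hi : ℕ → ℚ
    lo n = ι n * ratio n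
    hi n = ι (suc n) * ratio n

    multiple : ∀ k n → ι k * ratio n * ι (q ℕ.^ n) ≡ ι (k ℕ.* a n)
    multiple k n = trans (*-assoc (ι k) (ratio n) _) (trans (cong (ι k *_) (ratio-ι n)) (ι-* k (a n)))

    multiple-suc : ∀ k n → ι k * ratio n * ι (q ℕ.^ suc n) ≡ ι (k ℕ.* (q ℕ.* a n))
    multiple-suc k n = trans (cong (ι k * ratio n *_) (sym (ι-* q (q ℕ.^ n))))
      (trans (shuffle (ι k * ratio n) (ι q) (ι (q ℕ.^ n)))
        (trans (cong (_* ι q) (multiple k n)) (trans (ι-* (k ℕ.* a n) q)
          (cong ι (move k (a n) q)))))
      where
      shuffle : ∀ x y z → x * (y * z) ≡ x * z * y
      shuffle = solve 3 (λ x y z → x :* (y :* z) := x :* z :* y) refl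
      move : ∀ k a q → k ℕ.* a ℕ.* q ≡ k ℕ.* (q ℕ.* a)
      move = solve-∀

    lo-step : ∀ n → lo n ≤ lo (suc n)
    lo-step n = ≤-via-ι (q ℕ.^ suc n) _ _ {{q^n≢0 (suc n)}} (multiple-suc n n) (multiple (suc n) (suc n)) (growth n)

    hi-step : ∀ n → hi (suc n) ≤ hi n
    hi-step n = ≤-via-ι (q ℕ.^ suc n) _ _ {{q^n≢0 (suc n)}} (multiple (suc (suc n)) (suc n)) (multiple-suc (suc n) n) (decay n)

    lo-mono : ∀ {m n} → m ℕ.≤′ n → lo m ≤ lo n
    lo-mono (ℕ.≤′-reflexive refl) = ≤-refl
    lo-mono {m} {suc n} (ℕ.≤′-step le) = ≤-trans (lo-mono le) (lo-step n)

    hi-antitone : ∀ {m n} → m ℕ.≤′ n → hi n ≤ hi m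
    hi-antitone (ℕ.≤′-reflexive refl) = ≤-refl
    hi-antitone {m} {suc n} (ℕ.≤′-step le) = ≤-trans (hi-step n) (hi-antitone le)

    0≤ratio : ∀ n → 0ℚ ≤ ratio n
    0≤ratio n = nonNegative⁻¹ (ratio n) {{normalize-nonNeg (a n) (q ℕ.^ n) {{q^n≢0 n}}}}

    hi≡lo+ratio : ∀ n → hi n ≡ lo n + ratio n
    hi≡lo+ratio n = trans (cong (_* ratio n) (sym (ι-+ 1 n)))
      (trans (*-distribʳ-+ (ratio n) 1ℚ (ι n)) (trans (cong (_+ lo n) (*-identityˡ (ratio n))) (+-comm (ratio n) (lo n))))

    lo≤hi : ∀ m n → lo m ≤ hi n
    lo≤hi m n = ≤-trans (lo-mono {m} {k} (ℕ.≤⇒≤′ (ℕ.m≤m⊔n m n))) (≤-trans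
      (subst (lo k ≤_) (sym (hi≡lo+ratio k)) (p≤p+q {lo k} (0≤ratio k)))
      (hi-antitone {n} {k} (ℕ.≤⇒≤′ (ℕ.m≤n⊔m m n))))
      where
      k : ℕ
      k = m ℕ.⊔ n

    hi≤1 : ∀ n → hi n ≤ 1ℚ
    hi≤1 n = ≤-trans (hi-antitone {0} {n} (ℕ.≤⇒≤′ z≤n)) (≤-reflexive (trans (*-identityˡ (ratio 0))
      (trans (sym (*-identityʳ (ratio 0))) (trans (ratio-ι 0) (cong ι a₀)))))

    lo≤1 : ∀ n → lo n ≤ 1ℚ
    lo≤1 n = ≤-trans (lo≤hi n 0) (hi≤1 0)

    0≤lo : ∀ n → 0ℚ ≤ lo n
    0≤lo n = 0≤* (0≤ι n) (0≤ratio n)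

    -- Because `hi n` is at most `hi 0`, which is 1. As `ratio n` is the gap between `lo n` and
    -- `hi n`, this is the rate of convergence.
    ratio≤ : ∀ n → ratio n ≤ + 1 / suc n
    ratio≤ n = *-cancelˡ-≤-pos (ι (suc n)) {{ι-positive (suc n)}} (≤-trans (hi≤1 n)
      (≤-reflexive (sym (trans (*-comm (ι (suc n)) (+ 1 / suc n)) (frac-ι 1 (suc n))))))

    lo-cauchy : IsCauchy lo
    lo-cauchy = one-sided lo λ ε 0<ε → let (N , h) = archimedean 1 ε 0<ε in N , λ m n _ N≤n →
      ≤-trans (lo≤hi m n) (≤-trans (≤-reflexive (hi≡lo+ratio n)) (+-monoʳ-≤ (lo n) (≤-trans (ratio≤ n) (h n N≤n))))

    limit : ℝ
    limit = mkℝ lo lo-cauchy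

  -- The central binomial coefficient is squared because only its square, divided by 16ⁿ, decays
  -- like 1 / n; one enclosure then serves both families.
  module Binomial = Enclosure 16 (λ n → centralBinomial n ℕ.* centralBinomial n) refl binomial-growth binomial-decay
  module Trinomial = Enclosure 27 trinomial refl trinomial-growth trinomial-decay

  -- Equality of limits.

  infix 4 _≃ℝ_

  _≃ℝ_ : ℝ → ℝ → Set
  x ≃ℝ y = ∀ ε → 0ℚ < ε → ∃[ N ] (∀ n → N ℕ.≤ n → ∣ seq x n - seq y n ∣ ≤ ε)

  pointwise : ∀ {x y} → (∀ n → seq x n ≡ seq y n) → x ≃ℝ y
  pointwise {x} {y} h ε 0<ε = 0 , λ n _ → ≤-trans (≤-reflexive (cong ∣_∣
    (trans (cong (_- seq y n) (h n)) (+-inverseʳ (seq y n))))) (<⇒≤ 0<ε)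

  ≃ℝ-refl : ∀ {x} → x ≃ℝ x
  ≃ℝ-refl {x} = pointwise {x} {x} λ _ → refl

  ≃ℝ-sym : ∀ {x y} → x ≃ℝ y → y ≃ℝ x
  ≃ℝ-sym {x} {y} h ε 0<ε = let (N , k) = h ε 0<ε in N , λ n le →
    subst (_≤ ε) (∣-∣-sym (seq x n) (seq y n)) (k n le)

  ≃ℝ-trans : ∀ {x y z} → x ≃ℝ y → y ≃ℝ z → x ≃ℝ z
  ≃ℝ-trans {x} {y} {z} h k ε 0<ε with h (½ * ε) (0<½* 0<ε) | k (½ * ε) (0<½* 0<ε)
  ... | M , h′ | N , k′ = M ℕ.⊔ N , λ n le → ≤-trans (∣-∣-tri (seq x n) (seq y n) (seq z n))
    (subst (∣ seq x n - seq y n ∣ + ∣ seq y n - seq z n ∣ ≤_) (½+½ ε)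
      (+-mono-≤ (h′ n (ℕ.m⊔n≤o⇒m≤o M N le)) (k′ n (ℕ.m⊔n≤o⇒n≤o M N le))))

  ≃ℝ-scaled : ∀ {x y} K → 0ℚ ≤ K →
    (∀ δ → 0ℚ < δ → ∃[ N ] (∀ n → N ℕ.≤ n → ∣ seq x n - seq y n ∣ ≤ K * δ)) → x ≃ℝ y
  ≃ℝ-scaled K 0≤K h ε 0<ε =
    let (δ , 0<δ , Kδ≤ε) = shrink K 0≤K ε 0<ε
        (N , k)          = h δ 0<δ
    in N , λ n le → ≤-trans (k n le) Kδ≤ε

  *ℝ-cong : ∀ {x x′ y y′} → x ≃ℝ x′ → y ≃ℝ y′ → x *ℝ y ≃ℝ x′ *ℝ y′
  *ℝ-cong {x} {x′} {y} {y′} hx hy =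
    let (B , 0≤B , M , hB)  = bound (seq x) (cauchy x)
        (C , 0≤C , M′ , hC) = bound (seq y′) (cauchy y′)
    in ≃ℝ-scaled {x *ℝ y} {x′ *ℝ y′} (B + C) (0≤+ 0≤B 0≤C) λ δ 0<δ →
    let (N , h)   = hx δ 0<δ
        (N′ , h′) = hy δ 0<δ
    in (M ℕ.⊔ M′) ℕ.⊔ (N ℕ.⊔ N′) , λ n le →
       let leM = ℕ.m⊔n≤o⇒m≤o (M ℕ.⊔ M′) (N ℕ.⊔ N′) le
           leN = ℕ.m⊔n≤o⇒n≤o (M ℕ.⊔ M′) (N ℕ.⊔ N′) le
       in product-bound (seq x n) (seq y n) (seq x′ n) (seq y′ n) B C δ
            (hB n (ℕ.m⊔n≤o⇒m≤o M M′ leM)) (hC n (ℕ.m⊔n≤o⇒n≤o M M′ leM))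
            (h n (ℕ.m⊔n≤o⇒m≤o N N′ leN)) (h′ n (ℕ.m⊔n≤o⇒n≤o N N′ leN))

  *ℝ-cancelˡ : ∀ x {y z} → AwayFrom0 (seq x) → x *ℝ y ≃ℝ x *ℝ z → y ≃ℝ z
  *ℝ-cancelˡ x {y} {z} (b , 0<b , M , hb) h ε 0<ε =
    let (N , k) = h (b * ε) (positive⁻¹ (b * ε) {{pos*pos⇒pos b {{positive 0<b}} ε {{positive 0<ε}}}})
    in M ℕ.⊔ N , λ n le → *-cancelˡ-≤-pos b {{positive 0<b}} (begin
         b * ∣ seq y n - seq z n ∣
           ≤⟨ *-monoʳ-≤-nonNeg ∣ seq y n - seq z n ∣ {{nonNegative (0≤∣p∣ (seq y n - seq z n))}} (hb n (ℕ.m⊔n≤o⇒m≤o M N le)) ⟩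
         ∣ seq x n ∣ * ∣ seq y n - seq z n ∣
           ≡⟨ ∣p*q∣≡∣p∣*∣q∣ (seq x n) (seq y n - seq z n) ⟨
         ∣ seq x n * (seq y n - seq z n) ∣
           ≡⟨ cong ∣_∣ (distrib (seq x n) (seq y n) (seq z n)) ⟩
         ∣ seq x n * seq y n - seq x n * seq z n ∣
           ≤⟨ k n (ℕ.m⊔n≤o⇒n≤o M N le) ⟩
         b * ε ∎)
    where
    open ≤-Reasoning
    distrib : ∀ x y z → x * (y - z) ≡ x * y - x * z
    distrib = solve 3 (λ x y z → x :* (y :- z) := x :* y :- x :* z) refl

  -- Subsequences and the Wallis product.

  subsequence : (x : ℝ) (φ : ℕ → ℕ) → (∀ n → n ℕ.≤ φ n) → ℝ
  subsequence x φ le = mkℝ (λ n → seq x (φ n)) λ ε 0<ε → let (N , h) = cauchy x ε 0<ε in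
    N , λ m n a b → h (φ m) (φ n) (ℕ.≤-trans a (le m)) (ℕ.≤-trans b (le n))

  subsequence-≃ℝ : ∀ x φ le → subsequence x φ le ≃ℝ x
  subsequence-≃ℝ x φ le ε 0<ε = let (N , h) = cauchy x ε 0<ε in
    N , λ n a → h (φ n) n (ℕ.≤-trans a (le n)) a

  -- The radius `σ M` of `Wallis` for M = n, in grid cells.
  κ : ℕ → ℕ
  κ n = 2 ℕ.* n ℕ.* centralBinomial n

  -- Term k of `π` belongs to the radius k + 1, so that the disc of radius `κ n` sits at index
  -- `pred (κ n)`; the bound makes these indices a subsequence.
  n≤predκ : ∀ n → n ℕ.≤ ℕ.pred (κ n)
  n≤predκ zero    = z≤n
  n≤predκ (suc m) = ℕ.pred-mono-≤ (begin
    suc (suc m)                                  ≤⟨ ℕ.m≤m+n (suc (suc m)) m ⟩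
    suc (suc m) ℕ.+ m                            ≡⟨ twice m ⟩
    2 ℕ.* suc m                                  ≡⟨ ℕ.*-identityʳ (2 ℕ.* suc m) ⟨
    2 ℕ.* suc m ℕ.* 1                            ≤⟨ ℕ.*-monoʳ-≤ (2 ℕ.* suc m) (centralBinomial>0 (suc m)) ⟩
    κ (suc m)                                    ∎)
    where
    open ℕ.≤-Reasoning
    twice : ∀ m → suc (suc m) ℕ.+ m ≡ 2 ℕ.* suc m
    twice = solve-∀

  area-ι : ∀ r .{{_ : ℕ.NonZero r}} → seq π (ℕ.pred r) * ι (r ℕ.* r) ≡ ι (4 ℕ.* quarterDisc r)
  area-ι (suc k) = frac-ι (4 ℕ.* quarterDisc (suc k)) (suc k ℕ.* suc k)

  β δ : ℝ
  β = Binomial.limit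
  δ = Trinomial.limit

  module _ (m : ℕ) where

    private
      n u Q k X : ℕ
      n = suc m
      u = centralBinomial n
      Q = quarterDisc (κ n)
      X = 16 ℕ.^ n
      k = X ℕ.* (κ n ℕ.* κ n) ℕ.* n
      instance
        κ≢0 : ℕ.NonZero (κ n)
        κ≢0 = ℕ.m*n≢0 (2 ℕ.* n) u {{_}} {{ℕ.>-nonZero (centralBinomial>0 n)}}
        X≢0 : ℕ.NonZero X
        X≢0 = ℕ.m^n≢0 16 n
        k≢0 : ℕ.NonZero k
        k≢0 = ℕ.m*n≢0 (X ℕ.* (κ n ℕ.* κ n)) n {{ℕ.m*n≢0 X (κ n ℕ.* κ n) {{X≢0}} {{ℕ.m*n≢0 (κ n) (κ n)}}}}
      R : ℚ
      R = seq β n * seq π (ℕ.pred (κ n))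

      R-ι : R * ι k ≡ ι (κ n ℕ.* κ n ℕ.* Q)
      R-ι = begin
        b * a * ι (X ℕ.* (κ n ℕ.* κ n) ℕ.* n)
          ≡⟨ cong (b * a *_) (trans (cong (_* ι n) (ι-* X (κ n ℕ.* κ n))) (ι-* (X ℕ.* (κ n ℕ.* κ n)) n)) ⟨
        b * a * (ι X * ι (κ n ℕ.* κ n) * ι n)
          ≡⟨ shuffle b a (ι X) (ι (κ n ℕ.* κ n)) (ι n) ⟩
        (b * ι X) * (a * ι (κ n ℕ.* κ n)) * ι n
          ≡⟨ cong₂ (λ x y → x * y * ι n) (Binomial.multiple n n) (area-ι (κ n)) ⟩
        ι (n ℕ.* (u ℕ.* u)) * ι (4 ℕ.* Q) * ι n
          ≡⟨ trans (cong (_* ι n) (ι-* (n ℕ.* (u ℕ.* u)) (4 ℕ.* Q))) (ι-* (n ℕ.* (u ℕ.* u) ℕ.* (4 ℕ.* Q)) n) ⟩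
        ι (n ℕ.* (u ℕ.* u) ℕ.* (4 ℕ.* Q) ℕ.* n)
          ≡⟨ cong ι (square n u Q) ⟩
        ι (κ n ℕ.* κ n ℕ.* Q) ∎
        where
        open ≡-Reasoning
        a b : ℚ
        a = seq π (ℕ.pred (κ n))
        b = seq β n
        shuffle : ∀ b a x y z → b * a * (x * y * z) ≡ (b * x) * (a * y) * z
        shuffle = solve 5 (λ b a x y z → b :* a :* (x :* y :* z) := (b :* x) :* (a :* y) :* z) refl
        square : ∀ n u q → n ℕ.* (u ℕ.* u) ℕ.* (4 ℕ.* q) ℕ.* n ≡ (2 ℕ.* n ℕ.* u) ℕ.* (2 ℕ.* n ℕ.* u) ℕ.* q
        square = solve-∀

      1/n-ι : (+ 1 / n) * ι k ≡ ι (κ n ℕ.* κ n ℕ.* X)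
      1/n-ι = begin
        (+ 1 / n) * ι (X ℕ.* (κ n ℕ.* κ n) ℕ.* n)
          ≡⟨ cong ((+ 1 / n) *_) (ι-* (X ℕ.* (κ n ℕ.* κ n)) n) ⟨
        (+ 1 / n) * (ι (X ℕ.* (κ n ℕ.* κ n)) * ι n)
          ≡⟨ shuffle (+ 1 / n) (ι (X ℕ.* (κ n ℕ.* κ n))) (ι n) ⟩
        ((+ 1 / n) * ι n) * ι (X ℕ.* (κ n ℕ.* κ n))
          ≡⟨ cong (_* ι (X ℕ.* (κ n ℕ.* κ n))) (frac-ι 1 n) ⟩
        1ℚ * ι (X ℕ.* (κ n ℕ.* κ n))
          ≡⟨ *-identityˡ _ ⟩
        ι (X ℕ.* (κ n ℕ.* κ n))
          ≡⟨ cong ι (ℕ.*-comm X (κ n ℕ.* κ n)) ⟩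
        ι (κ n ℕ.* κ n ℕ.* X) ∎
        where
        open ≡-Reasoning
        shuffle : ∀ x y z → x * (y * z) ≡ (x * z) * y
        shuffle = solve 3 (λ x y z → x :* (y :* z) := (x :* z) :* y) refl

      +1/n : ∀ p a → p * ι k ≡ ι a → (p + + 1 / n) * ι k ≡ ι (a ℕ.+ κ n ℕ.* κ n ℕ.* X)
      +1/n p a e = trans (*-distribʳ-+ (ι k) p (+ 1 / n)) (trans (cong₂ _+_ e 1/n-ι) (ι-+ a (κ n ℕ.* κ n ℕ.* X)))

      1-ι : 1ℚ * ι k ≡ ι k
      1-ι = *-identityˡ (ι k)

    -- The product of n u² / 16ⁿ and 4Q / (2nu)² is Q / (n 16ⁿ), and Q lies between (n - 1) 16ⁿ and
    -- (n + 1) 16ⁿ by the two staircases. The number `k` is a common denominator of `R` and 1 / n.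
    wallis-bound : ∣ R - 1ℚ ∣ ≤ + 1 / n
    wallis-bound = ∣-∣-≤ {R} {1ℚ} {+ 1 / n}
      (≤-via-ι k (κ n ℕ.* κ n ℕ.* Q) (k ℕ.+ κ n ℕ.* κ n ℕ.* X) R-ι (+1/n 1ℚ k 1-ι) (begin
        κ n ℕ.* κ n ℕ.* Q                              ≤⟨ ℕ.*-monoʳ-≤ (κ n ℕ.* κ n) (Wallis.quarterDisc-upper n) ⟩
        κ n ℕ.* κ n ℕ.* (suc n ℕ.* X)                  ≡⟨ split (κ n ℕ.* κ n) n X ⟩
        k ℕ.+ κ n ℕ.* κ n ℕ.* X                        ∎))
      (≤-via-ι k k (κ n ℕ.* κ n ℕ.* Q ℕ.+ κ n ℕ.* κ n ℕ.* X) 1-ι (+1/n R (κ n ℕ.* κ n ℕ.* Q) R-ι) (begin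
        X ℕ.* (κ n ℕ.* κ n) ℕ.* n                      ≡⟨ merge (κ n ℕ.* κ n) m X ⟩
        κ n ℕ.* κ n ℕ.* (m ℕ.* X) ℕ.+ κ n ℕ.* κ n ℕ.* X ≤⟨ ℕ.+-monoˡ-≤ _ (ℕ.*-monoʳ-≤ (κ n ℕ.* κ n) (Wallis.quarterDisc-lower n)) ⟩
        κ n ℕ.* κ n ℕ.* Q ℕ.+ κ n ℕ.* κ n ℕ.* X        ∎))
      where
      open ℕ.≤-Reasoning
      split : ∀ s n x → s ℕ.* (suc n ℕ.* x) ≡ x ℕ.* s ℕ.* n ℕ.+ s ℕ.* x
      split = solve-∀
      merge : ∀ s m x → x ℕ.* s ℕ.* suc m ≡ s ℕ.* (m ℕ.* x) ℕ.+ s ℕ.* x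
      merge = solve-∀

  wallis : β *ℝ π ≃ℝ 1ℝ
  wallis = ≃ℝ-trans {β *ℝ π} {β *ℝ π′} {1ℝ}
    (*ℝ-cong {β} {β} {π} {π′} (≃ℝ-refl {β}) (≃ℝ-sym {π′} {π} (subsequence-≃ℝ π (λ n → ℕ.pred (κ n)) n≤predκ)))
    (λ ε 0<ε → let (N , h) = archimedean 1 ε 0<ε in suc N , λ { (suc m) (s≤s le) → ≤-trans (wallis-bound m) (h m le) })
    where
    π′ : ℝ
    π′ = subsequence π (λ n → ℕ.pred (κ n)) n≤predκ

  -- The duplication identity and the trinomial constant.

  ratio-duplication : ∀ n → let t = Trinomial.ratio n; b = Binomial.ratio n in
    Binomial.ratio (n ℕ.+ n ℕ.+ n) * (t * t * (t * t)) ≡ Trinomial.ratio (n ℕ.+ n) * Trinomial.ratio (n ℕ.+ n) * (b * b * b)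
  ratio-duplication n = *-cancelʳ (ι K) {{ι-positive K {{K≢0}}}} (begin
    b₃ * (t * t * (t * t)) * ι K
      ≡⟨ cong (b₃ * (t * t * (t * t)) *_) ιK ⟩
    b₃ * (t * t * (t * t)) * (ι X * ι X * ι X * (ι Y * ι Y * (ι Y * ι Y)))
      ≡⟨ left b₃ t (ι X) (ι Y) ⟩
    b₃ * (ι X * ι X * ι X) * (t * ι Y * (t * ι Y) * (t * ι Y * (t * ι Y)))
      ≡⟨ cong₂ (λ x y → x * (y * y * (y * y))) (trans (cong (b₃ *_) (sym ιX³)) (Binomial.ratio-ι (n ℕ.+ n ℕ.+ n))) (Trinomial.ratio-ι n) ⟩
    ι (u₃ ℕ.* u₃) * (ι v * ι v * (ι v * ι v))
      ≡⟨ cong (ι (u₃ ℕ.* u₃) *_) (trans (cong (λ x → x * x) (ι-* v v)) (ι-* (v ℕ.* v) (v ℕ.* v))) ⟩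
    ι (u₃ ℕ.* u₃) * ι (v ℕ.* v ℕ.* (v ℕ.* v))
      ≡⟨ ι-* (u₃ ℕ.* u₃) (v ℕ.* v ℕ.* (v ℕ.* v)) ⟩
    ι (u₃ ℕ.* u₃ ℕ.* (v ℕ.* v ℕ.* (v ℕ.* v)))
      -- `duplication` enters squared, because `Binomial.ratio` is made of squared coefficients.
      -- Both sides carry the same denominator, 16³ⁿ · 27⁴ⁿ.
      ≡⟨ cong ι (trans (squareˡ u₃ v) (trans (cong (λ x → x ℕ.* x) (duplication n)) (squareʳ v₂ u))) ⟩
    ι (v₂ ℕ.* v₂ ℕ.* (u ℕ.* u ℕ.* (u ℕ.* u) ℕ.* (u ℕ.* u)))
      ≡⟨ ι-* (v₂ ℕ.* v₂) (u ℕ.* u ℕ.* (u ℕ.* u) ℕ.* (u ℕ.* u)) ⟨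
    ι (v₂ ℕ.* v₂) * ι (u ℕ.* u ℕ.* (u ℕ.* u) ℕ.* (u ℕ.* u))
      ≡⟨ cong₂ _*_ (ι-* v₂ v₂) (trans (cong (_* ι (u ℕ.* u)) (ι-* (u ℕ.* u) (u ℕ.* u))) (ι-* (u ℕ.* u ℕ.* (u ℕ.* u)) (u ℕ.* u))) ⟨
    ι v₂ * ι v₂ * (ι (u ℕ.* u) * ι (u ℕ.* u) * ι (u ℕ.* u))
      ≡⟨ cong₂ (λ x y → x * x * (y * y * y)) (trans (cong (t₂ *_) (sym ιY²)) (Trinomial.ratio-ι (n ℕ.+ n))) (Binomial.ratio-ι n) ⟨
    t₂ * (ι Y * ι Y) * (t₂ * (ι Y * ι Y)) * (b * ι X * (b * ι X) * (b * ι X))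
      ≡⟨ right t₂ b (ι X) (ι Y) ⟩
    t₂ * t₂ * (b * b * b) * (ι X * ι X * ι X * (ι Y * ι Y * (ι Y * ι Y)))
      ≡⟨ cong (t₂ * t₂ * (b * b * b) *_) ιK ⟨
    t₂ * t₂ * (b * b * b) * ι K ∎)
    where
    open ≡-Reasoning
    X Y K u v u₃ v₂ : ℕ
    X = 16 ℕ.^ n
    Y = 27 ℕ.^ n
    K = X ℕ.* X ℕ.* X ℕ.* (Y ℕ.* Y ℕ.* (Y ℕ.* Y))
    u = centralBinomial n
    v = trinomial n
    u₃ = centralBinomial (n ℕ.+ n ℕ.+ n)
    v₂ = trinomial (n ℕ.+ n)
    b t b₃ t₂ : ℚ
    b = Binomial.ratio n
    t = Trinomial.ratio n
    b₃ = Binomial.ratio (n ℕ.+ n ℕ.+ n)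
    t₂ = Trinomial.ratio (n ℕ.+ n)
    K≢0 : ℕ.NonZero K
    K≢0 = ℕ.m*n≢0 _ _ {{ℕ.m*n≢0 _ _ {{ℕ.m*n≢0 X X {{x}} {{x}}}} {{x}}}} {{ℕ.m*n≢0 _ _ {{yy}} {{yy}}}}
      where
      x : ℕ.NonZero X
      x = ℕ.m^n≢0 16 n
      yy : ℕ.NonZero (Y ℕ.* Y)
      yy = ℕ.m*n≢0 Y Y {{ℕ.m^n≢0 27 n}} {{ℕ.m^n≢0 27 n}}
    cube : ∀ x → ι x * ι x * ι x ≡ ι (x ℕ.* x ℕ.* x)
    cube x = trans (cong (_* ι x) (ι-* x x)) (ι-* (x ℕ.* x) x)
    ιX³ : ι (16 ℕ.^ (n ℕ.+ n ℕ.+ n)) ≡ ι X * ι X * ι X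
    ιX³ = trans (cong ι (trans (ℕ.^-distribˡ-+-* 16 (n ℕ.+ n) n) (cong (ℕ._* X) (ℕ.^-distribˡ-+-* 16 n n)))) (sym (cube X))
    ιY² : ι (27 ℕ.^ (n ℕ.+ n)) ≡ ι Y * ι Y
    ιY² = trans (cong ι (ℕ.^-distribˡ-+-* 27 n n)) (sym (ι-* Y Y))
    ιK : ι K ≡ ι X * ι X * ι X * (ι Y * ι Y * (ι Y * ι Y))
    ιK = trans (sym (ι-* (X ℕ.* X ℕ.* X) (Y ℕ.* Y ℕ.* (Y ℕ.* Y)))) (cong₂ _*_ (sym (cube X))
      (trans (sym (ι-* (Y ℕ.* Y) (Y ℕ.* Y))) (cong (λ x → x * x) (sym (ι-* Y Y)))))
    left : ∀ b t x y → b * (t * t * (t * t)) * (x * x * x * (y * y * (y * y))) ≡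
                       b * (x * x * x) * (t * y * (t * y) * (t * y * (t * y)))
    left = solve 4 (λ b t x y → b :* (t :* t :* (t :* t)) :* (x :* x :* x :* (y :* y :* (y :* y))) :=
                       b :* (x :* x :* x) :* (t :* y :* (t :* y) :* (t :* y :* (t :* y)))) refl
    right : ∀ t b x y → t * (y * y) * (t * (y * y)) * (b * x * (b * x) * (b * x)) ≡
                        t * t * (b * b * b) * (x * x * x * (y * y * (y * y)))
    right = solve 4 (λ t b x y → t :* (y :* y) :* (t :* (y :* y)) :* (b :* x :* (b :* x) :* (b :* x)) :=
                        t :* t :* (b :* b :* b) :* (x :* x :* x :* (y :* y :* (y :* y)))) refl
    squareˡ : ∀ w v → w ℕ.* w ℕ.* (v ℕ.* v ℕ.* (v ℕ.* v)) ≡ (w ℕ.* (v ℕ.* v)) ℕ.* (w ℕ.* (v ℕ.* v))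
    squareˡ = solve-∀
    squareʳ : ∀ w u → (w ℕ.* (u ℕ.* u ℕ.* u)) ℕ.* (w ℕ.* (u ℕ.* u ℕ.* u)) ≡ w ℕ.* w ℕ.* (u ℕ.* u ℕ.* (u ℕ.* u) ℕ.* (u ℕ.* u))
    squareʳ = solve-∀

  n≤n+n : ∀ n → n ℕ.≤ n ℕ.+ n
  n≤n+n n = ℕ.m≤m+n n n

  n≤n+n+n : ∀ n → n ℕ.≤ n ℕ.+ n ℕ.+ n
  n≤n+n+n n = ℕ.m≤n+m n (n ℕ.+ n)

  β₃ δ₂ : ℝ
  β₃ = subsequence β (λ n → n ℕ.+ n ℕ.+ n) n≤n+n+n
  δ₂ = subsequence δ (λ n → n ℕ.+ n) n≤n+n

  -- This is `ratio-duplication` times 12 n⁵ π³: the 12 is 4 · 3 on the left, with β taken at 3n,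
  -- and 3 · 2² on the right, with δ taken twice at 2n. Each β is paired with a π, since these
  -- products tend to 1; the two factors π left over go with δ² on the left.
  limit-duplication : ∀ n → ι 4 * (seq β₃ n * seq π n) * (seq δ n * seq δ n * (seq δ n * seq π n * (seq δ n * seq π n))) ≡
    ι 3 * (seq δ₂ n * seq δ₂ n) * (seq β n * seq π n * (seq β n * seq π n) * (seq β n * seq π n))
  limit-duplication n = begin
    ι 4 * (ι (n ℕ.+ n ℕ.+ n) * b₃ * p) * (N * t * (N * t) * (N * t * p * (N * t * p)))
      ≡⟨ cong (λ k → ι 4 * (k * b₃ * p) * (N * t * (N * t) * (N * t * p * (N * t * p)))) (trans (sym (ι-+ (n ℕ.+ n) n)) (cong (_+ N) (sym (ι-+ n n)))) ⟩
    ι 4 * ((N + N + N) * b₃ * p) * (N * t * (N * t) * (N * t * p * (N * t * p)))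
      ≡⟨ left N b₃ t p ⟩
    ι 12 * (N * N * N * N * N * (p * p * p)) * (b₃ * (t * t * (t * t)))
      ≡⟨ cong (ι 12 * (N * N * N * N * N * (p * p * p)) *_) (ratio-duplication n) ⟩
    ι 12 * (N * N * N * N * N * (p * p * p)) * (t₂ * t₂ * (b * b * b))
      ≡⟨ right N t₂ b p ⟩
    ι 3 * ((N + N) * t₂ * ((N + N) * t₂)) * (N * b * p * (N * b * p) * (N * b * p))
      ≡⟨ cong (λ k → ι 3 * (k * t₂ * (k * t₂)) * (N * b * p * (N * b * p) * (N * b * p))) (ι-+ n n) ⟩
    ι 3 * (ι (n ℕ.+ n) * t₂ * (ι (n ℕ.+ n) * t₂)) * (N * b * p * (N * b * p) * (N * b * p)) ∎
    where
    open ≡-Reasoning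
    N b t b₃ t₂ p : ℚ
    N = ι n
    b = Binomial.ratio n
    t = Trinomial.ratio n
    b₃ = Binomial.ratio (n ℕ.+ n ℕ.+ n)
    t₂ = Trinomial.ratio (n ℕ.+ n)
    p = seq π n
    left : ∀ N b t p → ι 4 * ((N + N + N) * b * p) * (N * t * (N * t) * (N * t * p * (N * t * p))) ≡
                       ι 12 * (N * N * N * N * N * (p * p * p)) * (b * (t * t * (t * t)))
    left = solve 4 (λ N b t p → con (ι 4) :* ((N :+ N :+ N) :* b :* p) :* (N :* t :* (N :* t) :* (N :* t :* p :* (N :* t :* p))) :=
                       con (ι 12) :* (N :* N :* N :* N :* N :* (p :* p :* p)) :* (b :* (t :* t :* (t :* t)))) refl
    right : ∀ N t b p → ι 12 * (N * N * N * N * N * (p * p * p)) * (t * t * (b * b * b)) ≡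
                        ι 3 * ((N + N) * t * ((N + N) * t)) * (N * b * p * (N * b * p) * (N * b * p))
    right = solve 4 (λ N t b p → con (ι 12) :* (N :* N :* N :* N :* N :* (p :* p :* p)) :* (t :* t :* (b :* b :* b)) :=
                        con (ι 3) :* ((N :+ N) :* t :* ((N :+ N) :* t)) :* (N :* b :* p :* (N :* b :* p) :* (N :* b :* p))) refl

  -- The sequence `Trinomial.lo` increases and is positive at index 1; the bound starts there
  -- because the term at 0 vanishes.
  δ-away : AwayFrom0 (seq (δ *ℝ δ))
  δ-away = l * l , positive⁻¹ (l * l) , 1 , λ n 1≤n →
    ≤-trans (*-mono (Trinomial.0≤lo 1) (Trinomial.0≤lo n) (Trinomial.lo-mono {1} {n} (ℕ.≤⇒≤′ 1≤n)) (Trinomial.lo-mono {1} {n} (ℕ.≤⇒≤′ 1≤n)))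
      (p≤∣p∣ (Trinomial.lo n * Trinomial.lo n))
    where
    l : ℚ
    l = Trinomial.lo 1

  -- In `limit-duplication` every product of β and π may be replaced by 1 and `δ₂` by `δ`; the
  -- remaining equation has δ² on both sides, which `δ-away` allows to cancel.
  4δ²π²≃3 : fromℕ 4 *ℝ ((δ *ℝ π) *ℝ (δ *ℝ π)) ≃ℝ fromℕ 3
  4δ²π²≃3 = *ℝ-cancelˡ δ² {z} {fromℕ 3} δ-away
    (≃ℝ-trans {δ² *ℝ z} {fromℕ 4 *ℝ 1ℝ *ℝ (δ² *ℝ ζ)} {δ² *ℝ fromℕ 3} (pointwise {δ² *ℝ z} {fromℕ 4 *ℝ 1ℝ *ℝ (δ² *ℝ ζ)} rearrangeˡ)
    (≃ℝ-trans {fromℕ 4 *ℝ 1ℝ *ℝ (δ² *ℝ ζ)} {fromℕ 4 *ℝ (β₃ *ℝ π) *ℝ (δ² *ℝ ζ)} {δ² *ℝ fromℕ 3}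
      (≃ℝ-sym {fromℕ 4 *ℝ (β₃ *ℝ π) *ℝ (δ² *ℝ ζ)} {fromℕ 4 *ℝ 1ℝ *ℝ (δ² *ℝ ζ)}
        (*ℝ-cong {fromℕ 4 *ℝ (β₃ *ℝ π)} {fromℕ 4 *ℝ 1ℝ} {δ² *ℝ ζ} {δ² *ℝ ζ}
          (*ℝ-cong {fromℕ 4} {fromℕ 4} {β₃ *ℝ π} {1ℝ} (≃ℝ-refl {fromℕ 4}) wallis₃) (≃ℝ-refl {δ² *ℝ ζ})))
    (≃ℝ-trans {fromℕ 4 *ℝ (β₃ *ℝ π) *ℝ (δ² *ℝ ζ)} {fromℕ 3 *ℝ (δ₂ *ℝ δ₂) *ℝ (ω *ℝ ω *ℝ ω)} {δ² *ℝ fromℕ 3}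
      (pointwise {fromℕ 4 *ℝ (β₃ *ℝ π) *ℝ (δ² *ℝ ζ)} {fromℕ 3 *ℝ (δ₂ *ℝ δ₂) *ℝ (ω *ℝ ω *ℝ ω)} limit-duplication)
    (≃ℝ-trans {fromℕ 3 *ℝ (δ₂ *ℝ δ₂) *ℝ (ω *ℝ ω *ℝ ω)} {fromℕ 3 *ℝ δ² *ℝ (1ℝ *ℝ 1ℝ *ℝ 1ℝ)} {δ² *ℝ fromℕ 3}
      (*ℝ-cong {fromℕ 3 *ℝ (δ₂ *ℝ δ₂)} {fromℕ 3 *ℝ δ²} {ω *ℝ ω *ℝ ω} {1ℝ *ℝ 1ℝ *ℝ 1ℝ}
        (*ℝ-cong {fromℕ 3} {fromℕ 3} {δ₂ *ℝ δ₂} {δ²} (≃ℝ-refl {fromℕ 3}) (*ℝ-cong {δ₂} {δ} {δ₂} {δ} δ₂≃δ δ₂≃δ))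
        (*ℝ-cong {ω *ℝ ω} {1ℝ *ℝ 1ℝ} {ω} {1ℝ} (*ℝ-cong {ω} {1ℝ} {ω} {1ℝ} wallis wallis) wallis))
      (pointwise {fromℕ 3 *ℝ δ² *ℝ (1ℝ *ℝ 1ℝ *ℝ 1ℝ)} {δ² *ℝ fromℕ 3} rearrangeʳ)))))
    where
    δ² ζ ω z : ℝ
    δ² = δ *ℝ δ
    ζ = (δ *ℝ π) *ℝ (δ *ℝ π)
    ω = β *ℝ π
    z = fromℕ 4 *ℝ ζ
    δ₂≃δ : δ₂ ≃ℝ δ
    δ₂≃δ = subsequence-≃ℝ δ (λ n → n ℕ.+ n) n≤n+n
    wallis₃ : β₃ *ℝ π ≃ℝ 1ℝ
    wallis₃ = ≃ℝ-trans {β₃ *ℝ π} {ω} {1ℝ} (*ℝ-cong {β₃} {β} {π} {π}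
      (subsequence-≃ℝ β (λ n → n ℕ.+ n ℕ.+ n) n≤n+n+n) (≃ℝ-refl {π})) wallis
    rearrangeˡ : ∀ n → seq (δ² *ℝ z) n ≡ seq (fromℕ 4 *ℝ 1ℝ *ℝ (δ² *ℝ ζ)) n
    rearrangeˡ n = lemma (ι 4) (seq δ² n) (seq ζ n)
      where
      lemma : ∀ c d z → d * (c * z) ≡ c * 1ℚ * (d * z)
      lemma = solve 3 (λ c d z → d :* (c :* z) := c :* con 1ℚ :* (d :* z)) refl
    rearrangeʳ : ∀ n → seq (fromℕ 3 *ℝ δ² *ℝ (1ℝ *ℝ 1ℝ *ℝ 1ℝ)) n ≡ seq (δ² *ℝ fromℕ 3) n
    rearrangeʳ n = lemma (ι 3) (seq δ² n)
      where
      lemma : ∀ c d → c * d * (1ℚ * 1ℚ * 1ℚ) ≡ d * c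
      lemma = solve 2 (λ c d → c :* d :* (con 1ℚ :* con 1ℚ :* con 1ℚ) := d :* c) refl

  -- Rational approximations of square roots.

  √-lower : ∀ a N k → a ℕ.* a ℕ.≤ N → ι a ≤ seq (√ N) k
  √-lower a N k aa≤N = frac-≤ a 0 r k (begin
    -- Integers are multiples of 1 / K, so that rounding down does not fall below `a`: the bound
    -- holds at every index, not only in the limit.
    a ℕ.* K        ≤⟨ ℕ.s≤s⁻¹ (square-cancel-< (a ℕ.* K) (suc r) (ℕ.≤-<-trans below (proj₂ (isqrt-spec (N ℕ.* (K ℕ.* K)))))) ⟩
    r              ≡⟨ ℕ.*-identityʳ r ⟨
    r ℕ.* 1        ∎)
    where
    open ℕ.≤-Reasoning
    K r : ℕ
    K = suc k
    r = isqrt (N ℕ.* (K ℕ.* K))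
    swap : ∀ a k → (a ℕ.* k) ℕ.* (a ℕ.* k) ≡ (a ℕ.* a) ℕ.* (k ℕ.* k)
    swap = solve-∀
    below : (a ℕ.* K) ℕ.* (a ℕ.* K) ℕ.≤ N ℕ.* (K ℕ.* K)
    below = subst (ℕ._≤ N ℕ.* (K ℕ.* K)) (sym (swap a K)) (ℕ.*-monoˡ-≤ (K ℕ.* K) aa≤N)

  -- With r the integer root of N K², the defect N K² - r² is at most 2r, hence at most 2 N K;
  -- division by K² leaves 2 N / K.
  √-square-bound : ∀ N k → ∣ seq (√ N) k * seq (√ N) k - ι N ∣ ≤ + (2 ℕ.* N) / suc k
  √-square-bound N k = ∣-∣-≤ {s * s} {ι N} {e}
    (≤-trans (≤-via-ι (K ℕ.* K) (r ℕ.* r) (N ℕ.* (K ℕ.* K)) ss-ι (ι-* N (K ℕ.* K)) r²≤)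
      (p≤p+q {ι N} (frac-nonNeg (2 ℕ.* N) k)))
    (≤-via-ι (K ℕ.* K) (N ℕ.* (K ℕ.* K)) (r ℕ.* r ℕ.+ 2 ℕ.* N ℕ.* K) (ι-* N (K ℕ.* K)) sum-ι (begin
      N ℕ.* (K ℕ.* K)                     ≤⟨ ℕ.s≤s⁻¹ (proj₂ (isqrt-spec (N ℕ.* (K ℕ.* K)))) ⟩
      r ℕ.+ r ℕ.* suc r                   ≡⟨ expand r ⟩
      r ℕ.* r ℕ.+ 2 ℕ.* r                 ≤⟨ ℕ.+-monoʳ-≤ (r ℕ.* r) (ℕ.*-monoʳ-≤ 2 r≤NK) ⟩
      r ℕ.* r ℕ.+ 2 ℕ.* (N ℕ.* K)         ≡⟨ cong (r ℕ.* r ℕ.+_) (ℕ.*-assoc 2 N K) ⟨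
      r ℕ.* r ℕ.+ 2 ℕ.* N ℕ.* K           ∎))
    where
    open ℕ.≤-Reasoning
    K r : ℕ
    K = suc k
    r = isqrt (N ℕ.* (K ℕ.* K))
    s e : ℚ
    s = seq (√ N) k
    e = + (2 ℕ.* N) / suc k
    r²≤ : r ℕ.* r ℕ.≤ N ℕ.* (K ℕ.* K)
    r²≤ = proj₁ (isqrt-spec (N ℕ.* (K ℕ.* K)))
    expand : ∀ r → r ℕ.+ r ℕ.* suc r ≡ r ℕ.* r ℕ.+ 2 ℕ.* r
    expand = solve-∀
    n≤n² : ∀ n → n ℕ.≤ n ℕ.* n
    n≤n² zero    = z≤n
    n≤n² (suc n) = ℕ.m≤m*n (suc n) (suc n)
    swap : ∀ a k → (a ℕ.* a) ℕ.* (k ℕ.* k) ≡ (a ℕ.* k) ℕ.* (a ℕ.* k)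
    swap = solve-∀
    r≤NK : r ℕ.≤ N ℕ.* K
    r≤NK = ℕ.≮⇒≥ λ lt → ℕ.<⇒≱ (ℕ.*-mono-< lt lt)
      (ℕ.≤-trans r²≤ (ℕ.≤-trans (ℕ.*-monoˡ-≤ (K ℕ.* K) (n≤n² N)) (ℕ.≤-reflexive (swap N K))))
    shuffle : ∀ s x → s * s * (x * x) ≡ (s * x) * (s * x)
    shuffle = solve 2 (λ s x → s :* s :* (x :* x) := (s :* x) :* (s :* x)) refl
    ss-ι : s * s * ι (K ℕ.* K) ≡ ι (r ℕ.* r)
    ss-ι = trans (cong (s * s *_) (sym (ι-* K K))) (trans (shuffle s (ι K))
      (trans (cong (λ x → x * x) (frac-ι r K)) (ι-* r r)))
    e-ι : e * ι (K ℕ.* K) ≡ ι (2 ℕ.* N ℕ.* K)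
    e-ι = trans (cong (e *_) (sym (ι-* K K))) (trans (sym (*-assoc e (ι K) (ι K)))
      (trans (cong (_* ι K) (frac-ι (2 ℕ.* N) K)) (ι-* (2 ℕ.* N) K)))
    sum-ι : (s * s + e) * ι (K ℕ.* K) ≡ ι (r ℕ.* r ℕ.+ 2 ℕ.* N ℕ.* K)
    sum-ι = trans (*-distribʳ-+ (ι (K ℕ.* K)) (s * s) e) (trans (cong₂ _+_ ss-ι e-ι) (ι-+ (r ℕ.* r) (2 ℕ.* N ℕ.* K)))

  √-square : ∀ N → √ N *ℝ √ N ≃ℝ fromℕ N
  √-square N ε 0<ε = let (M , h) = archimedean (2 ℕ.* N) ε 0<ε in
    M , λ k le → ≤-trans (√-square-bound N k) (h k le)

  -- The quotient of `T n` by its leading term.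

  positive≢0 : ∀ {p} → 0ℚ < p → p ≢ 0ℚ
  positive≢0 0<p refl = <-irrefl refl 0<p

  0<* : ∀ {p q} → 0ℚ < p → 0ℚ < q → 0ℚ < p * q
  0<* {p} {q} a b = positive⁻¹ (p * q) {{pos*pos⇒pos p {{positive a}} q {{positive b}}}}

  -- A Cauchy sequence is eventually bounded by some B, so that its reciprocals stay away from 0;
  -- the lower bound `e` is chosen with B e ≤ 1.
  inverse-positive : ∀ x (x#0 : x #ℝ 0ℝ) → 0ℝ <ℝ x → 0ℝ <ℝ inverse x x#0
  inverse-positive x x#0 (δ , 0<δ , M , h) =
    let (B , 0≤B , N , hB) = bound (seq x) (cauchy x)
        (e , 0<e , Be≤1)   = shrink B 0≤B 1ℚ (positive⁻¹ 1ℚ)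
    in e , 0<e , M ℕ.⊔ N , λ n le →
       let p   = seq x n
           0<p = <-≤-trans 0<δ (subst (_≤ p) (+-identityˡ δ) (h n (ℕ.m⊔n≤o⇒m≤o M N le)))
       in subst (_≤ invℚ p) (sym (+-identityˡ e)) (*-cancelʳ-≤-pos p {{positive 0<p}} (≤-trans
            (*-monoˡ-≤-nonNeg e {{nonNegative (<⇒≤ 0<e)}} (≤-trans (p≤∣p∣ p) (hB n (ℕ.m⊔n≤o⇒n≤o M N le))))
            (≤-trans (≤-trans (≤-reflexive (*-comm e B)) Be≤1) (≤-reflexive (sym (invℚ-* (positive≢0 0<p)))))))

  -- With X the quotient on the left, X s = d p, so that (X - 1) s (d p + s) = (d p)² - s².
  quotient-error : ∀ N Q d s p → 0ℚ < N → 0ℚ < Q → 0ℚ ≤ d → 1ℚ ≤ s → 0ℚ < p →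
    ∣ N * (d * Q) * invℚ (N * s * invℚ p * Q) - 1ℚ ∣ ≤ ∣ d * p * (d * p) - s * s ∣
  quotient-error N Q d s p 0<N 0<Q 0≤d 1≤s 0<p = begin
    ∣ X - 1ℚ ∣
      ≡⟨ *-identityʳ ∣ X - 1ℚ ∣ ⟨
    ∣ X - 1ℚ ∣ * 1ℚ
      ≤⟨ *-monoˡ-≤-nonNeg ∣ X - 1ℚ ∣ {{nonNegative (0≤∣p∣ (X - 1ℚ))}} 1≤c ⟩
    ∣ X - 1ℚ ∣ * c
      ≡⟨ cong (∣ X - 1ℚ ∣ *_) (0≤p⇒∣p∣≡p 0≤c) ⟨
    ∣ X - 1ℚ ∣ * ∣ c ∣
      ≡⟨ ∣p*q∣≡∣p∣*∣q∣ (X - 1ℚ) c ⟨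
    ∣ (X - 1ℚ) * c ∣
      ≡⟨ cong ∣_∣ (trans (expand X s (d * p)) (trans (cong (λ y → (y - s) * (d * p + s)) Xs≡dp) (squares (d * p) s))) ⟩
    ∣ d * p * (d * p) - s * s ∣ ∎
    where
    open ≤-Reasoning
    i G X c : ℚ
    i = invℚ p
    G = N * s * i * Q
    X = N * (d * Q) * invℚ G
    c = s * (d * p + s)
    0<s : 0ℚ < s
    0<s = <-≤-trans (positive⁻¹ 1ℚ) 1≤s
    0≤dp : 0ℚ ≤ d * p
    0≤dp = 0≤* 0≤d (<⇒≤ 0<p)
    1≤dp+s : 1ℚ ≤ d * p + s
    1≤dp+s = ≤-trans 1≤s (≤-trans (p≤p+q {s} 0≤dp) (≤-reflexive (+-comm s (d * p))))
    1≤c : 1ℚ ≤ c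
    1≤c = *-mono {1ℚ} {s} {1ℚ} {d * p + s} (<⇒≤ (positive⁻¹ 1ℚ)) (0≤+ 0≤dp (<⇒≤ 0<s)) 1≤s 1≤dp+s
    0≤c : 0ℚ ≤ c
    0≤c = ≤-trans (<⇒≤ (positive⁻¹ 1ℚ)) 1≤c
    ip≡1 : i * p ≡ 1ℚ
    ip≡1 = invℚ-* (positive≢0 0<p)
    Gp≡ : G * p ≡ N * Q * s
    Gp≡ = trans (shuffle N s i Q p) (trans (cong (N * Q * s *_) ip≡1) (*-identityʳ (N * Q * s)))
      where
      shuffle : ∀ N s i Q p → N * s * i * Q * p ≡ N * Q * s * (i * p)
      shuffle = solve 5 (λ N s i Q p → N :* s :* i :* Q :* p := N :* Q :* s :* (i :* p)) refl
    G≢0 : G ≢ 0ℚ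
    G≢0 G≡0 = positive≢0 (0<* (0<* 0<N 0<Q) 0<s) (trans (sym Gp≡) (trans (cong (_* p) G≡0) (*-zeroˡ p)))
    Xs≡dp : X * s ≡ d * p
    Xs≡dp = *-cancelʳ (N * Q) {{positive (0<* 0<N 0<Q)}} (
      trans (collect X s N Q) (trans (cong (X *_) (sym Gp≡)) (trans (split N d Q (invℚ G) G p)
        (trans (cong (N * (d * Q) * p *_) (invℚ-* G≢0)) (finish N d Q p)))))
      where
      collect : ∀ X s N Q → X * s * (N * Q) ≡ X * (N * Q * s)
      collect = solve 4 (λ X s N Q → X :* s :* (N :* Q) := X :* (N :* Q :* s)) refl
      split : ∀ N d Q j G p → N * (d * Q) * j * (G * p) ≡ N * (d * Q) * p * (j * G)
      split = solve 6 (λ N d Q j G p → N :* (d :* Q) :* j :* (G :* p) := N :* (d :* Q) :* p :* (j :* G)) refl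
      finish : ∀ N d Q p → N * (d * Q) * p * 1ℚ ≡ d * p * (N * Q)
      finish = solve 4 (λ N d Q p → N :* (d :* Q) :* p :* con 1ℚ := d :* p :* (N :* Q)) refl
    expand : ∀ X s y → (X - 1ℚ) * (s * (y + s)) ≡ (X * s - s) * (y + s)
    expand = solve 3 (λ X s y → (X :- con 1ℚ) :* (s :* (y :+ s)) := (X :* s :- s) :* (y :+ s)) refl
    squares : ∀ y s → (y - s) * (y + s) ≡ y * y - s * s
    squares = solve 2 (λ y s → (y :- s) :* (y :+ s) := y :* y :- s :* s) refl

  -- In the quotient of `T n` by its leading term, δ occurs through its rational n-th term, but π as
  -- a real number, at an index k of its own. The equation for δ and π is therefore needed with n
  -- and k growing independently.
  two-indices : ∀ x y z → x *ℝ y ≃ℝ z → ∀ ε → 0ℚ < ε → ∃[ N ] (∀ n k → N ℕ.≤ n → N ℕ.≤ k →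
    ∣ seq x n * seq y k - seq z n ∣ ≤ ε)
  two-indices x y z h ε 0<ε = go (bound (seq x) (cauchy x)) (h (½ * ε) (0<½* 0<ε))
    where
    go : ∃[ B ] (0ℚ ≤ B × ∃[ N ] (∀ n → N ℕ.≤ n → ∣ seq x n ∣ ≤ B)) →
         ∃[ N ] (∀ n → N ℕ.≤ n → ∣ seq x n * seq y n - seq z n ∣ ≤ ½ * ε) →
         ∃[ N ] (∀ n k → N ℕ.≤ n → N ℕ.≤ k → ∣ seq x n * seq y k - seq z n ∣ ≤ ε)
    go (B , 0≤B , L , hB) (M , hM) with shrink B 0≤B (½ * ε) (0<½* 0<ε)
    ... | η , 0<η , Bη≤ with cauchy y η 0<η
    ...   | N , hN = L ℕ.⊔ (M ℕ.⊔ N) , λ n k len lek → begin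
      ∣ seq x n * seq y k - seq z n ∣
        ≤⟨ ∣-∣-tri (seq x n * seq y k) (seq x n * seq y n) (seq z n) ⟩
      ∣ seq x n * seq y k - seq x n * seq y n ∣ + ∣ seq x n * seq y n - seq z n ∣
        ≤⟨ +-mono-≤
             (≤-trans (≤-reflexive (cong ∣_∣ (factor (seq x n) (seq y k) (seq y n))))
               (≤-trans (∣*∣-≤ {seq x n} {seq y k - seq y n} (hB n (ℕ.m⊔n≤o⇒m≤o L (M ℕ.⊔ N) len))
                 (hN k n (ℕ.m⊔n≤o⇒n≤o M N (ℕ.m⊔n≤o⇒n≤o L (M ℕ.⊔ N) lek)) (ℕ.m⊔n≤o⇒n≤o M N (ℕ.m⊔n≤o⇒n≤o L (M ℕ.⊔ N) len)))) Bη≤))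
             (hM n (ℕ.m⊔n≤o⇒m≤o M N (ℕ.m⊔n≤o⇒n≤o L (M ℕ.⊔ N) len))) ⟩
      ½ * ε + ½ * ε
        ≡⟨ ½+½ ε ⟩
      ε ∎
      where
      open ≤-Reasoning
      factor : ∀ x y w → x * y - x * w ≡ x * (y - w)
      factor = solve 3 (λ x y w → x :* y :- x :* w := x :* (y :- w)) refl

  4d²π²-near-3 : ∀ ε → 0ℚ < ε → ∃[ N ] (∀ n k → N ℕ.≤ n → N ℕ.≤ k →
    ∣ ι 4 * (seq δ n * seq δ n) * (seq π k * seq π k) - ι 3 ∣ ≤ ε)
  4d²π²-near-3 = two-indices (fromℕ 4 *ℝ (δ *ℝ δ)) (π *ℝ π) (fromℕ 3)
    (≃ℝ-trans {fromℕ 4 *ℝ (δ *ℝ δ) *ℝ (π *ℝ π)} {fromℕ 4 *ℝ ((δ *ℝ π) *ℝ (δ *ℝ π))} {fromℕ 3}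
      (pointwise {fromℕ 4 *ℝ (δ *ℝ δ) *ℝ (π *ℝ π)} {fromℕ 4 *ℝ ((δ *ℝ π) *ℝ (δ *ℝ π))}
        λ n → factor (ι 4) (seq δ n) (seq π n)) 4δ²π²≃3)
    where
    factor : ∀ c d p → c * (d * d) * (p * p) ≡ c * (d * p * (d * p))
    factor = solve 3 (λ c d p → c :* (d :* d) :* (p :* p) := c :* (d :* p :* (d :* p))) refl

  -- The n-th term of δ is itself n (3n)! / ((n!)³ 27ⁿ), so that this factorisation is exact and the
  -- asymptotics reduce to the limit of that term.
  T-ι : ∀ n → ι (T n) ≡ ι n * (seq δ n * ι (3 ℕ.^ (3 ℕ.* n)))
  T-ι n = begin
    ι (n ℕ.* E n)                                    ≡⟨ cong (λ e → ι (n ℕ.* e)) (E≡trinomial n) ⟩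
    ι (n ℕ.* (n ℕ.* trinomial n))                    ≡⟨ ι-* n (n ℕ.* trinomial n) ⟨
    ι n * ι (n ℕ.* trinomial n)                      ≡⟨ cong (ι n *_) (Trinomial.multiple n n) ⟨
    ι n * (seq δ n * ι (27 ℕ.^ n))                   ≡⟨ cong (λ k → ι n * (seq δ n * ι k)) (ℕ.^-*-assoc 3 3 n) ⟩
    ι n * (seq δ n * ι (3 ℕ.^ (3 ℕ.* n)))            ∎
    where open ≡-Reasoning

  leading : ℕ → ℝ
  leading n = divide (fromℕ n *ℝ √ 3) (fromℕ 2 *ℝ π) 2π#0 *ℝ fromℕ (3 ℕ.^ (3 ℕ.* n))

  0<2π : 0ℝ <ℝ fromℕ 2 *ℝ π
  0<2π = *ℝ-positive (fromℕ 2) π (fromℕ-positive 1) 0<π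

  nonZero⇒fromℕ-positive : ∀ n .{{_ : ℕ.NonZero n}} → 0ℝ <ℝ fromℕ n
  nonZero⇒fromℕ-positive (suc n) = fromℕ-positive n

  0<√3 : 0ℝ <ℝ √ 3
  0<√3 = 1ℚ , positive⁻¹ 1ℚ , 0 , λ k _ → subst (_≤ seq (√ 3) k) (sym (+-identityˡ 1ℚ)) (√-lower 1 3 k (s≤s z≤n))

  0<leading : ∀ n .{{_ : ℕ.NonZero n}} → 0ℝ <ℝ leading n
  0<leading n = *ℝ-positive (divide (fromℕ n *ℝ √ 3) (fromℕ 2 *ℝ π) 2π#0) (fromℕ (3 ℕ.^ (3 ℕ.* n)))
    (*ℝ-positive (fromℕ n *ℝ √ 3) (inverse (fromℕ 2 *ℝ π) 2π#0)
      (*ℝ-positive (fromℕ n) (√ 3) (nonZero⇒fromℕ-positive n) 0<√3) (inverse-positive (fromℕ 2 *ℝ π) 2π#0 0<2π))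
    (nonZero⇒fromℕ-positive (3 ℕ.^ (3 ℕ.* n)) {{ℕ.m^n≢0 3 (3 ℕ.* n)}})

  T-seq : ∀ n k → seq (fromℕ (T n)) k ≡ ι n * (seq δ n * ι (3 ℕ.^ (3 ℕ.* n)))
  T-seq n k = T-ι n

  leading-quotient : ∀ n k .{{_ : ℕ.NonZero n}} → 0ℚ < ι 2 * seq π k →
    ∣ seq (fromℕ (T n)) k * invℚ (seq (leading n) k) - 1ℚ ∣ ≤
    ∣ ι 4 * (seq δ n * seq δ n) * (seq π k * seq π k) - seq (√ 3) k * seq (√ 3) k ∣
  leading-quotient n k 0<2π = begin
    ∣ seq (fromℕ (T n)) k * invℚ (seq (leading n) k) - 1ℚ ∣
      ≡⟨ cong (λ t → ∣ t * invℚ (seq (leading n) k) - 1ℚ ∣) (T-seq n k) ⟩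
    ∣ ι n * (d * ι Q) * invℚ (ι n * s * invℚ (ι 2 * p) * ι Q) - 1ℚ ∣
      ≤⟨ quotient-error (ι n) (ι Q) d s (ι 2 * p)
           (positive⁻¹ (ι n) {{ι-positive n}}) (positive⁻¹ (ι Q) {{ι-positive Q {{ℕ.m^n≢0 3 (3 ℕ.* n)}}}})
           (Trinomial.0≤lo n) (√-lower 1 3 k (s≤s z≤n)) 0<2π ⟩
    ∣ d * (ι 2 * p) * (d * (ι 2 * p)) - s * s ∣
      ≡⟨ cong (λ y → ∣ y - s * s ∣) (double d p) ⟩
    ∣ ι 4 * (d * d) * (p * p) - s * s ∣ ∎
    where
    open ≤-Reasoning
    Q : ℕ
    Q = 3 ℕ.^ (3 ℕ.* n)
    d s p : ℚ
    d = seq δ n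
    s = seq (√ 3) k
    p = seq π k
    double : ∀ d p → d * (ι 2 * p) * (d * (ι 2 * p)) ≡ ι 4 * (d * d) * (p * p)
    double = solve 2 (λ d p → d :* (con (ι 2) :* p) :* (d :* (con (ι 2) :* p)) := con (ι 4) :* (d :* d) :* (p :* p)) refl

  quotient-near-1 : ∀ η → 0ℚ < η → ∃[ N ] (∀ n → 1 ℕ.≤ n → N ℕ.≤ n → ∃[ K ] (∀ k → K ℕ.≤ k →
    ∣ seq (fromℕ (T n)) k * invℚ (seq (leading n) k) - 1ℚ ∣ ≤ η))
  quotient-near-1 η 0<η = go (4d²π²-near-3 (½ * η) (0<½* 0<η)) (√-square 3 (½ * η) (0<½* 0<η)) 0<2π
    where
    go : ∃[ N ] (∀ n k → N ℕ.≤ n → N ℕ.≤ k → ∣ ι 4 * (seq δ n * seq δ n) * (seq π k * seq π k) - ι 3 ∣ ≤ ½ * η) →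
         ∃[ L ] (∀ k → L ℕ.≤ k → ∣ seq (√ 3) k * seq (√ 3) k - ι 3 ∣ ≤ ½ * η) →
         0ℝ <ℝ fromℕ 2 *ℝ π → ∃[ N ] (∀ n → 1 ℕ.≤ n → N ℕ.≤ n → ∃[ K ] (∀ k → K ℕ.≤ k →
           ∣ seq (fromℕ (T n)) k * invℚ (seq (leading n) k) - 1ℚ ∣ ≤ η))
    go (N , h) (L , h√) (ρ , 0<ρ , P , hπ) = N , λ n 1≤n N≤n → N ℕ.⊔ L ℕ.⊔ P , λ k le →
      let leN = ℕ.m⊔n≤o⇒m≤o N L (ℕ.m⊔n≤o⇒m≤o (N ℕ.⊔ L) P le)
          leL = ℕ.m⊔n≤o⇒n≤o N L (ℕ.m⊔n≤o⇒m≤o (N ℕ.⊔ L) P le)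
          leP = ℕ.m⊔n≤o⇒n≤o (N ℕ.⊔ L) P le
          d   = seq δ n
          s   = seq (√ 3) k
          p   = seq π k
      in ≤-trans (leading-quotient n k {{ℕ.>-nonZero 1≤n}} (<-≤-trans 0<ρ (subst (_≤ ι 2 * p) (+-identityˡ ρ) (hπ k leP))))
        (≤-trans (∣-∣-tri (ι 4 * (d * d) * (p * p)) (ι 3) (s * s))
        (≤-trans (+-mono-≤ (h n k N≤n leN) (subst (_≤ ½ * η) (∣-∣-sym (s * s) (ι 3)) (h√ k leL)))
          (≤-reflexive (½+½ η))))

  ∼-via-seq : ∀ (f g : ℕ → ℝ) M → (∀ n → M ℕ.≤ n → 0ℝ <ℝ g n) →
    (∀ η → 0ℚ < η → ∃[ N ] (∀ n → M ℕ.≤ n → N ℕ.≤ n → ∃[ K ] (∀ k → K ℕ.≤ k →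
      ∣ seq (f n) k * invℚ (seq (g n) k) - 1ℚ ∣ ≤ η))) → f ∼ g
  ∼-via-seq f g M 0<g close = M , (λ n M≤n → inj₂ (0<g n M≤n)) , λ ε (ρ , 0<ρ , K₀ , hε) →
    let (N , h) = close (½ * ρ) (0<½* 0<ρ)
    in N , λ n M≤n N≤n →
       let (K , hK) = h n M≤n N≤n
       -- One half of the rational margin ρ below ε bounds the error; the other half is the gap
       -- required by the strict inequality.
       in ½ * ρ , 0<½* 0<ρ , K ℕ.⊔ K₀ , λ k le →
          ≤-trans (+-monoˡ-≤ (½ * ρ) (hK k (ℕ.m⊔n≤o⇒m≤o K K₀ le)))
            (≤-trans (≤-reflexive (trans (½+½ ρ) (sym (+-identityˡ ρ)))) (hε k (ℕ.m⊔n≤o⇒n≤o K K₀ le)))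

  T∼leading : (λ n → fromℕ (T n)) ∼ leading
  -- The threshold is 1 because the leading term vanishes at n = 0 and cannot be a denominator
  -- there.
  T∼leading = ∼-via-seq (λ n → fromℕ (T n)) leading 1 (λ n 1≤n → 0<leading n {{ℕ.>-nonZero 1≤n}}) quotient-near-1

  -- The number of tiles and the exponential bound.

  tiles-square : ∀ n → tiles n n n n ≡ 6 ℕ.* n ℕ.^ 2
  tiles-square = lemma
    where
    lemma : ∀ n → n ℕ.* n ℕ.+ n ℕ.* n ℕ.+ (n ℕ.+ n) ℕ.* (n ℕ.+ n) ≡ 6 ℕ.* (n ℕ.* (n ℕ.* 1))
    lemma = solve-∀

  ι-^ : ∀ a k → ι a ^ k ≡ ι (a ℕ.^ k)
  ι-^ a zero    = refl
  ι-^ a (suc k) = trans (cong (ι a *_) (ι-^ a k)) (ι-* a (a ℕ.^ k))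

  ^-mono : ∀ {p q} → 0ℚ ≤ p → p ≤ q → ∀ k → p ^ k ≤ q ^ k
  ^-mono {p} {q} 0≤p p≤q zero    = ≤-refl
  ^-mono {p} {q} 0≤p p≤q (suc k) = *-mono 0≤p (Powers.0≤^ q (≤-trans 0≤p p≤q) k) p≤q (^-mono 0≤p p≤q k)

  0≤expTerm : ∀ {x} → 0ℚ ≤ x → ∀ k → 0ℚ ≤ expTerm x k
  0≤expTerm {x} 0≤x k = 0≤* (Powers.0≤^ x 0≤x k) (0≤1/! k)

  0≤expSum : ∀ {x} → 0ℚ ≤ x → ∀ k → 0ℚ ≤ expSum x k
  0≤expSum 0≤x zero    = ≤-refl
  0≤expSum 0≤x (suc k) = 0≤+ (0≤expSum 0≤x k) (0≤expTerm 0≤x k)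

  expTerm≤expSum : ∀ {x} → 0ℚ ≤ x → ∀ {n k} → n ℕ.<′ k → expTerm x n ≤ expSum x k
  expTerm≤expSum {x} 0≤x {n} (ℕ.≤′-reflexive refl) =
    subst (_≤ expSum x n + expTerm x n) (+-identityˡ (expTerm x n)) (+-monoˡ-≤ (expTerm x n) (0≤expSum 0≤x n))
  expTerm≤expSum {x} 0≤x {n} {suc k} (ℕ.≤′-step lt) =
    ≤-trans (expTerm≤expSum 0≤x lt) (p≤p+q {expSum x k} (0≤expTerm 0≤x k))

  n!≤n^n : ∀ n → n ! ℕ.≤ n ℕ.^ n
  n!≤n^n zero    = ℕ.≤-refl
  n!≤n^n (suc n) = ℕ.*-monoʳ-≤ (suc n) (ℕ.≤-trans (n!≤n^n n) (ℕ.^-monoˡ-≤ n (ℕ.n≤1+n n)))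

  -- The n-th term of the exponential series at a n is aⁿ nⁿ / n! ≥ aⁿ.
  ^≤expTerm : ∀ a n x → ι (a ℕ.* n) ≤ x → ι (a ℕ.^ n) ≤ expTerm x n
  ^≤expTerm a n x le = begin
    ι (a ℕ.^ n)                          ≡⟨ *-identityʳ (ι (a ℕ.^ n)) ⟨
    ι (a ℕ.^ n) * 1ℚ                     ≡⟨ cong (ι (a ℕ.^ n) *_) (trans (*-comm (ι (n !)) (1/! n)) (frac-ι 1 (n !) {{n ℕ.!≢0}})) ⟨
    ι (a ℕ.^ n) * (ι (n !) * 1/! n)      ≡⟨ *-assoc (ι (a ℕ.^ n)) (ι (n !)) (1/! n) ⟨
    ι (a ℕ.^ n) * ι (n !) * 1/! n        ≡⟨ cong (_* 1/! n) (ι-* (a ℕ.^ n) (n !)) ⟩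
    ι (a ℕ.^ n ℕ.* n !) * 1/! n          ≤⟨ *-monoʳ-≤-nonNeg (1/! n) {{nonNegative (0≤1/! n)}} (ι-≤ power≤) ⟩
    ι ((a ℕ.* n) ℕ.^ n) * 1/! n          ≡⟨ cong (_* 1/! n) (ι-^ (a ℕ.* n) n) ⟨
    ι (a ℕ.* n) ^ n * 1/! n              ≤⟨ *-monoʳ-≤-nonNeg (1/! n) {{nonNegative (0≤1/! n)}} (^-mono (0≤ι (a ℕ.* n)) le n) ⟩
    x ^ n * 1/! n                        ∎
    where
    open ≤-Reasoning
    power≤ : a ℕ.^ n ℕ.* n ! ℕ.≤ (a ℕ.* n) ℕ.^ n
    power≤ = subst (a ℕ.^ n ℕ.* n ! ℕ.≤_) (sym ([m*n]^k≡m^k*n^k a n n)) (ℕ.*-monoʳ-≤ (a ℕ.^ n) (n!≤n^n n))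

  -- All terms of δ are at most 1; this is why the implied constant of the final bound can be 1.
  T≤ : ∀ n → ι (T n) ≤ ι n * ι (27 ℕ.^ n)
  T≤ n = ≤-trans (≤-reflexive (trans (T-ι n) (cong (λ k → ι n * (seq δ n * ι k)) (sym (ℕ.^-*-assoc 3 3 n)))))
    (*-monoˡ-≤-nonNeg (ι n) {{nonNegative (0≤ι n)}} (≤-trans
      (*-monoʳ-≤-nonNeg (ι (27 ℕ.^ n)) {{nonNegative (0≤ι (27 ℕ.^ n))}} (Trinomial.lo≤1 n))
      (≤-reflexive (*-identityˡ (ι (27 ℕ.^ n))))))

  -- With N = 6n² tiles, n² ≤ N gives n ≤ √N at every index. The exponential is bounded below by its
  -- n-th term alone, which at an argument of at least 27n is at least 27ⁿ: hence the generous γ =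
  -- 27. The condition n < k puts that term into the k-th partial sum.
  T≤√exp√ : ∀ n k → n ℕ.< k → ι (T n) ≤ seq (√ (tiles n n n n) *ℝ exp (fromℕ 27 *ℝ √ (tiles n n n n))) k
  T≤√exp√ n k n<k = ≤-trans (T≤ n) (*-mono (0≤ι n) (0≤expSum 0≤x k) n≤s
    (≤-trans (^≤expTerm 27 n x 27n≤x) (expTerm≤expSum 0≤x (ℕ.≤⇒≤′ n<k))))
    where
    s x : ℚ
    s = seq (√ (tiles n n n n)) k
    x = ι 27 * s
    n≤s : ι n ≤ s
    n≤s = √-lower n (tiles n n n n) k (ℕ.≤-trans (ℕ.m≤m+n (n ℕ.* n) (n ℕ.* n)) (ℕ.m≤m+n (n ℕ.* n ℕ.+ n ℕ.* n) ((n ℕ.+ n) ℕ.* (n ℕ.+ n))))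
    27n≤x : ι (27 ℕ.* n) ≤ x
    27n≤x = subst (_≤ x) (ι-* 27 n) (*-monoˡ-≤-nonNeg (ι 27) {{nonNegative (0≤ι 27)}} n≤s)
    0≤x : 0ℚ ≤ x
    0≤x = 0≤* (0≤ι 27) (≤-trans (0≤ι n) n≤s)

  T=O : (λ n → fromℕ (T n)) =O (λ n → √ (tiles n n n n) *ℝ exp (fromℕ 27 *ℝ √ (tiles n n n n)))
  T=O = 1ℝ , fromℕ-positive 0 , 0 , λ n _ ε 0<ε → suc n , λ k n<k →
    let y = seq (√ (tiles n n n n) *ℝ exp (fromℕ 27 *ℝ √ (tiles n n n n))) k
    in ≤-trans (≤-reflexive (0≤p⇒∣p∣≡p (0≤ι (T n)))) (≤-trans (T≤√exp√ n k n<k)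
      (≤-trans (p≤∣p∣ y) (≤-trans (≤-reflexive (sym (*-identityˡ ∣ y ∣))) (p≤p+q {1ℚ * ∣ y ∣} (<⇒≤ 0<ε)))))

  T-exact : ∀ n → + T n / 1 ≡ (+ (n ℕ.^ 2) / 1) * (+ ((3 ℕ.* n) !) / ((n !) ℕ.^ 3)) {{n!^k≢0 n 3}}
  T-exact n = *-cancelʳ (ι ((n !) ℕ.^ 3)) {{ι-positive ((n !) ℕ.^ 3) {{n!^k≢0 n 3}}}} (begin
    ι (T n) * ι ((n !) ℕ.^ 3)
      ≡⟨ ι-* (T n) ((n !) ℕ.^ 3) ⟩
    ι (T n ℕ.* (n !) ℕ.^ 3)
      ≡⟨ cong ι (trans (left n (E n) (n !)) (trans (cong (n ℕ.*_) (E-! n)) (trans (right n ((n ℕ.+ n ℕ.+ n) !)) (cong (λ k → n ℕ.^ 2 ℕ.* k !) (triple n))))) ⟩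
    ι (n ℕ.^ 2 ℕ.* (3 ℕ.* n) !)
      ≡⟨ ι-* (n ℕ.^ 2) ((3 ℕ.* n) !) ⟨
    ι (n ℕ.^ 2) * ι ((3 ℕ.* n) !)
      ≡⟨ cong (ι (n ℕ.^ 2) *_) (frac-ι ((3 ℕ.* n) !) ((n !) ℕ.^ 3) {{n!^k≢0 n 3}}) ⟨
    ι (n ℕ.^ 2) * (q * ι ((n !) ℕ.^ 3))
      ≡⟨ *-assoc (ι (n ℕ.^ 2)) q (ι ((n !) ℕ.^ 3)) ⟨
    ι (n ℕ.^ 2) * q * ι ((n !) ℕ.^ 3) ∎)
    where
    open ≡-Reasoning
    q : ℚ
    q = (+ ((3 ℕ.* n) !) / ((n !) ℕ.^ 3)) {{n!^k≢0 n 3}}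
    left : ∀ n e x → n ℕ.* e ℕ.* (x ℕ.* (x ℕ.* (x ℕ.* 1))) ≡ n ℕ.* (x ℕ.* x ℕ.* x ℕ.* e)
    left = solve-∀
    right : ∀ n x → n ℕ.* (n ℕ.* x) ≡ n ℕ.* (n ℕ.* 1) ℕ.* x
    right = solve-∀
    triple : ∀ n → n ℕ.+ n ℕ.+ n ≡ 3 ℕ.* n
    triple = solve-∀

open import Data.Integer.Base using (+_)
open import Data.Nat.Base using (_*_; _^_; _≤_; _!)
open import Data.Product.Base using (_×_; _,_; ∃-syntax)
open import Data.Rational.Base as ℚ using (_/_)
open import Relation.Binary.PropositionalEquality using (_≡_)

mainTheorem2 :
    (∀ n → 1 ≤ n → + T n / 1 ≡ (+ (n ^ 2) / 1) ℚ.* (+ ((3 * n) !) / ((n !) ^ 3)) {{n!^k≢0 n 3}})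
    × (λ n → fromℕ (T n)) ∼ (λ n → divide (fromℕ n *ℝ √ 3) (fromℕ 2 *ℝ π) 2π#0 *ℝ fromℕ (3 ^ (3 * n)))
    × (∀ n → tiles n n n n ≡ 6 * n ^ 2)
    × ∃[ γ ] (0ℝ <ℝ γ × (λ n → fromℕ (T n)) =O (λ n → √ (tiles n n n n) *ℝ exp (γ *ℝ √ (tiles n n n n))))
mainTheorem2 = (λ n _ → T-exact n) , T∼leading , tiles-square , fromℕ 27 , fromℕ-positive 26 , T=O
  where open Limits
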